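{- Let $k_1,k_2,k_3\ge2$ be integers and $\mathrm{d}=q\frac{d}{dq}$. With $g^{\mathrm{sh}}$, $\mathfrak{g}^{\mathrm{sh}}$, $\operatorname{ds}$ and $\mathcal{G}^{\mathrm{sh}}_{\le k}$ as defined in the context: (i) $$\mathrm{d}\,g^{\mathrm{sh}}_{k_1,k_2}\equiv 2k_1\Big(\mathfrak{g}^{\mathrm{sh}}(\operatorname{ds}(e_1,e_{k_1+1}e_{k_2}))-\mathfrak{g}^{\mathrm{sh}}(\operatorname{ds}(e_{k_2},e_{k_1+1}e_1))\Big)+2k_2\,\mathfrak{g}^{\mathrm{sh}}(\operatorname{ds}(e_1,e_{k_1}e_{k_2+1}))\mod \mathcal{G}^{\mathrm{sh}}_{\le k_1+k_2+1}.$$ (ii) $$\begin{aligned}\mathrm{d}\,g^{\mathrm{sh}}_{k_1,k_2,k_3}\equiv\;&2k_1\,\mathfrak{g}^{\mathrm{sh}}\big(\operatorname{ds}(e_1,e_{k_1+1}e_{k_2}e_{k_3})+\operatorname{ds}(e_{k_3},e_{k_2}e_{k_1+1}e_1)\big)\\&+2k_1\,\mathfrak{g}^{\mathrm{sh}}\big(\operatorname{ds}(e_{k_3},e_{k_1+1+k_2}e_1)-\operatorname{ds}(e_{k_1+1}e_1,e_{k_2}e_{k_3})\big)\\&+2k_2\,\mathfrak{g}^{\mathrm{sh}}\big(\operatorname{ds}(e_1,e_{k_1}e_{k_2+1}e_{k_3})-\operatorname{ds}(e_{k_3},e_{k_1}e_{k_2+1}e_1)\big)\\&+2k_3\,\mathfrak{g}^{\mathrm{sh}}\big(\operatorname{ds}(e_1,e_{k_1}e_{k_2}e_{k_3+1})\big)\mod\mathcal{G}^{\mathrm{sh}}_{\le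 k_1+k_2+k_3+1}.\end{aligned}$$ Here $f\equiv h \bmod V$ means $f-h\in V$.
   Context: Words and products. Let $\mathfrak{H}=\mathbb{Q}\langle e_0,e_1\rangle$ be the noncommutative polynomial algebra, $\mathfrak{H}^1=\mathbb{Q}\cdot 1+e_1\mathfrak{H}$, and $e_k=e_1e_0^{k-1}$ for $k\ge1$; the monomials $e_{k_1}\cdots e_{k_r}$ ($r\ge 0$, $k_i\ge 1$) form a basis of $\mathfrak{H}^1$. The shuffle product $\sqcup\!\sqcup$ on $\mathfrak{H}$ is the $\mathbb{Q}$-bilinear product with $1\sqcup\!\sqcup w=w\sqcup\!\sqcup 1=w$ and $av\sqcup\!\sqcup bw=a(v\sqcup\!\sqcup bw)+b(av\sqcup\!\sqcup w)$ for $a,b\in\{e_0,e_1\}$, $v,w\in\mathfrak{H}$; $\mathfrak{H}^1$ is closed under it. The harmonic product $\ast$ on $\mathfrak{H}^1$ is the $\mathbb{Q}$-bilinear product with $1\ast w=w\ast1=w$ and $e_{k_1}v\ast e_{k_2}w=e_{k_1}(v\ast e_{k_2}w)+e_{k_2}(e_{k_1}v\ast w)+e_{k_1+k_2}(v\ast w)$ for $k_1,k_2\geq 1$, $v,w\in\mathfrak{H}^1$. For $u,v\in\mathfrak{H}^1$ put $\operatorname{ds}(u,v)=u\ast v-u\sqcup\!\sqcup v\in\mathfrak{H}^1$. The $q$-series. For integers $n_1,\dots,n_m\ge 1$ set $$H\binom{n_1,\dots,n_m}{X_1,\dots,X_m} = \sum_{0<d_1<\dots<d_m} e^{d_1X_1}\left(\frac{q^{d_1}}{1-q^{d_1}}\right)^{n_1}\cdots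 e^{d_mX_m}\left(\frac{q^{d_m}}{1-q^{d_m}}\right)^{n_m}.$$ The $q$-series $g^{\mathrm{sh}}_{k_1,\dots,k_r}\in\mathbb{Q}[[q]]$ ($r\ge 1$, $k_i\ge1$) are defined by $$\sum_{k_1,\dots,k_r\ge1} g^{\mathrm{sh}}_{k_1,\dots,k_r}X_1^{k_1-1}\cdots X_r^{k_r-1} := \sum_{m=1}^{r}\ \sum_{\substack{i_1+\dots+i_m=r\\ i_1,\dots,i_m\ge1}}\frac{1}{i_1!\cdots i_m!}\,H\binom{i_1,\,i_2,\,\dots,\,i_m}{X_r-X_{r-i_1},\;X_{r-i_1}-X_{r-i_1-i_2},\;\dots,\;X_{i_m}},$$ i.e. the $j$-th lower entry is $X_{r-i_1-\dots-i_{j-1}}-X_{r-i_1-\dots-i_j}$ with $X_0=0$. For $r=0$ the series is $1$. The $\mathbb{Q}$-linear map $\mathfrak{g}^{\mathrm{sh}}:\mathfrak{H}^1\to\mathbb{Q}[[q]]$ is defined by $\mathfrak{g}^{\mathrm{sh}}(1)=1$ and $\mathfrak{g}^{\mathrm{sh}}(e_{k_1}\cdots e_{k_r})=g^{\mathrm{sh}}_{k_1,\dots,k_r}$. For $k\ge1$, $\mathcal{G}^{\mathrm{sh}}_{\le k}$ is the $\mathbb{Q}$-span in $\mathbb{Q}[[q]]$ of all $g^{\mathrm{sh}}_{k_1,\dots,k_r}$ with $0\le r\le k$, $k_i\ge 1$ and $k_1+\dots+k_r\le k$. -}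

module Defs where

open import Data.Nat.Base as ℕ using (ℕ; zero; suc; pred; _∸_; _≤_; _!)
open import Data.Nat.Divisibility using (_∣?_)
open import Data.Nat.ListAction using (sum)
open import Data.Nat.Properties using (_!≢0)
open import Data.Integer.Base using (+_)
open import Data.Rational.Base using (ℚ; 0ℚ; 1ℚ; _+_; _-_; _*_; -_; _/_)
open import Data.Bool.Base using (if_then_else_)
open import Data.List.Base using (List; []; _∷_; _++_; length; map; concatMap; foldr; replicate; upTo)
open import Data.List.Relation.Unary.All using (All)
open import Data.Vec.Base as Vec using (Vec; []; _∷_)
open import Data.Product.Base using (_×_; _,_; ∃; map₁; map₂; proj₂)
open import Relation.Binary.PropositionalEquality using (_≗_)
open import Relation.Nullary.Decidable.Core using (does)

infixr 8 _^ˣ_ _^q_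
infixr 7 _•_ _•q_ _•ˣ_
infixl 7 _*q_ _*ˣ_ _⧢_ _⧢ʷ_ _∗_ _∗ʷ_
infixl 6 _+q_ _-q_ _-ˣ_ _⊕_ _⊖_
infix  4 _≡_mod_

ℕ→ℚ : ℕ → ℚ
ℕ→ℚ n = + n / 1

1/_! : ℕ → ℚ
1/ n ! = + 1 / (n !)
  where instance _ = n !≢0

-- range a b is a, a+1, …, b (empty if b < a).
range : ℕ → ℕ → List ℕ
range a b = map (a ℕ.+_) (upTo (suc b ∸ a))

∑ : {A : Set} → List A → (A → ℚ) → ℚ
∑ xs f = foldr (λ x s → f x + s) 0ℚ xs

syntax ∑ xs (λ x → t) = ∑[ x ∈ xs ] t

-- Formal ℚ-linear combinations of elements of A.  Two lists denote the same
-- element of the free vector space when they agree after collecting terms;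
-- only maps that respect this are applied to them.
Lin : Set → Set
Lin A = List (ℚ × A)

_⊕_ : {A : Set} → Lin A → Lin A → Lin A
_⊕_ = _++_

_•_ : {A : Set} → ℚ → Lin A → Lin A
c • u = map (map₁ (c *_)) u

_⊖_ : {A : Set} → Lin A → Lin A → Lin A
u ⊖ v = u ⊕ (- 1ℚ) • v

single : {A : Set} → A → Lin A
single a = (1ℚ , a) ∷ []

mapLin : {A B : Set} → (A → B) → Lin A → Lin B
mapLin f = map (map₂ f)

linear : {A B : Set} → (A → Lin B) → Lin A → Lin B
linear f = concatMap (λ (c , a) → c • f a)

bilinear : {A B C : Set} → (A → B → Lin C) → Lin A → Lin B → Lin C
bilinear f u v = linear (λ a → linear (f a) v) u

data Letter : Set where
  e₀ e₁ : Letter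

ℌ : Set
ℌ = Lin (List Letter)

-- The list k₁ ∷ … ∷ kᵣ ∷ [] stands for the basis monomial e_{k₁}⋯e_{kᵣ} of ℌ¹.
-- Only lists of positive integers are meaningful.
ℌ¹ : Set
ℌ¹ = Lin (List ℕ)

e : List ℕ → ℌ¹
e = single

encode : List ℕ → List Letter
encode []      = []
encode (k ∷ w) = e₁ ∷ replicate (pred k) e₀ ++ encode w

leading₀ : List Letter → ℕ
leading₀ (e₀ ∷ w) = suc (leading₀ w)
leading₀ _        = 0

-- Inverse to encode on words that are empty or start with e₁, that is, on the
-- words of ℌ¹; on other words the leading e₀'s are lost.
decode : List Letter → List ℕ
decode []       = []
decode (e₀ ∷ w) = decode w
decode (e₁ ∷ w) = suc (leading₀ w) ∷ decode w

_⧢ʷ_ : List Letter → List Letter → ℌ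
[]      ⧢ʷ w       = single w
(a ∷ v) ⧢ʷ []      = single (a ∷ v)
(a ∷ v) ⧢ʷ (b ∷ w) = mapLin (a ∷_) (v ⧢ʷ (b ∷ w)) ⊕ mapLin (b ∷_) ((a ∷ v) ⧢ʷ w)

_⧢_ : ℌ → ℌ → ℌ
_⧢_ = bilinear _⧢ʷ_

_∗ʷ_ : List ℕ → List ℕ → ℌ¹
[]      ∗ʷ w       = single w
(k ∷ v) ∗ʷ []      = single (k ∷ v)
(k ∷ v) ∗ʷ (l ∷ w) = mapLin (k ∷_) (v ∗ʷ (l ∷ w))
                   ⊕ mapLin (l ∷_) ((k ∷ v) ∗ʷ w)
                   ⊕ mapLin (k ℕ.+ l ∷_) (v ∗ʷ w)

_∗_ : ℌ¹ → ℌ¹ → ℌ¹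
_∗_ = bilinear _∗ʷ_

-- The shuffle product is formed in ℌ.  Its terms are words of ℌ¹, because a
-- shuffle of words starting with e₁ starts with e₁, so decode loses nothing.
ds : ℌ¹ → ℌ¹ → ℌ¹
ds u v = (u ∗ v) ⊖ mapLin decode (mapLin encode u ⧢ mapLin encode v)

-- f n is the coefficient of qⁿ.
ℚ[[q]] : Set
ℚ[[q]] = ℕ → ℚ

1q : ℚ[[q]]
1q zero    = 1ℚ
1q (suc _) = 0ℚ

_+q_ _-q_ _*q_ : ℚ[[q]] → ℚ[[q]] → ℚ[[q]]
(f +q g) n = f n + g n
(f -q g) n = f n - g n
(f *q g) n = ∑[ i ∈ range 0 n ] (f i * g (n ∸ i))

_•q_ : ℚ → ℚ[[q]] → ℚ[[q]]
(c •q f) n = c * f n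

_^q_ : ℚ[[q]] → ℕ → ℚ[[q]]
f ^q zero  = 1q
f ^q suc n = f *q f ^q n

-- q d/dq
d : ℚ[[q]] → ℚ[[q]]
d f n = ℕ→ℚ n * f n

-- q^d / (1 - q^d) = q^d + q^{2d} + q^{3d} + ⋯, for d ≥ 1.
geometric : ℕ → ℚ[[q]]
geometric d zero    = 0ℚ
geometric d (suc n) = if does (d ∣? suc n) then 1ℚ else 0ℚ

-- ℚ[[X₁, …, Xᵣ]]; f α is the coefficient of X^α = X₁^α₁ ⋯ Xᵣ^αᵣ.
Series : ℕ → Set
Series r = Vec ℕ r → ℚ

0ˣ : ∀ {r} → Series r
0ˣ _ = 0ℚ

1ˣ : ∀ {r} → Series r
1ˣ []          = 1ℚ
1ˣ (zero  ∷ α) = 1ˣ α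
1ˣ (suc _ ∷ _) = 0ℚ

_-ˣ_ : ∀ {r} → Series r → Series r → Series r
(f -ˣ g) α = f α - g α

_•ˣ_ : ∀ {r} → ℚ → Series r → Series r
(c •ˣ f) α = c * f α

_*ˣ_ : ∀ {r} → Series r → Series r → Series r
_*ˣ_ {zero}  f g []      = f [] * g []
_*ˣ_ {suc r} f g (n ∷ α) =
  ∑[ i ∈ range 0 n ] ((λ β → f (i ∷ β)) *ˣ (λ β → g (n ∸ i ∷ β))) α

_^ˣ_ : ∀ {r} → Series r → ℕ → Series r
f ^ˣ zero  = 1ˣ
f ^ˣ suc n = f *ˣ f ^ˣ n

-- The exponential of a series with zero constant term: fⁿ has no terms of
-- degree below n, so only the n ≤ |α| contribute to the coefficient of X^α.
exp : ∀ {r} → Series r → Series r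
exp f α = ∑[ n ∈ range 0 (Vec.sum α) ] (1/ n ! * (f ^ˣ n) α)

-- X j is the variable Xⱼ for 1 ≤ j ≤ r, and X 0 = 0.
X : ∀ {r} → ℕ → Series r
X zero          _                 = 0ℚ
X (suc _)       []                = 0ℚ
X (suc zero)    (suc zero    ∷ α) = 1ˣ α
X (suc zero)    (_           ∷ _) = 0ℚ
X (suc (suc j)) (zero        ∷ α) = X (suc j) α
X (suc (suc _)) (suc _       ∷ _) = 0ℚ

-- All (d₁, …, dₘ) with a < d₁ < ⋯ < dₘ ≤ b.
increasing : (m a b : ℕ) → List (Vec ℕ m)
increasing zero    a b = [] ∷ []
increasing (suc m) a b =
  concatMap (λ d₁ → map (d₁ ∷_) (increasing m d₁ b)) (range (suc a) b)

-- All (i₁, …, iₘ) with iⱼ ≥ 1 and i₁ + ⋯ + iₘ = r.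
compositions : (m r : ℕ) → List (Vec ℕ m)
compositions zero    zero    = [] ∷ []
compositions zero    (suc _) = []
compositions (suc m) r       =
  concatMap (λ i → map (i ∷_) (compositions m (r ∸ i))) (range 1 r)

-- H n Y α N is the coefficient of X^α q^N in
--   Σ_{0<δ₁<⋯<δₘ} Πⱼ e^{δⱼYⱼ} (q^{δⱼ}/(1-q^{δⱼ}))^{nⱼ},
-- for series Yⱼ in X₁, …, Xᵣ with zero constant term and nⱼ ≥ 1.  A summand is
-- a series in X times a series in q, and the latter is divisible by q^{δₘ}, so
-- only tuples with δₘ ≤ N contribute.
H : ∀ {r m} → Vec ℕ m → Vec (Series r) m → Vec ℕ r → ℚ[[q]]
H {r} {m} n Y α N = ∑[ δ ∈ increasing m 0 N ]
  ( Vec.foldr′ _*ˣ_ 1ˣ (Vec.zipWith (λ δⱼ Yⱼ → exp (ℕ→ℚ δⱼ •ˣ Yⱼ)) δ Y) α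
  * Vec.foldr′ _*q_ 1q (Vec.zipWith (λ δⱼ nⱼ → geometric δⱼ ^q nⱼ) δ n) N )

-- The lower entries X_s - X_{s-i₁}, X_{s-i₁} - X_{s-i₁-i₂}, …
lowerEntries : ∀ {r m} → ℕ → Vec ℕ m → Vec (Series r) m
lowerEntries s []       = []
lowerEntries s (i ∷ is) = (X s -ˣ X (s ∸ i)) ∷ lowerEntries (s ∸ i) is

-- The coefficient of X^α in the generating series of depth r ≥ 1.
generating : (r : ℕ) → Vec ℕ r → ℚ[[q]]
generating r α N =
  ∑[ m ∈ range 1 r ] ∑[ i ∈ compositions m r ]
    (Vec.foldr′ (λ iⱼ c → 1/ iⱼ ! * c) 1ℚ i * H i (lowerEntries r i) α N)

gˢʰ : List ℕ → ℚ[[q]]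
gˢʰ []        = 1q
gˢʰ w@(_ ∷ _) = generating (length w) (Vec.map pred (Vec.fromList w))

𝔤ˢʰ : ℌ¹ → ℚ[[q]]
𝔤ˢʰ u n = ∑[ (c , w) ∈ u ] (c * gˢʰ w n)

𝒢ˢʰ≤ : ℕ → ℚ[[q]] → Set
𝒢ˢʰ≤ k f = ∃ λ (u : ℌ¹) →
  All (λ (_ , w) → length w ≤ k × All (1 ≤_) w × sum w ≤ k) u × f ≗ 𝔤ˢʰ u

_≡_mod_ : ℚ[[q]] → ℚ[[q]] → (ℚ[[q]] → Set) → Set
f ≡ h mod V = V (f -q h)

module Submission where

-- Put L_s = q^s/(1 − q^s).  In ℚ[[q]][[t]] let Λ multiply the coefficient of t^s by L_s and let
-- φ_k = Σ_{u≥1} u^{k−1}/(k−1)! t^u.  The identity L_a L_b = L_{a+b}(1 + L_a + L_b) makes Λ a Rota–Baxter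
-- operator of weight 1, so the series Γ(k₁,…,k_r) = Λ(φ_{k₁} Λ(φ_{k₂} ⋯)) multiply by a quasi-shuffle in which
-- two letters merge to φ_k φ_l, and by Faulhaber's formula φ_k φ_l is φ_{k+l} plus a combination of φ_j, j < k+l.
-- Setting t = 1 turns Γ(w) into gˢʰ(w) when all letters but the last are at least 2; a letter 1 in another place
-- adds ½ times the same nested sum with one factor L replaced by L².  Hence, up to lower weight, 𝔤ˢʰ(ds(v,w))
-- is half the sum of the terms with one L² coming from the stuffle product.  Since q d/dq L_s = s(L_s + L_s²), the
-- derivative of gˢʰ is, up to lower weight, a sum of terms with one L² as well, and the two sides match.
--
-- The shuffle product formula 𝔤ˢʰ(v ⧢ w) = 𝔤ˢʰ(v) 𝔤ˢʰ(w), which turns the shuffle part of ds into a product,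
-- holds because gˢʰ(w) is the coefficient of w in the path-ordered product ⋯ exp(L₂e₁) exp(e₀) exp(L₁e₁) exp(e₀)
-- of group-like elements.

open import Algebra.Bundles using (CommutativeRing)
import Algebra.Solver.Ring as RingSolver
open import Algebra.Solver.Ring.AlmostCommutativeRing using (fromCommutativeRing; _-Raw-AlmostCommutative⟶_)
open import Algebra.Properties.CommutativeSemigroup using (interchange)
open import Data.Bool.Base using (true; false; if_then_else_)
import Data.Integer.Base as ℤ
import Data.Integer.Properties as ℤₚ
open import Data.List.Base as List using (List; []; _∷_; _++_; map; concatMap; foldr; length; replicate; upTo; applyUpTo)
import Data.List.Properties as Listₚ
open import Data.List.Relation.Unary.All as All using (All; []; _∷_)
import Data.List.Relation.Unary.All.Properties as Allₚ
open import Data.Maybe.Base using (Maybe; just; nothing)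
open import Data.Nat.Base as ℕ using (ℕ; zero; suc; pred; _∸_; _!; _≤_; _<_; z≤n; s≤s; _≡ᵇ_; NonZero)
open import Data.Nat.Divisibility using (_∣_; _∣?_; ∣m+n∣m⇒∣n; ∣m∣n⇒∣m+n; ∣-refl; ∣⇒≤)
open import Data.Nat.ListAction using (sum)
import Data.Nat.Properties as ℕₚ
open ℕₚ using (≤-trans; ≤-refl; +-monoʳ-≤; +-monoˡ-≤; m≤n⇒m≤1+n; m≤m+n; m≤n+m; <⇒≤)
open import Data.Nat.Solver using () renaming (module +-*-Solver to ℕSolver)
open import Data.Product.Base using (_×_; _,_; proj₁; proj₂)
open import Data.Rational.Base as ℚ using (ℚ; 0ℚ; 1ℚ; ½)
import Data.Rational.Properties as ℚₚ
open import Data.Rational.Unnormalised.Base as ℚᵘ using (mkℚᵘ; *≡*)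
import Data.Rational.Unnormalised.Properties as ℚᵘₚ
open import Data.Sum.Base using (_⊎_; inj₁; inj₂)
open import Data.Vec.Base as Vec using (Vec; []; _∷_)
open import Function.Base using (_∘_; id)
open import Function.Bundles using (mk⇔)
open import Level using (0ℓ)
open import Relation.Binary.PropositionalEquality as ≡ using (_≡_; _≗_)
open import Relation.Nullary.Decidable using (yes; no; dec-true; dec-false; does-⇔)
open import Relation.Nullary.Negation using (¬_)
import Defs
open Defs using (ℕ→ℚ; 1/_!; ℌ; ℌ¹; Letter; e₀; e₁; encode; mapLin; _⧢ʷ_; _∗ʷ_; geometric; d)

-- Why the two sides match. The summation index s at the letter k_i is the sum of the gaps of k_i,
-- ..., k_r, so the factor s in q d/dq L_s = s(L_s + L_s²) raises each of these letters in turn: k_j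
-- is raised together with L² at position i for every i ≤ j. On the other side, ds(e_1, w) inserts
-- the letter 1 in front of every letter of w and gives ½ of L² at every position, hence the factors
-- 2; the remaining ds-terms delete the positions after j. In depth 2, with a = k_1 + 1 and b = k_2,
-- ds(e_b, e_a e_1) deletes position 2. In depth 3, with also c = k_3, ds(e_a e_1, e_b e_c) deletes
-- positions 2 and 3 at the price of two new terms, from the words b,a,1,c and a+b,1,c, which
-- ds(e_c, e_b e_a e_1) and ds(e_c, e_{a+b} e_1) compensate. The obstacle: merging a with b also
-- leaves nested sums with letters j,1,c, j < a + b, which differ from the series of the word by a
-- term with L² at the smaller of two indices. That this term has lower weight follows from ds(e_c,
-- e_j e_1).

ℕ→ℚ-+ : ∀ m n → ℕ→ℚ (m ℕ.+ n) ≡ ℕ→ℚ m ℚ.+ ℕ→ℚ n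
ℕ→ℚ-+ m n = ℚₚ.toℚᵘ-injective (begin
  ℚ.toℚᵘ (ℕ→ℚ (m ℕ.+ n))  ≈⟨ ℚₚ.toℚᵘ-fromℚᵘ (mkℚᵘ (ℤ.+ (m ℕ.+ n)) 0) ⟩
  mkℚᵘ (ℤ.+ (m ℕ.+ n)) 0  ≈⟨ *≡* (≡.cong (ℤ._* ℤ.+ 1) (≡.sym (≡.cong₂ ℤ._+_ (ℤₚ.*-identityʳ (ℤ.+ m)) (ℤₚ.*-identityʳ (ℤ.+ n))))) ⟩
  mkℚᵘ (ℤ.+ m) 0 ℚᵘ.+ mkℚᵘ (ℤ.+ n) 0  ≈⟨ ℚᵘₚ.+-cong (ℚₚ.toℚᵘ-fromℚᵘ (mkℚᵘ (ℤ.+ m) 0)) (ℚₚ.toℚᵘ-fromℚᵘ (mkℚᵘ (ℤ.+ n) 0)) ⟨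
  ℚ.toℚᵘ (ℕ→ℚ m) ℚᵘ.+ ℚ.toℚᵘ (ℕ→ℚ n)  ≈⟨ ℚₚ.toℚᵘ-homo-+ (ℕ→ℚ m) (ℕ→ℚ n) ⟨
  ℚ.toℚᵘ (ℕ→ℚ m ℚ.+ ℕ→ℚ n)  ∎)
  where open ℚᵘₚ.≃-Reasoning

ℕ→ℚ-* : ∀ m n → ℕ→ℚ (m ℕ.* n) ≡ ℕ→ℚ m ℚ.* ℕ→ℚ n
ℕ→ℚ-* zero    n = ≡.sym (ℚₚ.*-zeroˡ (ℕ→ℚ n))
ℕ→ℚ-* (suc m) n = begin
  ℕ→ℚ (n ℕ.+ m ℕ.* n)  ≡⟨ ℕ→ℚ-+ n (m ℕ.* n) ⟩
  ℕ→ℚ n ℚ.+ ℕ→ℚ (m ℕ.* n)  ≡⟨ ≡.cong₂ ℚ._+_ (≡.sym (ℚₚ.*-identityˡ (ℕ→ℚ n))) (ℕ→ℚ-* m n) ⟩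
  1ℚ ℚ.* ℕ→ℚ n ℚ.+ ℕ→ℚ m ℚ.* ℕ→ℚ n ≡⟨ ℚₚ.*-distribʳ-+ (ℕ→ℚ n) 1ℚ (ℕ→ℚ m) ⟨
  (1ℚ ℚ.+ ℕ→ℚ m) ℚ.* ℕ→ℚ n  ≡⟨ ≡.cong (ℚ._* ℕ→ℚ n) (ℕ→ℚ-+ 1 m) ⟨
  ℕ→ℚ (suc m) ℚ.* ℕ→ℚ n  ∎
  where open ≡.≡-Reasoning

ℕ→ℚ-suc : ∀ n → ℕ→ℚ (suc n) ≡ ℕ→ℚ n ℚ.+ 1ℚ
ℕ→ℚ-suc n = ≡.trans (ℕ→ℚ-+ 1 n) (ℚₚ.+-comm 1ℚ (ℕ→ℚ n))

ℕ→ℚ-inverse : ∀ n → ℕ→ℚ (suc n) ℚ.* (ℤ.+ 1 ℚ./ suc n) ≡ 1ℚ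
ℕ→ℚ-inverse n = ℚₚ.toℚᵘ-injective (begin
  ℚ.toℚᵘ (ℕ→ℚ (suc n) ℚ.* (ℤ.+ 1 ℚ./ suc n))  ≈⟨ ℚₚ.toℚᵘ-homo-* (ℕ→ℚ (suc n)) (ℤ.+ 1 ℚ./ suc n) ⟩
  ℚ.toℚᵘ (ℕ→ℚ (suc n)) ℚᵘ.* ℚ.toℚᵘ (ℤ.+ 1 ℚ./ suc n)
    ≈⟨ ℚᵘₚ.*-cong (ℚₚ.toℚᵘ-fromℚᵘ (mkℚᵘ (ℤ.+ suc n) 0)) (ℚₚ.toℚᵘ-fromℚᵘ (mkℚᵘ (ℤ.+ 1) n)) ⟩
  mkℚᵘ (ℤ.+ suc n) 0 ℚᵘ.* mkℚᵘ (ℤ.+ 1) n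
    ≈⟨ *≡* (≡.trans (ℤₚ.*-identityʳ (ℤ.+ suc n ℤ.* ℤ.+ 1)) (≡.trans (ℤₚ.*-identityʳ (ℤ.+ suc n))
        (≡.sym (≡.trans (ℤₚ.*-identityˡ _) (≡.cong (λ m → ℤ.+ suc m) (ℕₚ.+-identityʳ n)))))) ⟩
  mkℚᵘ (ℤ.+ 1) 0  ∎)
  where open ℚᵘₚ.≃-Reasoning

-- Commutative ℚ-algebras and their ring solver

record ℚ-Algebra : Set₁ where
  field
    commutativeRing : CommutativeRing 0ℓ 0ℓ
    morphism : CommutativeRing.rawRing ℚₚ.+-*-commutativeRing
                 -Raw-AlmostCommutative⟶ fromCommutativeRing commutativeRing

  open CommutativeRing commutativeRing public
  open _-Raw-AlmostCommutative⟶_ morphism public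
    renaming (⟦_⟧ to ι; +-homo to ι-+; *-homo to ι-*; -‿homo to ι-neg; 0-homo to ι-0; 1-homo to ι-1)

  ι-cong : ∀ {c c′} → c ≡ c′ → ι c ≈ ι c′
  ι-cong ≡.refl = refl

  module Solver where
    weaklyDecidable : ∀ x y → Maybe (ι x ≈ ι y)
    weaklyDecidable x y with x ℚₚ.≟ y
    ... | yes eq = just (ι-cong eq)
    ... | no _   = nothing

    open RingSolver (CommutativeRing.rawRing ℚₚ.+-*-commutativeRing) (fromCommutativeRing commutativeRing) morphism weaklyDecidable public

  ν : ℕ → Carrier
  ν n = ι (ℕ→ℚ n)

  ν-+ : ∀ m n → ν (m ℕ.+ n) ≈ ν m + ν n
  ν-+ m n = trans (ι-cong (ℕ→ℚ-+ m n)) (ι-+ _ _)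

  ν-suc : ∀ n → ν (suc n) ≈ ν n + ι 1ℚ
  ν-suc n = trans (ι-cong (ℕ→ℚ-suc n)) (ι-+ _ _)

  ν-inverse : ∀ n → ν (suc n) * ι (ℤ.+ 1 ℚ./ suc n) ≈ 1#
  ν-inverse n = trans (sym (ι-* _ _)) (trans (ι-cong (ℕ→ℚ-inverse n)) ι-1)

  cancel-ν : ∀ n {x y} → ν (suc n) * x ≈ y → x ≈ ι (ℤ.+ 1 ℚ./ suc n) * y
  cancel-ν n {x} e = trans (sym (*-identityˡ x)) (trans (*-congʳ (trans (sym (ν-inverse n)) (*-comm _ _)))
    (trans (*-assoc _ _ _) (*-congˡ e)))

ℚ-algebra : ℚ-Algebra
ℚ-algebra = record
  { commutativeRing = ℚₚ.+-*-commutativeRing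
  ; morphism = record
    { ⟦_⟧ = λ x → x
    ; +-homo = λ _ _ → ≡.refl
    ; *-homo = λ _ _ → ≡.refl
    ; -‿homo = λ _ → ≡.refl
    ; 0-homo = ≡.refl
    ; 1-homo = ≡.refl
    }
  }

-- Power series over a ℚ-algebra

module PowerSeries (K : ℚ-Algebra) where
  open ℚ-Algebra K
  open import Relation.Binary.Reasoning.Setoid setoid
  private
    +-interchange = interchange +-commutativeSemigroup

  antidiag : (ℕ → ℕ → Carrier) → ℕ → Carrier
  antidiag k zero    = k 0 0
  antidiag k (suc n) = k 0 (suc n) + antidiag (λ x → k (suc x)) n

  antidiag-cong : ∀ {k k′} n → (∀ x y → x ℕ.+ y ≡ n → k x y ≈ k′ x y) → antidiag k n ≈ antidiag k′ n
  antidiag-cong zero    p = p 0 0 ≡.refl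
  antidiag-cong (suc n) p = +-cong (p 0 (suc n) ≡.refl) (antidiag-cong n (λ x y e → p (suc x) y (≡.cong suc e)))

  antidiag-+ : ∀ k l n → antidiag (λ x y → k x y + l x y) n ≈ antidiag k n + antidiag l n
  antidiag-+ k l zero    = refl
  antidiag-+ k l (suc n) = trans (+-congˡ (antidiag-+ _ _ n)) (+-interchange _ _ _ _)

  antidiag-scale : ∀ c k n → antidiag (λ x y → c * k x y) n ≈ c * antidiag k n
  antidiag-scale c k zero    = refl
  antidiag-scale c k (suc n) = trans (+-congˡ (antidiag-scale c _ n)) (sym (distribˡ _ _ _))

  antidiag-zero : ∀ n → antidiag (λ _ _ → 0#) n ≈ 0#
  antidiag-zero zero    = refl
  antidiag-zero (suc n) = trans (+-identityˡ _) (antidiag-zero n)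

  antidiag-last : ∀ k n → antidiag k (suc n) ≈ antidiag (λ x y → k x (suc y)) n + k (suc n) 0
  antidiag-last k zero    = refl
  antidiag-last k (suc n) = trans (+-congˡ (antidiag-last (λ x → k (suc x)) n)) (sym (+-assoc _ _ _))

  conv : (ℕ → Carrier) → (ℕ → Carrier) → ℕ → Carrier
  conv f g = antidiag (λ x y → f x * g y)

  conv-cong : ∀ {f f′ g g′} → (∀ n → f n ≈ f′ n) → (∀ n → g n ≈ g′ n) →
              ∀ n → conv f g n ≈ conv f′ g′ n
  conv-cong p r n = antidiag-cong n (λ x y _ → *-cong (p x) (r y))

  conv-zeroˡ : ∀ f g → (∀ n → f n ≈ 0#) → ∀ n → conv f g n ≈ 0#
  conv-zeroˡ f g p n = trans (antidiag-cong n (λ x y _ → trans (*-congʳ (p x)) (zeroˡ _))) (antidiag-zero n)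

  conv-scaleˡ : ∀ c f g n → conv (λ i → c * f i) g n ≈ c * conv f g n
  conv-scaleˡ c f g n = trans (antidiag-cong n (λ _ _ _ → *-assoc _ _ _)) (antidiag-scale c _ n)

  conv-distribˡ : ∀ f g h n → conv f (λ i → g i + h i) n ≈ conv f g n + conv f h n
  conv-distribˡ f g h n = trans (antidiag-cong n (λ _ _ _ → distribˡ _ _ _)) (antidiag-+ _ _ n)

  conv-distribʳ : ∀ h f g n → conv (λ i → f i + g i) h n ≈ conv f h n + conv g h n
  conv-distribʳ h f g n = trans (antidiag-cong n (λ _ _ _ → distribʳ _ _ _)) (antidiag-+ _ _ n)

  conv-comm : ∀ f g n → conv f g n ≈ conv g f n
  conv-comm f g zero    = *-comm _ _
  conv-comm f g (suc n) = begin
    f 0 * g (suc n) + conv (λ i → f (suc i)) g n  ≈⟨ +-cong (*-comm _ _) (conv-comm _ g n) ⟩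
    g (suc n) * f 0 + conv g (λ i → f (suc i)) n  ≈⟨ +-comm _ _ ⟩
    conv g (λ i → f (suc i)) n + g (suc n) * f 0  ≈⟨ antidiag-last (λ x y → g x * f y) n ⟨
    conv g f (suc n)  ∎

  conv-assoc : ∀ f g h n → conv (conv f g) h n ≈ conv f (conv g h) n
  conv-assoc f g h zero    = *-assoc _ _ _
  conv-assoc f g h (suc n) = begin
    f 0 * g 0 * h (suc n) + conv (λ i → f 0 * g (suc i) + conv f′ g i) h n
      ≈⟨ +-cong (*-assoc _ _ _) (conv-distribʳ h _ _ n) ⟩
    f 0 * (g 0 * h (suc n)) + (conv (λ i → f 0 * g (suc i)) h n + conv (conv f′ g) h n)
      ≈⟨ +-congˡ (+-cong (conv-scaleˡ _ _ h n) (conv-assoc f′ g h n)) ⟩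
    f 0 * (g 0 * h (suc n)) + (f 0 * conv (λ i → g (suc i)) h n + conv f′ (conv g h) n)
      ≈⟨ +-assoc _ _ _ ⟨
    f 0 * (g 0 * h (suc n)) + f 0 * conv (λ i → g (suc i)) h n + conv f′ (conv g h) n
      ≈⟨ +-congʳ (distribˡ _ _ _) ⟨
    f 0 * conv g h (suc n) + conv f′ (conv g h) n ∎
    where
    f′ : ℕ → Carrier
    f′ i = f (suc i)

  const : Carrier → ℕ → Carrier
  const c zero    = c
  const c (suc _) = 0#

  conv-constˡ : ∀ c g n → conv (const c) g n ≈ c * g n
  conv-constˡ c g zero    = refl
  conv-constˡ c g (suc n) = trans (+-congˡ (conv-zeroˡ _ g (λ _ → refl) n)) (+-identityʳ _)

  -- The result is again a ℚ-algebra, so the construction iterates: ℚ[[q]] over ℚ, then ℚ[[q]][[t]]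
  -- over ℚ[[q]], with the same solver at each level.
  algebra : ℚ-Algebra
  algebra = record
    { commutativeRing = record
      { Carrier = ℕ → Carrier
      ; _≈_ = λ f g → ∀ n → f n ≈ g n
      ; _+_ = λ f g n → f n + g n
      ; _*_ = conv
      ; -_ = λ f n → - f n
      ; 0# = λ _ → 0#
      ; 1# = const 1#
      ; isCommutativeRing = record
        { isRing = record
          { +-isAbelianGroup = record
            { isGroup = record
              { isMonoid = record
                { isSemigroup = record
                  { isMagma = record
                    { isEquivalence = record
                      { refl = λ _ → refl
                      ; sym = λ p n → sym (p n)
                      ; trans = λ p r n → trans (p n) (r n)
                      }
                    ; ∙-cong = λ p r n → +-cong (p n) (r n)
                    }
                  ; assoc = λ f g h n → +-assoc (f n) (g n) (h n)
                  }
                ; identity = (λ f n → +-identityˡ (f n)) , (λ f n → +-identityʳ (f n))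
                }
              ; inverse = (λ f n → -‿inverseˡ (f n)) , (λ f n → -‿inverseʳ (f n))
              ; ⁻¹-cong = λ p n → -‿cong (p n)
              }
            ; comm = λ f g n → +-comm (f n) (g n)
            }
          ; *-cong = conv-cong
          ; *-assoc = conv-assoc
          ; *-identity = identityˡ , λ f n → trans (conv-comm f _ n) (identityˡ f n)
          ; distrib = conv-distribˡ , conv-distribʳ
          }
        ; *-comm = conv-comm
        }
      }
    ; morphism = record
      { ⟦_⟧ = λ c → const (ι c)
      ; +-homo = λ { x y zero → ι-+ x y ; x y (suc _) → sym (+-identityˡ _) }
      ; *-homo = λ x y n → trans (*-homo x y n) (sym (conv-constˡ (ι x) _ n))
      ; -‿homo = λ { x zero → ι-neg x ; x (suc _) → sym -0#≈0# }
      ; 0-homo = λ { zero → ι-0 ; (suc _) → refl }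
      ; 1-homo = λ { zero → ι-1 ; (suc _) → refl }
      }
    }
    where
    open import Algebra.Properties.Ring ring using (-0#≈0#)
    identityˡ : ∀ f n → conv (const 1#) f n ≈ f n
    identityˡ f n = trans (conv-constˡ 1# f n) (*-identityˡ _)
    *-homo : ∀ x y n → const (ι (x ℚ.* y)) n ≈ ι x * const (ι y) n
    *-homo x y zero    = ι-* x y
    *-homo x y (suc n) = sym (zeroʳ _)

  -- The Euler operator: q d/dq for series in q over ℚ, and t d/dt one level up.
  θ : (ℕ → Carrier) → ℕ → Carrier
  θ f n = ν n * f n

  θ-derivation : ∀ f g n → θ (conv f g) n ≈ conv (θ f) g n + conv f (θ g) n
  θ-derivation f g zero    = begin
    ν 0 * (f 0 * g 0)  ≈⟨ solve 2 (λ x y → con 0ℚ :* (x :* y) := con 0ℚ :* x :* y :+ x :* (con 0ℚ :* y)) refl (f 0) (g 0) ⟩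
    ι 0ℚ * f 0 * g 0 + f 0 * (ι 0ℚ * g 0)  ∎
    where open Solver
  θ-derivation f g (suc n) = begin
    ν (suc n) * (f 0 * g (suc n) + conv f′ g n)
      ≈⟨ solve 4 (λ m x y c → m :* (x :* y :+ c) := x :* (m :* y) :+ m :* c) refl _ _ _ _ ⟩
    f 0 * (ν (suc n) * g (suc n)) + ν (suc n) * conv f′ g n
      ≈⟨ +-congˡ (trans (*-congʳ (ν-suc n)) (trans (distribʳ _ _ _) (+-cong (θ-derivation f′ g n) (trans (*-congʳ ι-1) (*-identityˡ _))))) ⟩
    f 0 * (ν (suc n) * g (suc n)) + (conv (θ f′) g n + conv f′ (θ g) n + conv f′ g n)
      ≈⟨ solve 6 (λ x y s t u v → x :* y :+ (s :+ t :+ u) := con 0ℚ :* x :* v :+ (s :+ u) :+ (x :* y :+ t)) refl _ _ _ _ _ _ ⟩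
    ι 0ℚ * f 0 * g (suc n) + (conv (θ f′) g n + conv f′ g n) + (f 0 * (ν (suc n) * g (suc n)) + conv f′ (θ g) n)
      ≈⟨ +-congʳ (+-congˡ (trans (conv-cong step (λ _ → refl) n) (conv-distribʳ g _ _ n))) ⟨
    ι 0ℚ * f 0 * g (suc n) + conv (λ i → θ f (suc i)) g n + (f 0 * (ν (suc n) * g (suc n)) + conv f′ (θ g) n) ∎
    where
    open Solver
    f′ : ℕ → Carrier
    f′ i = f (suc i)
    step : ∀ i → θ f (suc i) ≈ θ f′ i + f′ i
    step i = trans (*-congʳ (ν-suc i)) (trans (distribʳ _ _ _) (+-congˡ (trans (*-congʳ ι-1) (*-identityˡ _))))

-- Divided powers x^n/n!

_^[_] : ℚ → ℕ → ℚ
x ^[ zero ]  = 1ℚ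
x ^[ suc n ] = (ℤ.+ 1 ℚ./ suc n) ℚ.* (x ℚ.* x ^[ n ])

^[]-suc : ∀ x n → ℕ→ℚ (suc n) ℚ.* x ^[ suc n ] ≡ x ℚ.* x ^[ n ]
^[]-suc x n = begin
  ℕ→ℚ (suc n) ℚ.* ((ℤ.+ 1 ℚ./ suc n) ℚ.* (x ℚ.* x ^[ n ]))  ≡⟨ ℚₚ.*-assoc (ℕ→ℚ (suc n)) (ℤ.+ 1 ℚ./ suc n) (x ℚ.* x ^[ n ]) ⟨
  ℕ→ℚ (suc n) ℚ.* (ℤ.+ 1 ℚ./ suc n) ℚ.* (x ℚ.* x ^[ n ])  ≡⟨ ≡.cong (ℚ._* (x ℚ.* x ^[ n ])) (ℕ→ℚ-inverse n) ⟩
  1ℚ ℚ.* (x ℚ.* x ^[ n ])  ≡⟨ ℚₚ.*-identityˡ _ ⟩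
  x ℚ.* x ^[ n ]  ∎
  where open ≡.≡-Reasoning

0^[suc] : ∀ n → 0ℚ ^[ suc n ] ≡ 0ℚ
0^[suc] n = ≡.trans (≡.cong ((ℤ.+ 1 ℚ./ suc n) ℚ.*_) (ℚₚ.*-zeroˡ (0ℚ ^[ n ]))) (ℚₚ.*-zeroʳ (ℤ.+ 1 ℚ./ suc n))

private
  module Qˢ = PowerSeries ℚ-algebra

cancel-ℕ→ℚ : ∀ n {x y} → ℕ→ℚ (suc n) ℚ.* x ≡ ℕ→ℚ (suc n) ℚ.* y → x ≡ y
cancel-ℕ→ℚ n {x} {y} e = ≡.trans (unit x) (≡.trans (≡.cong ((ℤ.+ 1 ℚ./ suc n) ℚ.*_) e) (≡.sym (unit y)))
  where
  unit : ∀ x → x ≡ (ℤ.+ 1 ℚ./ suc n) ℚ.* (ℕ→ℚ (suc n) ℚ.* x)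
  unit x = ≡.sym (≡.trans (≡.sym (ℚₚ.*-assoc (ℤ.+ 1 ℚ./ suc n) (ℕ→ℚ (suc n)) x))
    (≡.trans (≡.cong (ℚ._* x) (≡.trans (ℚₚ.*-comm (ℤ.+ 1 ℚ./ suc n) (ℕ→ℚ (suc n))) (ℕ→ℚ-inverse n))) (ℚₚ.*-identityˡ x)))

-- The binomial theorem. Applied to the product of the two exponential series, the Leibniz rule for
-- `θ` gives the recursion that characterizes (a + b)^t/t!, up to the factor t + 1, which is
-- cancelled.
^[]-+ : ∀ a b t → Qˢ.antidiag (λ j m → a ^[ j ] ℚ.* b ^[ m ]) t ≡ (a ℚ.+ b) ^[ t ]
^[]-+ a b zero    = ≡.refl
^[]-+ a b (suc t) = cancel-ℕ→ℚ t (begin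
  ℕ→ℚ (suc t) ℚ.* Qˢ.conv A B (suc t)
    ≡⟨ Qˢ.θ-derivation A B (suc t) ⟩
  Qˢ.conv (Qˢ.θ A) B (suc t) ℚ.+ Qˢ.conv A (Qˢ.θ B) (suc t)
    ≡⟨ ≡.cong₂ ℚ._+_ left right ⟩
  a ℚ.* Qˢ.conv A B t ℚ.+ b ℚ.* Qˢ.conv A B t
    ≡⟨ ℚₚ.*-distribʳ-+ (Qˢ.conv A B t) a b ⟨
  (a ℚ.+ b) ℚ.* Qˢ.conv A B t
    ≡⟨ ≡.cong ((a ℚ.+ b) ℚ.*_) (^[]-+ a b t) ⟩
  (a ℚ.+ b) ℚ.* (a ℚ.+ b) ^[ t ]
    ≡⟨ ^[]-suc (a ℚ.+ b) t ⟨
  ℕ→ℚ (suc t) ℚ.* (a ℚ.+ b) ^[ suc t ] ∎)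
  where
  open ≡.≡-Reasoning
  A B : ℕ → ℚ
  A j = a ^[ j ]
  B j = b ^[ j ]
  left : Qˢ.conv (Qˢ.θ A) B (suc t) ≡ a ℚ.* Qˢ.conv A B t
  left = ≡.trans (≡.cong (ℚ._+ Qˢ.antidiag (λ x y → Qˢ.θ A (suc x) ℚ.* B y) t) (ℚₚ.*-zeroˡ (B (suc t))))
    (≡.trans (ℚₚ.+-identityˡ _)
    (≡.trans (Qˢ.antidiag-cong t (λ x y _ → ≡.trans (≡.cong (ℚ._* B y) (^[]-suc a x)) (ℚₚ.*-assoc a (A x) (B y))))
             (Qˢ.antidiag-scale a _ t)))
  right : Qˢ.conv A (Qˢ.θ B) (suc t) ≡ b ℚ.* Qˢ.conv A B t
  right = ≡.trans (Qˢ.antidiag-last (λ x y → A x ℚ.* Qˢ.θ B y) t)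
    (≡.trans (≡.cong (Qˢ.antidiag (λ x y → A x ℚ.* Qˢ.θ B (suc y)) t ℚ.+_) (ℚₚ.*-zeroʳ (A (suc t))))
    (≡.trans (ℚₚ.+-identityʳ _)
    (≡.trans (Qˢ.antidiag-cong t (λ x y _ → ≡.trans (≡.cong (A x ℚ.*_) (^[]-suc b y))
        (≡.trans (≡.sym (ℚₚ.*-assoc (A x) b (B y))) (≡.trans (≡.cong (ℚ._* B y) (ℚₚ.*-comm (A x) b)) (ℚₚ.*-assoc b (A x) (B y))))))
             (Qˢ.antidiag-scale b _ t))))

1/!-* : ∀ n → 1/ n ! ℚ.* ℕ→ℚ (n !) ≡ 1ℚ
1/!-* n = ≡.trans (ℚₚ.*-comm (1/ n !) (ℕ→ℚ (n !))) (go (n !) {{n ℕₚ.!≢0}})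
  where
  go : ∀ m → .{{_ : ℕ.NonZero m}} → ℕ→ℚ m ℚ.* (ℤ.+ 1 ℚ./ m) ≡ 1ℚ
  go (suc m) = ℕ→ℚ-inverse m

1/!-suc : ∀ n → 1/ (suc n) ! ≡ (ℤ.+ 1 ℚ./ suc n) ℚ.* 1/ n !
1/!-suc n = begin
  x  ≡⟨ ℚₚ.*-identityʳ x ⟨
  x ℚ.* 1ℚ  ≡⟨ ≡.cong (x ℚ.*_) (≡.trans (≡.cong₂ ℚ._*_ (ℕ→ℚ-inverse n) (1/!-* n)) ≡.refl) ⟨
  x ℚ.* (s ℚ.* i ℚ.* (y ℚ.* m))  ≡⟨ solve 5 (λ x s i y m → x :* (s :* i :* (y :* m)) := x :* (s :* m) :* (i :* y)) ≡.refl x s i y m ⟩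
  x ℚ.* (s ℚ.* m) ℚ.* (i ℚ.* y)  ≡⟨ ≡.cong (λ z → x ℚ.* z ℚ.* (i ℚ.* y)) (ℕ→ℚ-* (suc n) (n !)) ⟨
  x ℚ.* ℕ→ℚ (suc n ℕ.* n !) ℚ.* (i ℚ.* y)  ≡⟨ ≡.cong (ℚ._* (i ℚ.* y)) (1/!-* (suc n)) ⟩
  1ℚ ℚ.* (i ℚ.* y)  ≡⟨ ℚₚ.*-identityˡ _ ⟩
  i ℚ.* y  ∎
  where
  open ≡.≡-Reasoning
  open ℚ-Algebra.Solver ℚ-algebra using (solve; _:=_; _:*_)
  x = 1/ (suc n) !
  s = ℕ→ℚ (suc n)
  i = ℤ.+ 1 ℚ./ suc n
  y = 1/ n !
  m = ℕ→ℚ (n !)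

-- Linear operators and the axioms for Rota-Baxter nested sums

module _ (𝒜 : ℚ-Algebra) where
  open ℚ-Algebra 𝒜

  record IsLinear (T : Carrier → Carrier) : Set where
    field
      T-cong  : ∀ {F G} → F ≈ G → T F ≈ T G
      T-+     : ∀ F G → T (F + G) ≈ T F + T G
      T-scale : ∀ c F → T (ι c * F) ≈ ι c * T F

    T-0 : T 0# ≈ 0#
    T-0 = begin
      T 0#  ≈⟨ T-cong (zeroʳ (ι 0ℚ)) ⟨
      T (ι 0ℚ * 0#) ≈⟨ T-scale 0ℚ 0# ⟩
      ι 0ℚ * T 0#  ≈⟨ *-congʳ ι-0 ⟩
      0# * T 0#  ≈⟨ zeroˡ _ ⟩
      0#  ∎
      where open import Relation.Binary.Reasoning.Setoid setoid

    T-minus : ∀ F G → T (F - G) ≈ T F - T G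
    T-minus F G = begin
      T (F - G)  ≈⟨ T-cong (minus F G) ⟩
      T (F + ι (ℚ.- 1ℚ) * G)  ≈⟨ trans (T-+ _ _) (+-congˡ (T-scale _ G)) ⟩
      T F + ι (ℚ.- 1ℚ) * T G  ≈⟨ minus (T F) (T G) ⟨
      T F - T G  ∎
      where
      open import Relation.Binary.Reasoning.Setoid setoid
      open Solver
      minus : ∀ F G → F - G ≈ F + ι (ℚ.- 1ℚ) * G
      minus = solve 2 (λ F G → F :- G := F :+ con (ℚ.- 1ℚ) :* G) refl

  record RotaBaxterData : Set₁ where
    field
      φ : ℕ → Carrier
      -- θ = t d/dt and D = q d/dq.
      Λ θ D : Carrier → Carrier
      -- No constant term in t.
      Small : Carrier → Set
      Λ-linear : IsLinear Λ
      θ-linear : IsLinear θ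
      D-cong   : ∀ {F G} → F ≈ G → D F ≈ D G
      φ-small  : ∀ k → Small (φ k)
      *-small  : ∀ {F} G → Small F → Small (F * G)
      -- The identity for L_a L_b is available for a, b ≥ 1, hence the restriction to series without
      -- constant term.
      rotaBaxter : ∀ F G → Small F → Small G → Λ F * Λ G ≈ Λ (F * Λ G + G * Λ F + F * G)
      θ-* : ∀ F G → θ (F * G) ≈ θ F * G + F * θ G
      θ-Λ : ∀ F → θ (Λ F) ≈ Λ (θ F)
      θ-1 : θ 1# ≈ 0#
      θ-φ : ∀ k .{{_ : ℕ.NonZero k}} → θ (φ k) ≈ ν k * φ (suc k)
      -- There are u - 1 ways to write u as a sum of two positive integers.
      φ₁² : φ 1 * φ 1 ≈ φ 2 - φ 1
      D-φ : ∀ k F → D (φ k * F) ≈ φ k * D F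
      -- The product rule with D L_s = s(L_s + L_s²): multiplying the coefficient of t^s by s is
      -- `θ`, and L_s² is `Λ` applied twice.
      D-Λ : ∀ F → D (Λ F) ≈ Λ (D F) + (Λ (θ F) + Λ (Λ (θ F)))
      D-1 : D 1# ≈ 0#

-- Products of the series φ: Faulhaber's formula

module Stuffle (𝒜 : ℚ-Algebra) (S : RotaBaxterData 𝒜) where
  open ℚ-Algebra 𝒜
  open RotaBaxterData S
  open Solver using (solve; _:=_; _:+_; _:*_; _:-_; :-_; con)
  open import Relation.Binary.Reasoning.Setoid setoid
  module Λᴸ = IsLinear Λ-linear
  module θᴸ = IsLinear θ-linear

  -- The span of φ₂, …, φ_d.  That φ₁ never occurs keeps the letters produced by a merge at least 2.
  data Low (d : ℕ) : Carrier → Set where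
    nil  : ∀ {F} → F ≈ 0# → Low d F
    cons : ∀ {F G} c j → 2 ≤ j → j ≤ d → Low d G → F ≈ ι c * φ j + G → Low d F

  Low-≈ : ∀ {d F G} → G ≈ F → Low d F → Low d G
  Low-≈ e (nil z)            = nil (trans e z)
  Low-≈ e (cons c j p r l f) = cons c j p r l (trans e f)

  Low-φ : ∀ {d} j → 2 ≤ j → j ≤ d → Low d (φ j)
  Low-φ j p r = cons 1ℚ j p r (nil refl)
    (solve 1 (λ x → x := con 1ℚ :* x :+ con 0ℚ) refl (φ j) ⟨trans⟩ +-congˡ ι-0)
    where
    infixl 4 _⟨trans⟩_
    _⟨trans⟩_ = trans

  Low-+ : ∀ {d F G} → Low d F → Low d G → Low d (F + G)
  Low-+ (nil z) l = Low-≈ (trans (+-congʳ z) (+-identityˡ _)) l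
  Low-+ (cons c j p r l f) m = cons c j p r (Low-+ l m) (trans (+-congʳ f) (+-assoc _ _ _))

  Low-scale : ∀ {d F} c → Low d F → Low d (ι c * F)
  Low-scale c (nil z) = nil (trans (*-congˡ z) (zeroʳ _))
  Low-scale c (cons {F} {G} b j p r l f) = cons (c ℚ.* b) j p r (Low-scale c l) (begin
    ι c * F  ≈⟨ *-congˡ f ⟩
    ι c * (ι b * φ j + G)  ≈⟨ solve 4 (λ x y z w → x :* (y :* z :+ w) := x :* y :* z :+ x :* w) refl _ _ _ _ ⟩
    ι c * ι b * φ j + ι c * G  ≈⟨ +-congʳ (*-congʳ (ι-* c b)) ⟨
    ι (c ℚ.* b) * φ j + ι c * G  ∎)

  Low-neg : ∀ {d F} → Low d F → Low d (- F)
  Low-neg {d} {F} l = Low-≈ (solve 1 (λ x → :- x := con (ℚ.- 1ℚ) :* x) refl F) (Low-scale (ℚ.- 1ℚ) l)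

  Low-mono : ∀ {d d′ F} → d ≤ d′ → Low d F → Low d′ F
  Low-mono d≤ (nil z)            = nil z
  Low-mono d≤ (cons c j p r l f) = cons c j p (≤-trans r d≤) (Low-mono d≤ l) f

  -- The predicate is general because it serves twice: for `Low` with a new bound, and for
  -- membership in the space of lower weight.
  Low-image : ∀ {d F} {P : Carrier → Set} {T} → IsLinear 𝒜 T →
              P 0# → (∀ c {G H} → P G → P H → P (ι c * G + H)) → (∀ {G H} → G ≈ H → P H → P G) →
              (∀ j → 2 ≤ j → j ≤ d → P (T (φ j))) → Low d F → P (T F)
  Low-image T-lin P-0 P-+ P-≈ Pφ (nil z) = P-≈ (trans (T-cong z) T-0) P-0
    where open IsLinear T-lin
  Low-image T-lin P-0 P-+ P-≈ Pφ (cons c j p r l f) =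
    P-≈ (trans (T-cong f) (trans (T-+ _ _) (+-congʳ (T-scale c _))))
        (P-+ c (Pφ j p r) (Low-image T-lin P-0 P-+ P-≈ Pφ l))
    where open IsLinear T-lin

  *-linear : ∀ F → IsLinear 𝒜 (F *_)
  *-linear F = record
    { T-cong = *-congˡ ; T-+ = distribˡ F
    ; T-scale = λ c G → solve 3 (λ x y z → x :* (y :* z) := y :* (x :* z)) refl _ _ _ }

  Low-map : ∀ {d d′ F T} → IsLinear 𝒜 T → (∀ j → 2 ≤ j → j ≤ d → Low d′ (T (φ j))) → Low d F → Low d′ (T F)
  Low-map T-lin = Low-image {P = Low _} T-lin (nil refl) (λ c l m → Low-+ (Low-scale c l) m) Low-≈

  Low-θ : ∀ {d F} → Low d F → Low (suc d) (θ F)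
  Low-θ = Low-map θ-linear (λ { (suc j) p r → Low-≈ (θ-φ (suc j)) (Low-scale _ (Low-φ (suc (suc j)) (m≤n⇒m≤1+n p) (s≤s r))) })

  -- Faulhaber's formula, one exponent at a time: θ (φ₁φ_b) and φ₂ = φ₁² + φ₁ give
  -- (b+1) φ₁φ_{b+1} in terms of φ₁φ_j with j ≤ b.
  Faulhaber : ℕ → Set
  Faulhaber b = Low b (φ 1 * φ b - φ (suc b))

  Low-φ₁ : ∀ {d F} → (∀ j → 2 ≤ j → j ≤ d → Faulhaber j) → Low d F → Low (suc d) (φ 1 * F)
  Low-φ₁ fh = Low-map (*-linear (φ 1)) (λ j p r →
    Low-≈ (solve 2 (λ x y → x := x :- y :+ y) refl _ (φ (suc j)))
      (Low-+ (Low-mono (m≤n⇒m≤1+n r) (fh j p r)) (Low-φ (suc j) (m≤n⇒m≤1+n p) (s≤s r))))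

  θ-φ₁ : θ (φ 1) ≈ φ 2
  θ-φ₁ = trans (θ-φ 1) (trans (*-congʳ ι-1) (*-identityˡ _))

  -- Applying θ to φ₁² = φ₂ - φ₁ gives 2 φ₁φ₂ = 2 φ₃ - φ₂. The induction starts at 2, as φ₁φ₁ - φ₂ =
  -- -φ₁ involves φ₁.
  faulhaber-2 : Faulhaber 2
  faulhaber-2 = Low-≈ (trans (cancel-ν 1 (begin
    ι (ℕ→ℚ 2) * (φ 1 * φ 2 - φ 3)
      ≈⟨ solve 3 (λ x y z → con (ℕ→ℚ 2) :* (x :* y :- z) := y :* x :+ x :* y :- con (ℕ→ℚ 2) :* z) refl _ _ _ ⟩
    φ 2 * φ 1 + φ 1 * φ 2 - ν 2 * φ 3  ≈⟨ +-congʳ (+-cong (*-congʳ θ-φ₁) (*-congˡ θ-φ₁)) ⟨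
    θ (φ 1) * φ 1 + φ 1 * θ (φ 1) - ν 2 * φ 3  ≈⟨ +-congʳ (θ-* _ _) ⟨
    θ (φ 1 * φ 1) - ν 2 * φ 3  ≈⟨ +-congʳ (trans (θᴸ.T-cong φ₁²) (θᴸ.T-minus _ _)) ⟩
    θ (φ 2) - θ (φ 1) - ν 2 * φ 3  ≈⟨ +-congʳ (+-cong (θ-φ 2) (-‿cong θ-φ₁)) ⟩
    ν 2 * φ 3 - φ 2 - ν 2 * φ 3  ≈⟨ solve 2 (λ x y → x :- y :- x := :- y) refl _ _ ⟩
    - φ 2  ∎)) refl)
    (Low-scale _ (Low-neg (Low-φ 2 ≤-refl ≤-refl)))

  -- The hypothesis covers all smaller exponents because the remainder `R` one step down is a
  -- combination of several φ_j, each of which is multiplied by φ₁.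
  faulhaber-step : ∀ b → (∀ j → 2 ≤ j → j ≤ suc (suc b) → Faulhaber j) → Faulhaber (suc (suc (suc b)))
  faulhaber-step b fh = Low-≈ (cancel-ν (suc (suc b)) (begin
      ν (suc b′) * (x * z - w)
        ≈⟨ *-congʳ (ν-suc b′) ⟩
      (ν b′ + ι 1ℚ) * (x * z - w)
        ≈⟨ solve 4 (λ m x z w → (m :+ con 1ℚ) :* (x :* z :- w) := x :* (m :* z) :+ (x :* z :- (m :+ con 1ℚ) :* w)) refl _ _ _ _ ⟩
      x * (ν b′ * z) + (x * z - (ν b′ + ι 1ℚ) * w)
        ≈⟨ +-congʳ θ-step ⟩
      (ν b′ + ι 1ℚ) * w + θ R - (x * (z + R) + (z + R)) + (x * z - (ν b′ + ι 1ℚ) * w)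
        ≈⟨ solve 6 (λ m w t x z R → (m :+ con 1ℚ) :* w :+ t :- (x :* (z :+ R) :+ (z :+ R)) :+ (x :* z :- (m :+ con 1ℚ) :* w)
                                 := t :- x :* R :- z :- R) refl _ _ _ _ _ _ ⟩
      θ R - x * R - z - R  ∎))
    (Low-scale _ (Low-+ (Low-+ (Low-+ (Low-θ fb) (Low-neg (Low-φ₁ fh fb))) (Low-neg (Low-φ (suc b′) (s≤s (s≤s z≤n)) ≤-refl)))
                        (Low-neg (Low-mono (ℕₚ.n≤1+n _) fb))))
    where
    b′ = suc (suc b)
    x = φ 1
    y = φ b′
    z = φ (suc b′)
    w = φ (suc (suc b′))
    R = x * y - z
    fb = fh b′ (s≤s (s≤s z≤n)) ≤-refl
    xy : x * y ≈ z + R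
    xy = solve 2 (λ p z → p := z :+ (p :- z)) refl _ _
    φ₂ : φ 2 ≈ x * x + x
    φ₂ = trans (solve 2 (λ u v → u := u :- v :+ v) refl _ x) (+-congʳ (sym φ₁²))
    θ-step : x * (ν b′ * z) ≈ (ν b′ + ι 1ℚ) * w + θ R - (x * (z + R) + (z + R))
    θ-step = begin
      x * (ν b′ * z)
        ≈⟨ solve 3 (λ x y t → t := (x :* x :+ x) :* y :+ t :- (x :* (x :* y) :+ x :* y)) refl x y _ ⟩
      (x * x + x) * y + x * (ν b′ * z) - (x * (x * y) + x * y)
        ≈⟨ +-congʳ (+-cong (*-congʳ (trans θ-φ₁ φ₂)) (*-congˡ (θ-φ b′))) ⟨
      θ x * y + x * θ y - (x * (x * y) + x * y)
        ≈⟨ +-congʳ (θ-* x y) ⟨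
      θ (x * y) - (x * (x * y) + x * y)
        ≈⟨ +-cong (trans (θᴸ.T-cong xy) (θᴸ.T-+ z R)) (-‿cong (+-cong (*-congˡ xy) xy)) ⟩
      θ z + θ R - (x * (z + R) + (z + R))
        ≈⟨ +-congʳ (+-congʳ (trans (θ-φ (suc b′)) (*-congʳ (ν-suc b′)))) ⟩
      (ν b′ + ι 1ℚ) * w + θ R - (x * (z + R) + (z + R)) ∎

  faulhaber : ∀ b → Faulhaber (suc (suc b))
  faulhaber b = below b _ (s≤s (s≤s z≤n)) ≤-refl
    where
    below : ∀ b j → 2 ≤ j → j ≤ suc (suc b) → Faulhaber j
    below b       (suc (suc zero))    p r = faulhaber-2
    below (suc b) (suc (suc (suc j))) p (s≤s r) = faulhaber-step j (λ i 2≤i i≤ → below b i 2≤i (≤-trans i≤ r))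
    below zero    (suc (suc (suc j))) p (s≤s (s≤s ()))
    below _       (suc zero) (s≤s ()) _

  -- Induction on `a` for all `b`: by the Leibniz rule, θ(φ_{a+1} φ_{b+2}) expresses φ_{a+2} φ_{b+2}
  -- through φ_{a+1} φ_{b+3}, and both of these are known. The bound of `Low` is the sum of the two
  -- indices minus 1.
  φ-φ : ∀ a b → Low (a ℕ.+ suc (suc b)) (φ (suc a) * φ (suc (suc b)) - φ (suc a ℕ.+ suc (suc b)))
  φ-φ zero    b = faulhaber b
  φ-φ (suc a) b = Low-≈ (cancel-ν a (begin
      ν (suc a) * (f′ * g - w)
        ≈⟨ solve 7 (λ m n f f′ g h w → m :* (f′ :* g :- w)
             := m :* f′ :* g :+ f :* (n :* h) :- (m :+ n) :* w :- n :* (f :* h :- w)) refl (ν (suc a)) (ν b′) f f′ g h w ⟩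
      ν (suc a) * f′ * g + f * (ν b′ * h) - (ν (suc a) + ν b′) * w - ν b′ * (f * h - w)
        ≈⟨ +-cong (+-cong (+-cong (*-congʳ (θ-φ (suc a))) (*-congˡ (θ-φ b′)))
            (-‿cong (trans (θ-φ (suc a ℕ.+ b′)) (*-congʳ (ν-+ (suc a) b′))))) (-‿cong (*-congˡ (+-congˡ (-‿cong φ-s)))) ⟨
      θ f * g + f * θ g - θ (φ s) - ν b′ * R₂
        ≈⟨ +-congʳ (trans (θᴸ.T-minus _ _) (+-congʳ (θ-* f g))) ⟨
      θ R₁ - ν b′ * R₂ ∎))
    (Low-scale _ (Low-+ (Low-θ (φ-φ a b)) (Low-neg (Low-scale _ (≡.subst (λ n → Low n R₂) (ℕₚ.+-suc a b′) (φ-φ a (suc b)))))))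
    where
    b′ = suc (suc b)
    φ-s : φ (suc a ℕ.+ suc b′) ≈ φ (suc (suc a ℕ.+ b′))
    φ-s = reflexive (≡.cong φ (ℕₚ.+-suc (suc a) b′))
    s = suc a ℕ.+ suc (suc b)
    f = φ (suc a)
    f′ = φ (suc (suc a))
    g = φ (suc (suc b))
    h = φ (suc (suc (suc b)))
    w = φ (suc s)
    R₁ = f * g - φ s
    R₂ = f * h - φ (suc a ℕ.+ suc (suc (suc b)))

  merge : ∀ k l → 1 ≤ k → 2 ≤ l → Low (pred (k ℕ.+ l)) (φ k * φ l - φ (k ℕ.+ l))
  merge (suc k) (suc (suc l)) _ _ = φ-φ k l
  merge (suc k) (suc zero) _ (s≤s ())

  merge-swap : ∀ k l → 1 ≤ k → 2 ≤ l → Low (pred (l ℕ.+ k)) (φ l * φ k - φ (l ℕ.+ k))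
  merge-swap k l p r = Low-≈ (+-cong (*-comm _ _) (-‿cong (reflexive (≡.cong φ (ℕₚ.+-comm l k)))))
    (≡.subst (λ n → Low (pred n) (φ k * φ l - φ (k ℕ.+ l))) (ℕₚ.+-comm k l) (merge k l p r))

  -- The quasi-shuffle product of nested sums

  Γ : List Carrier → Carrier
  Γ []      = 1#
  Γ (ψ ∷ w) = Λ (ψ * Γ w)

  -- A letter may be any series, so that two merged letters, being a product, are one letter again.
  -- The expansion of φ_k φ_l into single φ_j is postponed to `slot`.
  quasiShuffle : List Carrier → List Carrier → List (List Carrier)
  quasiShuffle []      w       = w ∷ []
  quasiShuffle (ψ ∷ v) []      = (ψ ∷ v) ∷ []
  quasiShuffle (ψ ∷ v) (χ ∷ w) =
    map (ψ ∷_) (quasiShuffle v (χ ∷ w)) ++ map (χ ∷_) (quasiShuffle (ψ ∷ v) w) ++ map (ψ * χ ∷_) (quasiShuffle v w)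

  -- The empty sum is `ι 0ℚ` and not `0#` because this is the value of the solver's constant
  -- `con 0ℚ`.
  ΣΓ : List (List Carrier) → Carrier
  ΣΓ []       = ι 0ℚ
  ΣΓ (w ∷ ws) = Γ w + ΣΓ ws

  ΣΓ-++ : ∀ us vs → ΣΓ (us ++ vs) ≈ ΣΓ us + ΣΓ vs
  ΣΓ-++ []       vs = sym (trans (+-congʳ ι-0) (+-identityˡ _))
  ΣΓ-++ (u ∷ us) vs = trans (+-congˡ (ΣΓ-++ us vs)) (sym (+-assoc _ _ _))

  ΣΓ-∷ : ∀ ψ ws → ΣΓ (map (ψ ∷_) ws) ≈ Λ (ψ * ΣΓ ws)
  ΣΓ-∷ ψ []       = trans ι-0 (sym (trans (Λᴸ.T-cong (trans (*-congˡ ι-0) (zeroʳ ψ))) Λᴸ.T-0))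
  ΣΓ-∷ ψ (w ∷ ws) = trans (+-congˡ (ΣΓ-∷ ψ ws)) (sym (trans (Λᴸ.T-cong (distribˡ ψ _ _)) (Λᴸ.T-+ _ _)))

  Γ-* : ∀ v w → All Small v → All Small w → Γ v * Γ w ≈ ΣΓ (quasiShuffle v w)
  Γ-* []      w       _        _        = trans (*-identityˡ _) (sym (trans (+-congˡ ι-0) (+-identityʳ _)))
  Γ-* (ψ ∷ v) []      _        _        = trans (*-identityʳ _) (sym (trans (+-congˡ ι-0) (+-identityʳ _)))
  Γ-* (ψ ∷ v) (χ ∷ w) (p ∷ ps) (r ∷ rs) = begin
    Γ (ψ ∷ v) * Γ (χ ∷ w)
      ≈⟨ rotaBaxter _ _ (*-small _ p) (*-small _ r) ⟩
    Λ (ψ * Γ v * Γ (χ ∷ w) + χ * Γ w * Γ (ψ ∷ v) + ψ * Γ v * (χ * Γ w))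
      ≈⟨ Λᴸ.T-cong (solve 6 (λ ψ χ v w ψv χw → ψ :* v :* χw :+ χ :* w :* ψv :+ ψ :* v :* (χ :* w)
           := ψ :* (v :* χw) :+ (χ :* (ψv :* w) :+ ψ :* χ :* (v :* w))) refl _ _ _ _ _ _) ⟩
    Λ (ψ * (Γ v * Γ (χ ∷ w)) + (χ * (Γ (ψ ∷ v) * Γ w) + ψ * χ * (Γ v * Γ w)))
      ≈⟨ trans (Λᴸ.T-+ _ _) (+-congˡ (Λᴸ.T-+ _ _)) ⟩
    Λ (ψ * (Γ v * Γ (χ ∷ w))) + (Λ (χ * (Γ (ψ ∷ v) * Γ w)) + Λ (ψ * χ * (Γ v * Γ w)))
      ≈⟨ +-cong (step ψ (quasiShuffle v (χ ∷ w)) (Γ-* v (χ ∷ w) ps (r ∷ rs)))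
          (+-cong (step χ (quasiShuffle (ψ ∷ v) w) (Γ-* (ψ ∷ v) w (p ∷ ps) rs)) (step (ψ * χ) (quasiShuffle v w) (Γ-* v w ps rs))) ⟩
    ΣΓ us + (ΣΓ vs + ΣΓ ws)
      ≈⟨ trans (ΣΓ-++ us (vs ++ ws)) (+-congˡ (ΣΓ-++ vs ws)) ⟨
    ΣΓ (us ++ vs ++ ws) ∎
    where
    us = map (ψ ∷_) (quasiShuffle v (χ ∷ w))
    vs = map (χ ∷_) (quasiShuffle (ψ ∷ v) w)
    ws = map (ψ * χ ∷_) (quasiShuffle v w)
    step : ∀ ψ ws {F} → F ≈ ΣΓ ws → Λ (ψ * F) ≈ ΣΓ (map (ψ ∷_) ws)
    step ψ ws e = trans (Λᴸ.T-cong (*-congˡ e)) (sym (ΣΓ-∷ ψ ws))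

  γ : List ℕ → Carrier
  γ w = Γ (map φ w)

  γ-* : ∀ v w → γ v * γ w ≈ ΣΓ (quasiShuffle (map φ v) (map φ w))
  γ-* v w = Γ-* (map φ v) (map φ w) (small v) (small w)
    where
    small : ∀ w → All Small (map φ w)
    small []      = []
    small (k ∷ w) = φ-small k ∷ small w

  slot-linear : ∀ u w → IsLinear 𝒜 (λ ψ → Γ (u ++ ψ ∷ w))
  slot-linear [] w = record
    { T-cong  = λ e → Λᴸ.T-cong (*-congʳ e)
    ; T-+     = λ F G → trans (Λᴸ.T-cong (distribʳ _ F G)) (Λᴸ.T-+ _ _)
    ; T-scale = λ c F → trans (Λᴸ.T-cong (*-assoc _ _ _)) (Λᴸ.T-scale c _) }
  slot-linear (ψ ∷ u) w = record
    { T-cong  = λ e → Λᴸ.T-cong (*-congˡ (T-cong e))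
    ; T-+     = λ F G → trans (Λᴸ.T-cong (trans (*-congˡ (T-+ F G)) (distribˡ _ _ _))) (Λᴸ.T-+ _ _)
    ; T-scale = λ c F → trans (Λᴸ.T-cong (trans (*-congˡ (T-scale c F)) (IsLinear.T-scale (*-linear ψ) c _))) (Λᴸ.T-scale c _) }
    where open IsLinear (slot-linear u w)

  -- The series of gˢʰ and its difference from a pure nested sum

  Λ^ : ℕ → Carrier → Carrier
  Λ^ zero    F = F
  Λ^ (suc i) F = Λ (Λ^ i F)

  -- G w is the series of gˢʰ(w), sorted by the largest summation index.  In G′ i k w the letter k shares this
  -- index with i − 1 letters 1 to its left, whence Λ^i / i!; the factor 0^(k−1) lets a further letter join if k = 1.
  mutual
    G : List ℕ → Carrier
    G []      = 1#
    G (k ∷ w) = G′ 1 k w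

    G′ : ℕ → ℕ → List ℕ → Carrier
    G′ i k []      = ι (1/ i !) * Λ^ i (φ k * 1#)
    G′ i k (l ∷ w) = ι (1/ i !) * Λ^ i (φ k * G (l ∷ w)) + ι (0ℚ ^[ pred k ]) * G′ (suc i) l w

  G′-≥2 : ∀ i k w → 2 ≤ k → G′ i k w ≈ ι (1/ i !) * Λ^ i (φ k * G w)
  G′-≥2 i k             []      _ = refl
  G′-≥2 i (suc (suc k)) (l ∷ w) _ =
    trans (+-congˡ (trans (*-congʳ (trans (ι-cong (0^[suc] k)) ι-0)) (zeroˡ _))) (+-identityʳ _)
  G′-≥2 i (suc zero) (_ ∷ _) (s≤s ())

  G-≥2 : ∀ k w → 2 ≤ k → G (k ∷ w) ≈ Λ (φ k * G w)
  G-≥2 k w p = trans (G′-≥2 1 k w p) (solve 1 (λ x → con 1ℚ :* x := x) refl _)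

  -- A letter 1 can share its summation index only with the letter to its right, so a final 1 gives
  -- no additional term.
  data Admissible : List ℕ → Set where
    [] : Admissible []
    [_] : ∀ k → Admissible (k ∷ [])
    _∷_ : ∀ {k w} → 2 ≤ k → Admissible w → Admissible (k ∷ w)

  G-admissible : ∀ {w} → Admissible w → G w ≈ γ w
  G-admissible [] = refl
  G-admissible [ k ] = solve 1 (λ x → con 1ℚ :* x := x) refl _
  G-admissible {k ∷ w} (p ∷ a) = trans (G-≥2 k w p) (Λᴸ.T-cong (*-congˡ (G-admissible a)))

  -- The constant ½ is 1/2!, from the summand of `G′` in which 1 and `l` share one summation index.
  G-1 : ∀ {l w} → 2 ≤ l → Admissible w → G (1 ∷ l ∷ w) ≈ γ (1 ∷ l ∷ w) + ι ½ * Λ (Λ (φ l * γ w))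
  G-1 {l} {w} p a = trans
    (+-cong (*-congˡ (Λᴸ.T-cong (*-congˡ (G-admissible (p ∷ a)))))
            (*-congˡ (trans (G′-≥2 2 l w p) (*-congˡ (Λᴸ.T-cong (Λᴸ.T-cong (*-congˡ (G-admissible a))))))))
    (solve 2 (λ x y → con 1ℚ :* x :+ con 1ℚ :* (con ½ :* y) := x :+ con ½ :* y) refl _ _)

-- The remainder of ds and the terms with one squared factor

module Remainder (𝒜 : ℚ-Algebra) (S : RotaBaxterData 𝒜) where
  open ℚ-Algebra 𝒜
  open RotaBaxterData S
  open Stuffle 𝒜 S
  open Solver using (solve; _:=_; _:+_; _:*_; _:-_; :-_; con)
  open import Relation.Binary.Reasoning.Setoid setoid
  open ℕSolver using () renaming (solve to solveℕ; _:+_ to _⊕_; _:=_ to _⊜_; con to #)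

  Ĝ : ℌ¹ → Carrier
  Ĝ []            = ι 0ℚ
  Ĝ ((c , w) ∷ u) = ι c * G w + Ĝ u

  -- The image of ds(v, w) when G is extended linearly; the shuffle part of ds becomes a product.
  R : List ℕ → List ℕ → Carrier
  R v w = Ĝ (v ∗ʷ w) - G v * G w

  -- The nested sums with one factor L²: at the smaller (A) or larger (B) of two summation indices, and at the
  -- largest (T₁), middle (T₂) or smallest (T₃) of three.
  A B : ℕ → ℕ → Carrier
  A a b = Λ (φ a * Λ (Λ (φ b * 1#)))
  B a b = Λ (Λ (φ a * γ (b ∷ [])))

  T₁ T₂ T₃ : ℕ → ℕ → ℕ → Carrier
  T₁ a b c = Λ (Λ (φ a * γ (b ∷ c ∷ [])))
  T₂ a b c = Λ (φ a * B b c)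
  T₃ a b c = Λ (φ a * A b c)

  prepend : ∀ {k F X Y} → F ≈ X + ι ½ * Y → Λ (φ k * F) ≈ Λ (φ k * X) + ι ½ * Λ (φ k * Y)
  prepend {k} e = trans (Λᴸ.T-cong (trans (*-congˡ e) (solve 3 (λ k x y → k :* (x :+ con ½ :* y) := k :* x :+ con ½ :* (k :* y)) refl _
      _ _)))
    (trans (Λᴸ.T-+ _ _) (+-congˡ (Λᴸ.T-scale ½ _)))

  G-k1 : ∀ {k l w} → 2 ≤ k → 2 ≤ l → Admissible w → G (k ∷ 1 ∷ l ∷ w) ≈ γ (k ∷ 1 ∷ l ∷ w) + ι ½ * Λ (φ k * Λ (Λ (φ l * γ w)))
  G-k1 {k} {l} {w} p q a = trans (G-≥2 k (1 ∷ l ∷ w) p) (prepend (G-1 q a))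

  G-kl1 : ∀ {k l m w} → 2 ≤ k → 2 ≤ l → 2 ≤ m → Admissible w →
          G (k ∷ l ∷ 1 ∷ m ∷ w) ≈ γ (k ∷ l ∷ 1 ∷ m ∷ w) + ι ½ * Λ (φ k * Λ (φ l * Λ (Λ (φ m * γ w))))
  G-kl1 {k} {l} {m} {w} p q r a = trans (G-≥2 k (l ∷ 1 ∷ m ∷ w) p) (prepend (G-k1 q r a))

  infixr 5 _⊞_
  -- Every word of a stuffle product carries the coefficient `1ℚ`. A chain of `_⊞_` rewrites `Ĝ`
  -- word by word, in the order in which `_∗ʷ_` lists the words.
  _⊞_ : ∀ {F F′ X X′} → F ≈ F′ → X ≈ X′ → ι 1ℚ * F + X ≈ F′ + X′
  e ⊞ r = +-cong (trans (trans (*-congʳ ι-1) (*-identityˡ _)) e) r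

  2≤⇒1≤ : ∀ {k} → 2 ≤ k → 1 ≤ k
  2≤⇒1≤ = ≤-trans (s≤s z≤n)

  ≥2-nonZero : ∀ {k} → 2 ≤ k → NonZero k
  ≥2-nonZero p = ℕ.>-nonZero (2≤⇒1≤ p)

  ≤-+ʳ : ∀ {i m} k → i ≤ m → i ≤ k ℕ.+ m
  ≤-+ʳ k p = ≤-trans p (m≤n+m _ k)

  ≤-pred⇒< : ∀ {j n} → 2 ≤ j → j ≤ pred n → suc j ≤ n
  ≤-pred⇒< {n = suc n} _ p = s≤s p
  ≤-pred⇒< {n = zero} (s≤s _) ()

  merge-swap′ : ∀ {k} → 2 ≤ k → Low k (φ k * φ 1 - φ (k ℕ.+ 1))
  merge-swap′ {k} p = ≡.subst (λ n → Low (pred n) (φ k * φ 1 - φ (k ℕ.+ 1))) (ℕₚ.+-comm k 1) (merge-swap 1 k (s≤s z≤n) p)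

  Λφ-linear : ∀ k → IsLinear 𝒜 (λ F → Λ (φ k * F))
  Λφ-linear k = record
    { T-cong  = λ e → Λᴸ.T-cong (*-congˡ e)
    ; T-+     = λ F F′ → trans (Λᴸ.T-cong (distribˡ _ _ _)) (Λᴸ.T-+ _ _)
    ; T-scale = λ c F → trans (Λᴸ.T-cong (IsLinear.T-scale (*-linear (φ k)) c F)) (Λᴸ.T-scale c _) }

  module _ {T} (T-linear : IsLinear 𝒜 T) where
    open IsLinear T-linear
    T-comb₂ : ∀ c d {F F′} → T (ι c * F + ι d * F′) ≈ ι c * T F + ι d * T F′
    T-comb₂ c d = trans (T-+ _ _) (+-cong (T-scale c _) (T-scale d _))

    T-comb₃ : ∀ c d e {F F′ F″} → T (ι c * F + ι d * F′ + ι e * F″) ≈ ι c * T F + ι d * T F′ + ι e * T F″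
    T-comb₃ c d e = trans (T-+ _ _) (+-cong (T-comb₂ c d) (T-scale e _))

  -- Derivatives of nested sums

  θ-γ₁ : ∀ a .{{_ : NonZero a}} → θ (φ a * 1#) ≈ ν a * (φ (suc a) * 1#)
  θ-γ₁ a = begin
    θ (φ a * 1#)  ≈⟨ θ-* _ _ ⟩
    θ (φ a) * 1# + φ a * θ 1#  ≈⟨ +-cong (*-congʳ (θ-φ a)) (trans (*-congˡ θ-1) (zeroʳ _)) ⟩
    ν a * φ (suc a) * 1# + 0#  ≈⟨ trans (+-identityʳ _) (*-assoc _ _ _) ⟩
    ν a * (φ (suc a) * 1#)  ∎

  θ-γ₂ : ∀ a b .{{_ : NonZero a}} .{{_ : NonZero b}} → θ (φ a * γ (b ∷ [])) ≈ ν a * (φ (suc a) * γ (b ∷ [])) + ν b * (φ a * γ (suc b ∷ []))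
  θ-γ₂ a b = begin
    θ (φ a * γ (b ∷ []))
      ≈⟨ θ-* _ _ ⟩
    θ (φ a) * γ (b ∷ []) + φ a * θ (γ (b ∷ []))
      ≈⟨ +-cong (*-congʳ (θ-φ a)) (*-congˡ (trans (θ-Λ _) (trans (Λᴸ.T-cong (θ-γ₁ b)) (Λᴸ.T-scale _ _)))) ⟩
    ν a * φ (suc a) * γ (b ∷ []) + φ a * (ν b * γ (suc b ∷ []))
      ≈⟨ solve 6 (λ m f g n h k → m :* f :* g :+ h :* (n :* k) := m :* (f :* g) :+ n :* (h :* k)) refl _ _ _ _ _ _ ⟩
    ν a * (φ (suc a) * γ (b ∷ [])) + ν b * (φ a * γ (suc b ∷ [])) ∎

  θ-γ₃ : ∀ a b c .{{_ : NonZero a}} .{{_ : NonZero b}} .{{_ : NonZero c}} → θ (φ a * γ (b ∷ c ∷ [])) ≈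
         ν a * (φ (suc a) * γ (b ∷ c ∷ [])) + ν b * (φ a * γ (suc b ∷ c ∷ []))
         + ν c * (φ a * γ (b ∷ suc c ∷ []))
  θ-γ₃ a b c = begin
    θ (φ a * γ (b ∷ c ∷ []))
      ≈⟨ θ-* _ _ ⟩
    θ (φ a) * γ (b ∷ c ∷ []) + φ a * θ (γ (b ∷ c ∷ []))
      ≈⟨ +-cong (*-congʳ (θ-φ a)) (*-congˡ (trans (θ-Λ _) (trans (Λᴸ.T-cong (θ-γ₂ b c)) (T-comb₂ Λ-linear _ _)))) ⟩
    ν a * φ (suc a) * γ (b ∷ c ∷ []) + φ a * (ν b * γ (suc b ∷ c ∷ []) + ν c * γ (b ∷ suc c ∷ []))
      ≈⟨ solve 8 (λ m f g n h k p l → m :* f :* g :+ h :* (n :* k :+ p :* l) := m :* (f :* g) :+ n :* (h :* k) :+ p :* (h :* l)) refl _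
          _ _ _ _ _ _ _ ⟩
    ν a * (φ (suc a) * γ (b ∷ c ∷ [])) + ν b * (φ a * γ (suc b ∷ c ∷ []))
      + ν c * (φ a * γ (b ∷ suc c ∷ [])) ∎

  D-γ₁ : ∀ a .{{_ : NonZero a}} → D (γ (a ∷ [])) ≈ ν a * γ (suc a ∷ []) + ν a * Λ (Λ (φ (suc a) * 1#))
  D-γ₁ a = begin
    D (Λ (φ a * 1#))
      ≈⟨ D-Λ _ ⟩
    Λ (D (φ a * 1#)) + (Λ (θ (φ a * 1#)) + Λ (Λ (θ (φ a * 1#))))
      ≈⟨ +-cong (trans (Λᴸ.T-cong (trans (D-φ _ _) (trans (*-congˡ D-1) (zeroʳ _)))) Λᴸ.T-0)
                (+-cong e (trans (Λᴸ.T-cong e) (Λᴸ.T-scale _ _))) ⟩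
    0# + (ν a * γ (suc a ∷ []) + ν a * Λ (Λ (φ (suc a) * 1#)))
      ≈⟨ +-identityˡ _ ⟩
    ν a * γ (suc a ∷ []) + ν a * Λ (Λ (φ (suc a) * 1#)) ∎
    where
    e : Λ (θ (φ a * 1#)) ≈ ν a * γ (suc a ∷ [])
    e = trans (Λᴸ.T-cong (θ-γ₁ a)) (Λᴸ.T-scale _ _)

  -- In `B` the squared factor sits at the larger index, the sum of both gaps, so both letters are
  -- raised in turn; in `A` it sits at the smaller index and only `b` is raised.
  D-γ₂ : ∀ a b .{{_ : NonZero a}} .{{_ : NonZero b}} → D (γ (a ∷ b ∷ [])) ≈
         ν b * γ (a ∷ suc b ∷ []) + ν b * A a (suc b)
         + (ν a * γ (suc a ∷ b ∷ []) + ν b * γ (a ∷ suc b ∷ [])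
         + (ν a * B (suc a) b + ν b * B a (suc b)))
  D-γ₂ a b = trans (D-Λ _) (+-cong
      (trans (Λᴸ.T-cong (trans (D-φ _ _) (*-congˡ (D-γ₁ b)))) (T-comb₂ (Λφ-linear a) _ _))
      (+-cong e (trans (Λᴸ.T-cong e) (T-comb₂ Λ-linear _ _))))
    where
    e : Λ (θ (φ a * γ (b ∷ []))) ≈ ν a * γ (suc a ∷ b ∷ []) + ν b * γ (a ∷ suc b ∷ [])
    e = trans (Λᴸ.T-cong (θ-γ₂ a b)) (T-comb₂ Λ-linear _ _)

  D-γ₃ : ∀ a b c .{{_ : NonZero a}} .{{_ : NonZero b}} .{{_ : NonZero c}} → D (γ (a ∷ b ∷ c ∷ [])) ≈
         ν c * γ (a ∷ b ∷ suc c ∷ []) + ν c * T₃ a b (suc c)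
         + (ν b * γ (a ∷ suc b ∷ c ∷ []) + ν c * γ (a ∷ b ∷ suc c ∷ [])
         + (ν b * T₂ a (suc b) c + ν c * T₂ a b (suc c)))
         + (ν a * γ (suc a ∷ b ∷ c ∷ []) + ν b * γ (a ∷ suc b ∷ c ∷ [])
           + ν c * γ (a ∷ b ∷ suc c ∷ [])
         + (ν a * T₁ (suc a) b c + ν b * T₁ a (suc b) c
           + ν c * T₁ a b (suc c)))
  D-γ₃ a b c = trans (D-Λ _) (+-cong
      (trans (Λᴸ.T-cong (trans (D-φ _ _) (*-congˡ (D-γ₂ b c))))
        (trans (T-+ _ _) (+-cong (T-comb₂ lin _ _) (trans (T-+ _ _) (+-cong (T-comb₂ lin _ _) (T-comb₂ lin _ _))))))
      (+-cong e (trans (Λᴸ.T-cong e) (T-comb₃ Λ-linear _ _ _))))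
    where
    lin = Λφ-linear a
    open IsLinear lin
    e : Λ (θ (φ a * γ (b ∷ c ∷ []))) ≈ ν a * γ (suc a ∷ b ∷ c ∷ []) + ν b * γ (a ∷ suc b ∷ c ∷ [])
           + ν c * γ (a ∷ b ∷ suc c ∷ [])
    e = trans (Λᴸ.T-cong (θ-γ₃ a b c)) (T-comb₃ Λ-linear _ _ _)

  -- Congruences modulo lower weight

  module Modulo (P : Carrier → Set) (P-0 : P 0#)
               (P-+ : ∀ c {F F′} → P F → P F′ → P (ι c * F + F′))
               (P-≈ : ∀ {F F′} → F ≈ F′ → P F′ → P F)
               (n : ℕ)
               (P-G : ∀ w → All (1 ≤_) w → length w ≤ 3 → sum w ≤ n → P (G w))
               -- Besides single words, one kind of remainder is assumed to be small: ds of two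
               -- words of total weight at most `n` is itself a combination of words of weight at
               -- most `n`. This is the input to `P-A`.
               (P-R : ∀ k m → 2 ≤ k → 2 ≤ m → k ℕ.+ m ℕ.+ 1 ≤ n → P (R (k ∷ []) (m ∷ 1 ∷ []))) where
    P-∸ : ∀ {F F′} → P F → P F′ → P (F′ - F)
    P-∸ p r = P-≈ (solve 2 (λ x y → y :- x := con (ℚ.- 1ℚ) :* x :+ y) refl _ _) (P-+ (ℚ.- 1ℚ) p r)

    P-neg : ∀ {F} → P F → P (- F)
    P-neg p = P-≈ (solve 1 (λ x → :- x := con (ℚ.- 1ℚ) :* x :+ con 0ℚ) refl _) (P-+ (ℚ.- 1ℚ) p (P-≈ ι-0 P-0))

    P-⊹ : ∀ {F F′} → P F → P F′ → P (F + F′)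
    P-⊹ p r = P-≈ (solve 2 (λ x y → x :+ y := con 1ℚ :* x :+ y) refl _ _) (P-+ 1ℚ p r)

    -- A nested sum is linear in each letter, so by `merge` the merged letter φ_k φ_l may be
    -- replaced by φ_{k+l} as soon as the sums with a smaller letter φ_j in its place are in `P`.
    slot : ∀ u w {k l m} → Low m (φ k * φ l - φ (k ℕ.+ l)) → (∀ j → 2 ≤ j → j ≤ m → P (Γ (u ++ φ j ∷ w))) →
           P (Γ (u ++ φ k * φ l ∷ w) - Γ (u ++ φ (k ℕ.+ l) ∷ w))
    slot u w low p = P-≈ (sym (IsLinear.T-minus lin _ _)) (Low-image {P = P} lin P-0 P-+ P-≈ p low)
      where lin = slot-linear u w

    P-scale : ∀ c {F} → P F → P (ι c * F)
    P-scale c p = P-≈ (sym (+-identityʳ _)) (P-+ c p P-0)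

    P-γ₂ : ∀ a b → 2 ≤ a → 1 ≤ b → a ℕ.+ b ≤ n → P (γ (a ∷ b ∷ []))
    P-γ₂ a b p q r = P-≈ (sym (G-admissible (p ∷ [ b ])))
      (P-G _ (2≤⇒1≤ p ∷ q ∷ []) (s≤s (s≤s z≤n)) (≡.subst (λ m → a ℕ.+ m ≤ n) (≡.sym (ℕₚ.+-identityʳ b)) r))

    P-γ₃ : ∀ a b c → 2 ≤ a → 2 ≤ b → 1 ≤ c → a ℕ.+ b ℕ.+ c ≤ n → P (γ (a ∷ b ∷ c ∷ []))
    P-γ₃ a b c p q r s = P-≈ (sym (G-admissible (p ∷ q ∷ [ c ])))
      (P-G _ (2≤⇒1≤ p ∷ 2≤⇒1≤ q ∷ r ∷ []) ≤-refl
        (≡.subst (_≤ n) (≡.trans (ℕₚ.+-assoc a b c) (≡.cong (λ m → a ℕ.+ (b ℕ.+ m)) (≡.sym (ℕₚ.+-identityʳ c)))) s))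

    -- Of the stuffle words, 1,a,b and a,1,b have a letter 1 in front of another letter; they
    -- contribute ½ B and ½ A. The pure nested sums cancel against the quasi-shuffle except for the
    -- lower terms of the two merges, and so weight a + b suffices although the words have weight a
    -- + b + 1.
    R-1-2 : ∀ {a b} → 2 ≤ a → 2 ≤ b → a ℕ.+ b ≤ n → P (R (1 ∷ []) (a ∷ b ∷ []) - ι ½ * (A a b + B a b))
    R-1-2 {a} {b} pa pb N = P-≈ (trans (+-congʳ (+-cong
        (G-1 pa [ b ] ⊞ G-k1 pa pb [] ⊞ G-admissible (pa ∷ pb ∷ [ 1 ]) ⊞ G-admissible (pa ∷ [ _ ]) ⊞ G-admissible
            (s≤s (2≤⇒1≤ pa) ∷ [ _ ]) ⊞ refl)
        (-‿cong (trans (*-cong (G-admissible [ 1 ]) (G-admissible (pa ∷ [ b ]))) (γ-* (1 ∷ []) (a ∷ b ∷ []))))))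
      (solve 9 (λ x₁ x₂ x₃ x₄ x₅ y₄ y₅ A B →
          (x₁ :+ con ½ :* B :+ (x₂ :+ con ½ :* A :+ (x₃ :+ (x₄ :+ (x₅ :+ con 0ℚ)))))
          :- (x₁ :+ (x₂ :+ (x₃ :+ (y₄ :+ (y₅ :+ con 0ℚ))))) :- con ½ :* (A :+ B)
          := :- ((y₄ :- x₄) :+ (y₅ :- x₅))) refl _ _ _ _ _ _ _ _ _))
      (P-neg (P-⊹ (slot (φ a ∷ []) [] (merge 1 b (s≤s z≤n) pb) p₁) (slot [] (φ b ∷ []) (merge 1 a (s≤s z≤n) pa) p₂)))
      where
      p₁ : ∀ j → 2 ≤ j → j ≤ b → P (γ (a ∷ j ∷ []))
      p₁ j p r = P-γ₂ a j pa (2≤⇒1≤ p) (≤-trans (+-monoʳ-≤ a r) N)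
      p₂ : ∀ j → 2 ≤ j → j ≤ a → P (γ (j ∷ b ∷ []))
      p₂ j p r = P-γ₂ j b p (2≤⇒1≤ pb) (≤-trans (+-monoˡ-≤ b r) N)

    R-1-3 : ∀ {a b c} → 2 ≤ a → 2 ≤ b → 2 ≤ c → a ℕ.+ b ℕ.+ c ≤ n →
             P (R (1 ∷ []) (a ∷ b ∷ c ∷ []) - ι ½ * (T₁ a b c + T₂ a b c + T₃ a b c))
    R-1-3 {a} {b} {c} pa pb pc N = P-≈ (trans (+-congʳ (+-cong
        (G-1 pa (pb ∷ [ c ]) ⊞ G-k1 pa pb [ c ] ⊞ G-kl1 pa pb pc [] ⊞ G-admissible (pa ∷ pb ∷ pc ∷ [ 1 ]) ⊞
         G-admissible (pa ∷ pb ∷ [ _ ]) ⊞ G-admissible (pa ∷ s≤s (2≤⇒1≤ pb) ∷ [ _ ]) ⊞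
         G-admissible (s≤s (2≤⇒1≤ pa) ∷ pb ∷ [ _ ]) ⊞ refl)
        (-‿cong (trans (*-cong (G-admissible [ 1 ]) (G-admissible (pa ∷ pb ∷ [ c ]))) (γ-* (1 ∷ []) (a ∷ b ∷ c ∷ []))))))
      (solve 13 (λ x0 x1 x2 x3 x4 x5 x6 y4 y5 y6 T₁ T₂ T₃ →
          ((x0 :+ con ½ :* T₁) :+ ((x1 :+ con ½ :* T₂) :+ ((x2 :+ con ½ :* T₃) :+ (x3 :+ (x4 :+ (x5 :+ (x6 :+ con 0ℚ)))))))
          :- (x0 :+ (x1 :+ (x2 :+ (x3 :+ (y4 :+ (y5 :+ (y6 :+ con 0ℚ))))))) :- con ½ :* (T₁ :+ T₂ :+ T₃)
          := :- ((y4 :- x4) :+ (y5 :- x5) :+ (y6 :- x6))) refl _ _ _ _ _ _ _ _ _ _ _ _ _))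
      (P-neg (P-⊹ (P-⊹
        (slot (φ a ∷ φ b ∷ []) [] (merge 1 c (s≤s z≤n) pc) p₁)
        (slot (φ a ∷ []) (φ c ∷ []) (merge 1 b (s≤s z≤n) pb) p₂))
        (slot [] (φ b ∷ φ c ∷ []) (merge 1 a (s≤s z≤n) pa) p₃)))
      where
      p₁ : ∀ j → 2 ≤ j → j ≤ c → P (γ (a ∷ b ∷ j ∷ []))
      p₁ j p r = P-γ₃ a b j pa pb (2≤⇒1≤ p) (≤-trans (+-monoʳ-≤ (a ℕ.+ b) r) N)
      p₂ : ∀ j → 2 ≤ j → j ≤ b → P (γ (a ∷ j ∷ c ∷ []))
      p₂ j p r = P-γ₃ a j c pa p (2≤⇒1≤ pc) (≤-trans (+-monoˡ-≤ c (+-monoʳ-≤ a r)) N)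
      p₃ : ∀ j → 2 ≤ j → j ≤ a → P (γ (j ∷ b ∷ c ∷ []))
      p₃ j p r = P-γ₃ j b c p pb (2≤⇒1≤ pc) (≤-trans (+-monoˡ-≤ c (+-monoˡ-≤ b r)) N)

    suc-bound : ∀ {j m} → 2 ≤ j → j ≤ pred m → j ℕ.+ 1 ≤ m
    suc-bound {j} {m} p r = ≡.subst (_≤ m) (ℕₚ.+-comm 1 j) (≤-pred⇒< p r)

    -- Only the stuffle word m,1,k has a letter 1 before its end.
    R-k-m1 : ∀ {k m} → 2 ≤ k → 2 ≤ m → k ℕ.+ m ≤ n → P (R (k ∷ []) (m ∷ 1 ∷ []) - ι ½ * A m k)
    R-k-m1 {k} {m} pk pm N = P-≈ (trans (+-congʳ (+-cong
        (G-admissible (pk ∷ pm ∷ [ 1 ]) ⊞ G-admissible (pm ∷ pk ∷ [ 1 ]) ⊞ G-k1 pm pk [] ⊞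
         G-admissible (pm ∷ [ _ ]) ⊞ G-admissible (≤-+ʳ k pm ∷ [ 1 ]) ⊞ refl)
        (-‿cong (trans (*-cong (G-admissible [ k ]) (G-admissible (pm ∷ [ 1 ]))) (γ-* (k ∷ []) (m ∷ 1 ∷ []))))))
      (solve 8 (λ x0 x1 x2 x3 x4 y3 y4 A →
          (x0 :+ (x1 :+ ((x2 :+ con ½ :* A) :+ (x3 :+ (x4 :+ con 0ℚ)))))
          :- (x0 :+ (x1 :+ (x2 :+ (y3 :+ (y4 :+ con 0ℚ))))) :- con ½ :* A
          := :- ((y3 :- x3) :+ (y4 :- x4))) refl _ _ _ _ _ _ _ _))
      (P-neg (P-⊹
        (slot (φ m ∷ []) [] (merge-swap′ pk) p₁)
        (slot [] (φ 1 ∷ []) (merge k m (2≤⇒1≤ pk) pm) p₂)))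
      where
      p₁ : ∀ j → 2 ≤ j → j ≤ k → P (γ (m ∷ j ∷ []))
      p₁ j p r = P-γ₂ m j pm (2≤⇒1≤ p) (≤-trans (≡.subst (m ℕ.+ j ≤_) (ℕₚ.+-comm m k) (+-monoʳ-≤ m r)) N)
      p₂ : ∀ j → 2 ≤ j → j ≤ pred (k ℕ.+ m) → P (γ (j ∷ 1 ∷ []))
      p₂ j p r = P-γ₂ j 1 p (s≤s z≤n) (≤-trans (suc-bound p r) N)

    R-k-lm1 : ∀ {k l m} → 2 ≤ k → 2 ≤ l → 2 ≤ m → k ℕ.+ l ℕ.+ m ≤ n → P (R (k ∷ []) (l ∷ m ∷ 1 ∷ []) - ι ½ * T₃ l m k)
    R-k-lm1 {k} {l} {m} pk pl pm N = P-≈ (trans (+-congʳ (+-cong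
        (G-admissible (pk ∷ pl ∷ pm ∷ [ 1 ]) ⊞ G-admissible (pl ∷ pk ∷ pm ∷ [ 1 ]) ⊞ G-admissible (pl ∷ pm ∷ pk ∷ [ 1 ]) ⊞
         G-kl1 pl pm pk [] ⊞ G-admissible (pl ∷ pm ∷ [ _ ]) ⊞ G-admissible (pl ∷ ≤-+ʳ k pm ∷ [ 1 ]) ⊞
         G-admissible (≤-+ʳ k pl ∷ pm ∷ [ 1 ]) ⊞ refl)
        (-‿cong (trans (*-cong (G-admissible [ k ]) (G-admissible (pl ∷ pm ∷ [ 1 ]))) (γ-* (k ∷ []) (l ∷ m ∷ 1 ∷ []))))))
      (solve 11 (λ x0 x1 x2 x3 x4 x5 x6 y4 y5 y6 T₃ →
          (x0 :+ (x1 :+ (x2 :+ ((x3 :+ con ½ :* T₃) :+ (x4 :+ (x5 :+ (x6 :+ con 0ℚ)))))))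
          :- (x0 :+ (x1 :+ (x2 :+ (x3 :+ (y4 :+ (y5 :+ (y6 :+ con 0ℚ))))))) :- con ½ :* T₃
          := :- ((y4 :- x4) :+ (y5 :- x5) :+ (y6 :- x6))) refl _ _ _ _ _ _ _ _ _ _ _))
      (P-neg (P-⊹ (P-⊹
        (slot (φ l ∷ φ m ∷ []) [] (merge-swap′ pk) p₁)
        (slot (φ l ∷ []) (φ 1 ∷ []) (merge k m (2≤⇒1≤ pk) pm) p₂))
        (slot [] (φ m ∷ φ 1 ∷ []) (merge k l (2≤⇒1≤ pk) pl) p₃)))
      where
      eq₁ : k ℕ.+ l ℕ.+ m ≡ l ℕ.+ m ℕ.+ k
      eq₁ = solveℕ 3 (λ k l m → k ⊕ l ⊕ m ⊜ l ⊕ m ⊕ k) ≡.refl k l m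
      eq₂ : k ℕ.+ l ℕ.+ m ≡ l ℕ.+ (k ℕ.+ m)
      eq₂ = solveℕ 3 (λ k l m → k ⊕ l ⊕ m ⊜ l ⊕ (k ⊕ m)) ≡.refl k l m
      p₁ : ∀ j → 2 ≤ j → j ≤ k → P (γ (l ∷ m ∷ j ∷ []))
      p₁ j p r = P-γ₃ l m j pl pm (2≤⇒1≤ p) (≤-trans (+-monoʳ-≤ (l ℕ.+ m) r) (≡.subst (_≤ n) eq₁ N))
      p₂ : ∀ j → 2 ≤ j → j ≤ pred (k ℕ.+ m) → P (γ (l ∷ j ∷ 1 ∷ []))
      p₂ j p r = P-γ₃ l j 1 pl p (s≤s z≤n) (≡.subst (_≤ n) (≡.sym (ℕₚ.+-assoc l j 1))
                   (≤-trans (+-monoʳ-≤ l (suc-bound p r)) (≡.subst (_≤ n) eq₂ N)))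
      p₃ : ∀ j → 2 ≤ j → j ≤ pred (k ℕ.+ l) → P (γ (j ∷ m ∷ 1 ∷ []))
      p₃ j p r = P-γ₃ j m 1 p pm (s≤s z≤n) (≡.subst (_≤ n) (solveℕ 2 (λ j m → j ⊕ # 1 ⊕ m ⊜ j ⊕ m ⊕ # 1) ≡.refl j m)
                   (≤-trans (+-monoˡ-≤ m (suc-bound p r)) N))

    -- By `R-k-m1`, ½ A(j,c) is R(c; j,1) up to lower weight, and that remainder is in `P` by `P-R`.
    -- The bound is on c + j + 1, the weight of the words in ds(e_c, e_j e_1).
    P-A : ∀ {j c} → 2 ≤ j → 2 ≤ c → c ℕ.+ j ℕ.+ 1 ≤ n → P (A j c)
    P-A {j} {c} p q N = P-≈ (solve 2 (λ A r → A := con (ℕ→ℚ 2) :* (r :- (r :- con ½ :* A))) refl _ _)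
      (P-scale _ (P-∸ (R-k-m1 q p (≤-trans (m≤m+n (c ℕ.+ j) 1) N)) (P-R c j q p N)))

    -- Four stuffle words have a letter 1 before their end: a,1,b,c and a,b,1,c and b,a,1,c, and
    -- finally a+b,1,c, where a and b have merged to the left of the 1. The last one yields the term
    -- `A`, which has two summation indices instead of three.
    R-a1-bc : ∀ {a b c} → 2 ≤ a → 2 ≤ b → 2 ≤ c → a ℕ.+ b ℕ.+ c ≤ n →
               P (R (a ∷ 1 ∷ []) (b ∷ c ∷ []) - ι ½ * (T₂ a b c + T₃ a b c + T₃ b a c + A (a ℕ.+ b) c))
    R-a1-bc {a} {b} {c} pa pb pc N = P-≈ (trans (+-congʳ (+-cong
        (G-k1 pa pb [ c ] ⊞ G-kl1 pa pb pc [] ⊞ G-admissible (pa ∷ pb ∷ pc ∷ [ 1 ]) ⊞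
         G-admissible (pa ∷ pb ∷ [ _ ]) ⊞ G-admissible (pa ∷ s≤s (2≤⇒1≤ pb) ∷ [ _ ]) ⊞
         G-kl1 pb pa pc [] ⊞ G-admissible (pb ∷ pa ∷ pc ∷ [ 1 ]) ⊞ G-admissible (pb ∷ pa ∷ [ _ ]) ⊞
         G-admissible (pb ∷ pc ∷ pa ∷ [ 1 ]) ⊞ G-admissible (pb ∷ pac ∷ [ 1 ]) ⊞
         G-k1 pab pc [] ⊞ G-admissible (pab ∷ pc ∷ [ 1 ]) ⊞ G-admissible (pab ∷ [ _ ]) ⊞ refl)
        (-‿cong (trans (*-cong (G-admissible (pa ∷ [ 1 ])) (G-admissible (pb ∷ [ c ]))) (γ-* (a ∷ 1 ∷ []) (b ∷ c ∷ []))))))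
      (solve 25 (λ x0 x1 x2 x3 x4 x5 x6 x7 x8 x9 x10 x11 x12 y3 y4 y7 y9 y10 y11 y12 z A T₂ T₃ T₃′ →
          ((x0 :+ con ½ :* T₂) :+ ((x1 :+ con ½ :* T₃) :+ (x2 :+ (x3 :+
              (x4 :+ ((x5 :+ con ½ :* T₃′) :+ (x6 :+ (x7 :+ (x8 :+ (x9 :+ ((x10 :+ con ½ :* A) :+ (x11 :+ (x12 :+ con 0ℚ)))))))))))))
          :- (x0 :+ (x1 :+ (x2 :+ (y3 :+ (y4 :+ (x5 :+ (x6 :+ (y7 :+ (x8 :+ (y9 :+ (y10 :+ (y11 :+ (y12 :+ con 0ℚ))))))))))))) :- con ½
              :* (T₂ :+ T₃ :+ T₃′ :+ A)
          := :- ((y3 :- x3) :+ (y4 :- x4) :+ (y7 :- x7) :+ (y9 :- x9) :+ (y10 :- x10) :+ (y11 :- x11) :+ (y12 :- z) :+ (z :- x12))) refl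
              _ _ _ _ _ _ _ _ _ _ _ _ _ _ _ _ _ _ _ _ _ _ _ _ _))
      (P-neg (P-⊹ (P-⊹ (P-⊹ (P-⊹ (P-⊹ (P-⊹ (P-⊹
        (slot (φ a ∷ φ b ∷ []) [] (merge 1 c (s≤s z≤n) pc) (λ j p r → proj₁ (p₁ j p r)))
        (slot (φ a ∷ []) (φ c ∷ []) (merge 1 b (s≤s z≤n) pb) p₂))
        (slot (φ b ∷ φ a ∷ []) [] (merge 1 c (s≤s z≤n) pc) (λ j p r → proj₂ (p₁ j p r))))
        (slot (φ b ∷ []) (φ 1 ∷ []) (merge a c (2≤⇒1≤ pa) pc) p₃))
        -- The word j,1,c is not admissible, so γ(j,1,c) is not the series of a word. It is G(j,1,c)
        -- - ½ A(j,c), and `P-A` takes care of the correction.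
        (slot [] (φ 1 ∷ φ c ∷ []) (merge a b (2≤⇒1≤ pa) pb) (λ j p r →
          P-≈ (trans (solve 2 (λ x y → x := x :+ con ½ :* y :- con ½ :* y) refl _ _) (+-congʳ (sym (G-k1 p pc []))))
              (P-∸ (P-≈ (sym (trans (+-congˡ ι-0) (+-identityʳ _))) (P-+ ½ (p₅ j p r) (P-≈ ι-0 P-0))) (proj₁ (p₄ j p r))))))
        (slot [] (φ c ∷ φ 1 ∷ []) (merge a b (2≤⇒1≤ pa) pb) (λ j p r → proj₂ (p₄ j p r))))
        -- Here a merges with b and also 1 with c. The first merge is resolved with φ₁φ_c kept as
        -- one letter, which gives the intermediate term `z`; for each lower term φ_j the letter
        -- φ₁φ_c is then expanded in turn.
        (slot [] (φ 1 * φ c ∷ []) (merge a b (2≤⇒1≤ pa) pb) (λ j p r →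
          P-≈ (solve 2 (λ x y → x := x :- y :+ y) refl _ _) (P-⊹
            (slot (φ j ∷ []) [] (merge 1 c (s≤s z≤n) pc) (λ i q t → p₆ j i p q (ℕₚ.+-mono-≤ (<⇒≤ (≤-pred⇒< p r)) t)))
            (p₆ j (suc c) p (s≤s (2≤⇒1≤ pc)) (≡.subst (_≤ a ℕ.+ b ℕ.+ c) (≡.sym (ℕₚ.+-suc j c)) (+-monoˡ-≤ c (≤-pred⇒< p r))))))))
        (slot (φ (a ℕ.+ b) ∷ []) [] (merge 1 c (s≤s z≤n) pc) (λ j p r → p₆ (a ℕ.+ b) j pab p (+-monoʳ-≤ (a ℕ.+ b) r)))))
      where
      eq₂ : a ℕ.+ b ℕ.+ c ≡ b ℕ.+ (a ℕ.+ c)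
      eq₂ = solveℕ 3 (λ a b c → a ⊕ b ⊕ c ⊜ b ⊕ (a ⊕ c)) ≡.refl a b c
      j1c : ∀ j → 2 ≤ j → j ≤ pred (a ℕ.+ b) → j ℕ.+ 1 ℕ.+ c ≤ n
      j1c j p r = ≤-trans (+-monoˡ-≤ c (suc-bound p r)) N
      pab = ≤-+ʳ a pb
      pac = ≤-+ʳ a pc
      p₁ : ∀ j → 2 ≤ j → j ≤ c → P (γ (a ∷ b ∷ j ∷ [])) × P (γ (b ∷ a ∷ j ∷ []))
      p₁ j p r = P-γ₃ a b j pa pb (2≤⇒1≤ p) (≤-trans (+-monoʳ-≤ (a ℕ.+ b) r) N)
               , P-γ₃ b a j pb pa (2≤⇒1≤ p) (≤-trans (≡.subst (λ i → i ℕ.+ j ≤ a ℕ.+ b ℕ.+ c) (ℕₚ.+-comm a b) (+-monoʳ-≤ (a ℕ.+ b) r)) N)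
      p₂ : ∀ j → 2 ≤ j → j ≤ b → P (γ (a ∷ j ∷ c ∷ []))
      p₂ j p r = P-γ₃ a j c pa p (2≤⇒1≤ pc) (≤-trans (+-monoˡ-≤ c (+-monoʳ-≤ a r)) N)
      p₃ : ∀ j → 2 ≤ j → j ≤ pred (a ℕ.+ c) → P (γ (b ∷ j ∷ 1 ∷ []))
      p₃ j p r = P-γ₃ b j 1 pb p (s≤s z≤n) (≡.subst (_≤ n) (≡.sym (ℕₚ.+-assoc b j 1))
                   (≤-trans (+-monoʳ-≤ b (suc-bound p r)) (≡.subst (_≤ n) eq₂ N)))
      p₄ : ∀ j → 2 ≤ j → j ≤ pred (a ℕ.+ b) → P (G (j ∷ 1 ∷ c ∷ [])) × P (γ (j ∷ c ∷ 1 ∷ []))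
      p₄ j p r = P-G (j ∷ 1 ∷ c ∷ []) (2≤⇒1≤ p ∷ s≤s z≤n ∷ 2≤⇒1≤ pc ∷ []) ≤-refl
                   (≡.subst (_≤ n) (solveℕ 2 (λ j c → j ⊕ # 1 ⊕ c ⊜ j ⊕ (# 1 ⊕ (c ⊕ # 0))) ≡.refl j c) (j1c j p r))
               , P-γ₃ j c 1 p pc (s≤s z≤n) (≡.subst (_≤ n) (solveℕ 2 (λ j c → j ⊕ # 1 ⊕ c ⊜ j ⊕ c ⊕ # 1) ≡.refl j c) (j1c j p r))
      p₅ : ∀ j → 2 ≤ j → j ≤ pred (a ℕ.+ b) → P (A j c)
      p₅ j p r = P-A p pc (≡.subst (_≤ n) (solveℕ 2 (λ j c → j ⊕ # 1 ⊕ c ⊜ c ⊕ j ⊕ # 1) ≡.refl j c) (j1c j p r))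
      p₆ : ∀ i j → 2 ≤ i → 2 ≤ j → i ℕ.+ j ≤ a ℕ.+ b ℕ.+ c → P (γ (i ∷ j ∷ []))
      p₆ i j p r s = P-γ₂ i j p (2≤⇒1≤ r) (≤-trans s N)

    depth₂ : ∀ a b → 2 ≤ a → 2 ≤ b → a ℕ.+ b ℕ.+ 1 ≤ n →
      P (D (G (a ∷ b ∷ [])) -
         (ι (ℕ→ℚ 2) * ν a * (R (1 ∷ []) (suc a ∷ b ∷ []) - R (b ∷ []) (suc a ∷ 1 ∷ []))
          + ι (ℕ→ℚ 2) * ν b * R (1 ∷ []) (a ∷ suc b ∷ [])))
    depth₂ a b pa pb N≤n = P-≈ (trans (+-congʳ (trans (D-cong (G-admissible (pa ∷ [ _ ]))) (D-γ₂ a b)))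
      -- `A`, `B` belong to the letters (a + 1, b) and `A′`, `B′` to (a, b + 1). All four cancel in
      -- the identity; what stays is the errors of the three remainders and the raised sums `g`,
      -- `h`, which are themselves of weight a + b + 1.
      (solve 11 (λ α β g h A B A′ B′ r s t →
            β :* g :+ β :* A′ :+ (α :* h :+ β :* g :+ (α :* B :+ β :* B′))
              :- (con (ℕ→ℚ 2) :* α :* (r :- s) :+ con (ℕ→ℚ 2) :* β :* t)
         := con (ℕ→ℚ 2) :* (β :* g) :+ α :* h
              :- con (ℕ→ℚ 2) :* (α :* (r :- con ½ :* (A :+ B)))
              :+ con (ℕ→ℚ 2) :* (α :* (s :- con ½ :* A))
              :- con (ℕ→ℚ 2) :* (β :* (t :- con ½ :* (A′ :+ B′)))) refl _ _ _ _ _ _ _ _ _ _ _))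
      (P-∸ (P-scale _ (P-scale _ (R-1-2 pa pb′ (≡.subst (_≤ n) eq₁ N≤n))))
       (P-⊹ (P-∸ (P-scale _ (P-scale _ (R-1-2 pa′ pb (≡.subst (_≤ n) eq₂ N≤n))))
        (P-⊹ (P-scale _ (P-scale _ (P-γ₂ a (suc b) pa (s≤s z≤n) (≡.subst (_≤ n) eq₁ N≤n))))
             (P-scale _ (P-γ₂ (suc a) b pa′ (2≤⇒1≤ pb) (≡.subst (_≤ n) eq₂ N≤n)))))
        (P-scale _ (P-scale _ (R-k-m1 pb pa′ (≡.subst (_≤ n) eq₃ N≤n))))))
      where
      instance
        _ = ≥2-nonZero pa
        _ = ≥2-nonZero pb
      pa′ = m≤n⇒m≤1+n pa
      pb′ = m≤n⇒m≤1+n pb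
      eq₁ : a ℕ.+ b ℕ.+ 1 ≡ a ℕ.+ suc b
      eq₁ = solveℕ 2 (λ a b → a ⊕ b ⊕ # 1 ⊜ a ⊕ (# 1 ⊕ b)) ≡.refl a b
      eq₂ : a ℕ.+ b ℕ.+ 1 ≡ suc a ℕ.+ b
      eq₂ = solveℕ 2 (λ a b → a ⊕ b ⊕ # 1 ⊜ # 1 ⊕ a ⊕ b) ≡.refl a b
      eq₃ : a ℕ.+ b ℕ.+ 1 ≡ b ℕ.+ suc a
      eq₃ = solveℕ 2 (λ a b → a ⊕ b ⊕ # 1 ⊜ b ⊕ (# 1 ⊕ a)) ≡.refl a b

    depth₃ : ∀ a b c → 2 ≤ a → 2 ≤ b → 2 ≤ c → a ℕ.+ b ℕ.+ c ℕ.+ 1 ≤ n →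
      P (D (G (a ∷ b ∷ c ∷ [])) -
         (ι (ℕ→ℚ 2) * ν a * (R (1 ∷ []) (suc a ∷ b ∷ c ∷ []) + R (c ∷ []) (b ∷ suc a ∷ 1 ∷ []))
          + ι (ℕ→ℚ 2) * ν a * (R (c ∷ []) (suc a ℕ.+ b ∷ 1 ∷ []) - R (suc a ∷ 1 ∷ []) (b ∷ c ∷ []))
          + ι (ℕ→ℚ 2) * ν b * (R (1 ∷ []) (a ∷ suc b ∷ c ∷ []) - R (c ∷ []) (a ∷ suc b ∷ 1 ∷ []))
          + ι (ℕ→ℚ 2) * ν c * R (1 ∷ []) (a ∷ b ∷ suc c ∷ [])))
    depth₃ a b c pa pb pc N≤n = P-≈ (trans (+-congʳ (trans (D-cong (G-admissible (pa ∷ pb ∷ [ _ ]))) (D-γ₃ a b c)))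
      -- The suffix of a `T` names the raised letter. `T₃′` is `T₃ b (suc a) c` and `A′` is
      -- `A (suc a + b) c`: both enter through `r₄`, the remainder of ds(e_{a+1} e_1, e_b e_c), and
      -- are removed by `r₂` and `r₃`.
      (solve 24 (λ α β δ g₁ g₂ g₃ T₁a T₂a T₃a T₃′ A′ T₁b T₂b T₃b T₁c T₂c T₃c r₁ r₂ r₃ r₄ r₅ r₆ r₇ →
            δ :* g₃ :+ δ :* T₃c :+ (β :* g₂ :+ δ :* g₃ :+ (β :* T₂b :+ δ :* T₂c))
              :+ (α :* g₁ :+ β :* g₂ :+ δ :* g₃ :+ (α :* T₁a :+ β :* T₁b :+ δ :* T₁c))
              :- (con (ℕ→ℚ 2) :* α :* (r₁ :+ r₂) :+ con (ℕ→ℚ 2) :* α :* (r₃ :- r₄) :+ con (ℕ→ℚ 2) :* β :* (r₅ :- r₆) :+ con (ℕ→ℚ 2) :* δ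
                  :* r₇)
         := con (ℕ→ℚ 3) :* (δ :* g₃) :+ con (ℕ→ℚ 2) :* (β :* g₂) :+ α :* g₁
              :- con (ℕ→ℚ 2) :* (α :* (r₁ :- con ½ :* (T₁a :+ T₂a :+ T₃a)))
              :- con (ℕ→ℚ 2) :* (α :* (r₂ :- con ½ :* T₃′))
              :- con (ℕ→ℚ 2) :* (α :* (r₃ :- con ½ :* A′))
              :+ con (ℕ→ℚ 2) :* (α :* (r₄ :- con ½ :* (T₂a :+ T₃a :+ T₃′ :+ A′)))
              :- con (ℕ→ℚ 2) :* (β :* (r₅ :- con ½ :* (T₁b :+ T₂b :+ T₃b)))
              :+ con (ℕ→ℚ 2) :* (β :* (r₆ :- con ½ :* T₃b))
              :- con (ℕ→ℚ 2) :* (δ :* (r₇ :- con ½ :* (T₁c :+ T₂c :+ T₃c)))) refl _ _ _ _ _ _ _ _ _ _ _ _ _ _ _ _ _ _ _ _ _ _ _ _))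
      (P-∸ (twice (R-1-3 pa pb pc′ eq₃))
      (P-⊹ (P-∸ (twice (R-1-3 pa pb′ pc eq₂))
      (P-⊹ (P-∸ (twice (R-k-m1 pc (≤-+ʳ (suc a) pb) eq₅))
           (P-∸ (twice (R-k-lm1 pc pb pa′ eq₄))
           (P-∸ (twice (R-1-3 pa′ pb pc eq₁))
           (P-⊹ (P-⊹ (P-scale _ (P-scale _ (P-γ₃ a b (suc c) pa pb (s≤s z≤n) eq₃)))
                     (twice (P-γ₃ a (suc b) c pa pb′ (2≤⇒1≤ pc) eq₂)))
                (P-scale _ (P-γ₃ (suc a) b c pa′ pb (2≤⇒1≤ pc) eq₁))))))
           (twice (R-a1-bc pa′ pb pc eq₁))))
           (twice (R-k-lm1 pc pa pb′ eq₆))))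
      where
      instance
        _ = ≥2-nonZero pa
        _ = ≥2-nonZero pb
        _ = ≥2-nonZero pc
      pa′ = m≤n⇒m≤1+n pa
      pb′ = m≤n⇒m≤1+n pb
      pc′ = m≤n⇒m≤1+n pc
      twice : ∀ {q F} → P F → P (ι (ℕ→ℚ 2) * (ι q * F))
      twice p = P-scale _ (P-scale _ p)
      bound : ∀ {i} → a ℕ.+ b ℕ.+ c ℕ.+ 1 ≡ i → i ≤ n
      bound ≡.refl = N≤n
      eq₁ : suc a ℕ.+ b ℕ.+ c ≤ n
      eq₁ = bound (solveℕ 3 (λ a b c → a ⊕ b ⊕ c ⊕ # 1 ⊜ # 1 ⊕ a ⊕ b ⊕ c) ≡.refl a b c)
      eq₂ : a ℕ.+ suc b ℕ.+ c ≤ n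
      eq₂ = bound (solveℕ 3 (λ a b c → a ⊕ b ⊕ c ⊕ # 1 ⊜ a ⊕ (# 1 ⊕ b) ⊕ c) ≡.refl a b c)
      eq₃ : a ℕ.+ b ℕ.+ suc c ≤ n
      eq₃ = bound (solveℕ 3 (λ a b c → a ⊕ b ⊕ c ⊕ # 1 ⊜ a ⊕ b ⊕ (# 1 ⊕ c)) ≡.refl a b c)
      eq₄ : c ℕ.+ b ℕ.+ suc a ≤ n
      eq₄ = bound (solveℕ 3 (λ a b c → a ⊕ b ⊕ c ⊕ # 1 ⊜ c ⊕ b ⊕ (# 1 ⊕ a)) ≡.refl a b c)
      eq₅ : c ℕ.+ (suc a ℕ.+ b) ≤ n
      eq₅ = bound (solveℕ 3 (λ a b c → a ⊕ b ⊕ c ⊕ # 1 ⊜ c ⊕ (# 1 ⊕ a ⊕ b)) ≡.refl a b c)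
      eq₆ : c ℕ.+ a ℕ.+ suc b ≤ n
      eq₆ = bound (solveℕ 3 (λ a b c → a ⊕ b ⊕ c ⊕ # 1 ⊜ c ⊕ a ⊕ (# 1 ⊕ b)) ≡.refl a b c)

-- Characters of the shuffle algebra

module ShuffleCharacter (K : ℚ-Algebra) where
  open ℚ-Algebra K
  open Solver using (solve; _:=_; _:+_; _:*_; con)
  open import Relation.Binary.Reasoning.Setoid setoid

  Word : Set
  Word = List Letter

  -- The linear extension of `f`, evaluated at the shuffle product of two words; the recursion of
  -- `_⧢ʷ_` is followed without forming the list of words.
  shuffle : (Word → Carrier) → Word → Word → Carrier
  shuffle f []      v       = f v
  shuffle f (a ∷ u) []      = f (a ∷ u)
  shuffle f (a ∷ u) (b ∷ v) = shuffle (λ w → f (a ∷ w)) u (b ∷ v) + shuffle (λ w → f (b ∷ w)) (a ∷ u) v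

  shuffle-[] : ∀ f u → shuffle f u [] ≈ f u
  shuffle-[] f []      = refl
  shuffle-[] f (_ ∷ _) = refl

  shuffle-cong : ∀ {f g} → (∀ w → f w ≈ g w) → ∀ u v → shuffle f u v ≈ shuffle g u v
  shuffle-cong p []      v       = p v
  shuffle-cong p (a ∷ u) []      = p (a ∷ u)
  shuffle-cong p (a ∷ u) (b ∷ v) = +-cong (shuffle-cong (λ w → p (a ∷ w)) u (b ∷ v)) (shuffle-cong (λ w → p (b ∷ w)) (a ∷ u) v)

  shuffle-linear : ∀ c f g u v → shuffle (λ w → c * f w + g w) u v ≈ c * shuffle f u v + shuffle g u v
  shuffle-linear c f g []      v       = refl
  shuffle-linear c f g (a ∷ u) []      = refl
  shuffle-linear c f g (a ∷ u) (b ∷ v) = trans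
    (+-cong (shuffle-linear c _ _ u (b ∷ v)) (shuffle-linear c _ _ (a ∷ u) v))
    (solve 5 (λ c x y z w → c :* x :+ y :+ (c :* z :+ w) := c :* (x :+ z) :+ (y :+ w)) refl _ _ _ _ _)

  shuffle-scale : ∀ c f u v → shuffle (λ w → c * f w) u v ≈ c * shuffle f u v
  shuffle-scale c f []      v       = refl
  shuffle-scale c f (a ∷ u) []      = refl
  shuffle-scale c f (a ∷ u) (b ∷ v) = trans
    (+-cong (shuffle-scale c _ u (b ∷ v)) (shuffle-scale c _ (a ∷ u) v)) (sym (distribˡ _ _ _))

  extend : (Word → Carrier) → ℌ → Carrier
  extend f []            = 0#
  extend f ((c , w) ∷ x) = ι c * f w + extend f x

  extend-++ : ∀ f x y → extend f (x ++ y) ≈ extend f x + extend f y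
  extend-++ f []      y = sym (+-identityˡ _)
  extend-++ f (_ ∷ x) y = trans (+-congˡ (extend-++ f x y)) (sym (+-assoc _ _ _))

  extend-∷ : ∀ f a x → extend f (mapLin (a ∷_) x) ≈ extend (λ w → f (a ∷ w)) x
  extend-∷ f a []      = refl
  extend-∷ f a (_ ∷ x) = +-congˡ (extend-∷ f a x)

  extend-single : ∀ f w → extend f ((1ℚ , w) ∷ []) ≈ f w
  extend-single f w = trans (+-identityʳ _) (trans (*-congʳ ι-1) (*-identityˡ _))

  extend-⧢ʷ : ∀ f u v → extend f (u ⧢ʷ v) ≈ shuffle f u v
  extend-⧢ʷ f []      v       = extend-single f v
  extend-⧢ʷ f (a ∷ u) []      = extend-single f (a ∷ u)
  extend-⧢ʷ f (a ∷ u) (b ∷ v) = begin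
    extend f (mapLin (a ∷_) (u ⧢ʷ (b ∷ v)) ++ mapLin (b ∷_) ((a ∷ u) ⧢ʷ v))
      ≈⟨ extend-++ f (mapLin (a ∷_) (u ⧢ʷ (b ∷ v))) _ ⟩
    extend f (mapLin (a ∷_) (u ⧢ʷ (b ∷ v))) + extend f (mapLin (b ∷_) ((a ∷ u) ⧢ʷ v))
      ≈⟨ +-cong (extend-∷ f a (u ⧢ʷ (b ∷ v))) (extend-∷ f b ((a ∷ u) ⧢ʷ v)) ⟩
    extend (λ w → f (a ∷ w)) (u ⧢ʷ (b ∷ v)) + extend (λ w → f (b ∷ w)) ((a ∷ u) ⧢ʷ v)
      ≈⟨ +-cong (extend-⧢ʷ _ u (b ∷ v)) (extend-⧢ʷ _ (a ∷ u) v) ⟩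
    shuffle f (a ∷ u) (b ∷ v) ∎

  splitSum : (Word → Word → Carrier) → Word → Carrier
  splitSum k []      = k [] []
  splitSum k (a ∷ w) = k [] (a ∷ w) + splitSum (λ u → k (a ∷ u)) w

  splitSum-cong : ∀ {k l} → (∀ u v → k u v ≈ l u v) → ∀ w → splitSum k w ≈ splitSum l w
  splitSum-cong p []      = p [] []
  splitSum-cong p (a ∷ w) = +-cong (p [] (a ∷ w)) (splitSum-cong (λ u → p (a ∷ u)) w)

  splitSum-+ : ∀ k l w → splitSum (λ u v → k u v + l u v) w ≈ splitSum k w + splitSum l w
  splitSum-+ k l []      = refl
  splitSum-+ k l (a ∷ w) = trans (+-congˡ (splitSum-+ _ _ w))
    (solve 4 (λ x y z w → x :+ y :+ (z :+ w) := x :+ z :+ (y :+ w)) refl _ _ _ _)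

  splitSum-scale : ∀ c k w → splitSum (λ u v → c * k u v) w ≈ c * splitSum k w
  splitSum-scale c k []      = refl
  splitSum-scale c k (a ∷ w) = trans (+-congˡ (splitSum-scale c _ w)) (sym (distribˡ _ _ _))

  infixl 7 _⋆_
  _⋆_ : (Word → Carrier) → (Word → Carrier) → Word → Carrier
  f ⋆ g = splitSum (λ u v → f u * g v)

  splitSum₂ : (F G : Word → Word → Carrier) → Word → Word → Carrier
  splitSum₂ F G u v = splitSum (λ u′ u″ → splitSum (λ v′ v″ → F u′ v′ * G u″ v″) v) u

  -- Deconcatenation is a homomorphism for the shuffle product.
  shuffle-⋆ : ∀ f g u v → shuffle (f ⋆ g) u v ≈ splitSum₂ (shuffle f) (shuffle g) u v
  shuffle-⋆ f g []      v       = refl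
  shuffle-⋆ f g (a ∷ u) []      =
    +-congˡ (splitSum-cong (λ _ u″ → *-congˡ (sym (shuffle-[] g u″))) u)
  shuffle-⋆ f g (a ∷ u) (b ∷ v) = begin
    shuffle (λ w → f [] * g (a ∷ w) + (∂ a ⋆ g) w) u (b ∷ v) + shuffle (λ w → f [] * g (b ∷ w) + (∂ b ⋆ g) w) (a ∷ u) v
      ≈⟨ +-cong (trans (shuffle-linear (f []) _ _ u (b ∷ v)) (+-congˡ (trans (shuffle-⋆ (∂ a) g u (b ∷ v))
                  (splitSum-+ _ _ u))))
                (trans (shuffle-linear (f []) _ _ (a ∷ u) v) (+-congˡ (shuffle-⋆ (∂ b) g (a ∷ u) v))) ⟩
    f [] * shuffle (λ w → g (a ∷ w)) u (b ∷ v) + (X′ + Y₁) + (f [] * shuffle (λ w → g (b ∷ w)) (a ∷ u) v + (Z + Y₂))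
      ≈⟨ solve 7 (λ f g h x y z w → f :* g :+ (x :+ y) :+ (f :* h :+ (z :+ w)) := f :* (g :+ h) :+ z :+ (x :+ (y :+ w))) refl _ _ _ _ _
          _ _ ⟩
    f [] * shuffle g (a ∷ u) (b ∷ v) + Z + (X′ + (Y₁ + Y₂))
      ≈⟨ +-congˡ (+-cong (splitSum-cong (λ u′ _ → *-congʳ (shuffle-[] (∂ a) u′)) u)
            (sym (trans (splitSum-cong (λ u′ u″ → trans (splitSum-cong (λ v′ v″ → distribʳ _ _ _) v) (splitSum-+ _ _ v)) u)
                (splitSum-+ _ _ u)))) ⟩
    f [] * shuffle g (a ∷ u) (b ∷ v) + Z + (X + Y)
      ≈⟨ +-congˡ (splitSum-+ _ _ u) ⟨
    splitSum₂ (shuffle f) (shuffle g) (a ∷ u) (b ∷ v) ∎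
    where
    ∂ : Letter → Word → Carrier
    ∂ c w = f (c ∷ w)
    X  = splitSum (λ u′ u″ → f (a ∷ u′) * shuffle g u″ (b ∷ v)) u
    X′ = splitSum (λ u′ u″ → shuffle (∂ a) u′ [] * shuffle g u″ (b ∷ v)) u
    Y  = splitSum (λ u′ u″ → splitSum (λ v′ v″ → shuffle f (a ∷ u′) (b ∷ v′) * shuffle g u″ v″) v) u
    Y₁ = splitSum (λ u′ u″ → splitSum (λ v′ v″ → shuffle (∂ a) u′ (b ∷ v′) * shuffle g u″ v″) v) u
    Y₂ = splitSum (λ u′ u″ → splitSum (λ v′ v″ → shuffle (∂ b) (a ∷ u′) v′ * shuffle g u″ v″) v) u
    Z  = splitSum (λ v′ v″ → f (b ∷ v′) * shuffle g (a ∷ u) v″) v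

  IsCharacter : (Word → Carrier) → Set
  IsCharacter f = ∀ u v → shuffle f u v ≈ f u * f v

  ⋆-character : ∀ {f g} → IsCharacter f → IsCharacter g → IsCharacter (f ⋆ g)
  ⋆-character {f} {g} χf χg u v = begin
    shuffle (f ⋆ g) u v
      ≈⟨ shuffle-⋆ f g u v ⟩
    splitSum₂ (shuffle f) (shuffle g) u v
      ≈⟨ splitSum-cong (λ u′ u″ → trans (splitSum-cong (λ v′ v″ → trans (*-cong (χf u′ v′) (χg u″ v″))
           (solve 4 (λ x y z w → x :* y :* (z :* w) := x :* z :* (y :* w)) refl _ _ _ _)) v)
           (trans (splitSum-scale _ _ v) (*-comm _ _))) u ⟩
    splitSum (λ u′ u″ → (f ⋆ g) v * (f u′ * g u″)) u
      ≈⟨ trans (splitSum-scale _ _ u) (*-comm _ _) ⟩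
    (f ⋆ g) u * (f ⋆ g) v ∎

  -- The coefficients of the exponential of the linear element Σ_b y_b b.
  expo : (Letter → Carrier) → Word → Carrier
  expo y []      = 1#
  expo y (b ∷ w) = ι (ℤ.+ 1 ℚ./ suc (length w)) * (y b * expo y w)

  expo-∷ : ∀ y b w → ν (suc (length w)) * expo y (b ∷ w) ≈ y b * expo y w
  expo-∷ y b w = trans (sym (*-assoc _ _ _)) (trans (*-congʳ (ν-inverse (length w))) (*-identityˡ _))

  degree : (Word → Carrier) → Word → Carrier
  degree f w = ν (length w) * f w

  shuffle-degree : ∀ f u v → shuffle (degree f) u v ≈ (ν (length u) + ν (length v)) * shuffle f u v
  shuffle-degree f []      v       = *-congʳ (sym (trans (+-congʳ ι-0) (+-identityˡ _)))
  shuffle-degree f (a ∷ u) []      = *-congʳ (sym (trans (+-congˡ ι-0) (+-identityʳ _)))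
  shuffle-degree f (a ∷ u) (b ∷ v) = begin
    shuffle (λ w → degree f (a ∷ w)) u (b ∷ v) + shuffle (λ w → degree f (b ∷ w)) (a ∷ u) v
      ≈⟨ +-cong (step a u (b ∷ v)) (step b (a ∷ u) v) ⟩
    1# * S + (m + ν (suc (length v))) * S + (1# * T + (ν (suc (length u)) + n) * T)
      ≈⟨ +-cong (+-cong (*-congʳ (sym ι-1)) (*-congʳ (+-congˡ (ν-+ 1 (length v)))))
          (+-cong (*-congʳ (sym ι-1)) (*-congʳ (+-congʳ (ν-+ 1 (length u))))) ⟩
    ι 1ℚ * S + (m + (ι 1ℚ + n)) * S + (ι 1ℚ * T + (ι 1ℚ + m + n) * T)
      ≈⟨ solve 4 (λ m n S T → con 1ℚ :* S :+ (m :+ (con 1ℚ :+ n)) :* S :+ (con 1ℚ :* T :+ (con 1ℚ :+ m :+ n) :* T)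
           := (con 1ℚ :+ m :+ (con 1ℚ :+ n)) :* (S :+ T)) refl m n S T ⟩
    (ι 1ℚ + m + (ι 1ℚ + n)) * (S + T)
      ≈⟨ *-congʳ (+-cong (ν-+ 1 (length u)) (ν-+ 1 (length v))) ⟨
    (ν (suc (length u)) + ν (suc (length v))) * (S + T) ∎
    where
    m = ν (length u)
    n = ν (length v)
    S = shuffle (λ w → f (a ∷ w)) u (b ∷ v)
    T = shuffle (λ w → f (b ∷ w)) (a ∷ u) v
    step : ∀ c u v → shuffle (λ w → degree f (c ∷ w)) u v ≈
             1# * shuffle (λ w → f (c ∷ w)) u v + (ν (length u) + ν (length v)) * shuffle (λ w → f (c ∷ w)) u v
    step c u v = trans (shuffle-cong (λ w → trans (*-congʳ (trans (ν-+ 1 (length w)) (+-congʳ ι-1))) (distribʳ _ _ _)) u v)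
      (trans (shuffle-linear 1# _ _ u v) (+-congˡ (shuffle-degree _ u v)))

  -- Multiply both sides by the total length, which is the length of every shuffle. By `expo-∷`,
  -- length times `expo` strips off the first letter; on the right this is done in each factor
  -- separately, as in a Leibniz rule, and the shorter words are covered by induction.
  expo-character : ∀ y → IsCharacter (expo y)
  expo-character y []      v       = sym (*-identityˡ _)
  expo-character y (a ∷ u) []      = sym (*-identityʳ _)
  expo-character y (a ∷ u) (b ∷ v) = trans (cancel-ν (length u ℕ.+ suc (length v)) (begin
    ν (suc (length u) ℕ.+ suc (length v)) * shuffle ε (a ∷ u) (b ∷ v)
      ≈⟨ *-congʳ (ν-+ (suc (length u)) (suc (length v))) ⟩
    (ν (suc (length u)) + ν (suc (length v))) * shuffle ε (a ∷ u) (b ∷ v)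
      ≈⟨ shuffle-degree ε (a ∷ u) (b ∷ v) ⟨
    shuffle (degree ε) (a ∷ u) (b ∷ v)
      ≈⟨ +-cong (step a u (b ∷ v)) (step b (a ∷ u) v) ⟩
    y a * shuffle ε u (b ∷ v) + y b * shuffle ε (a ∷ u) v
      ≈⟨ +-cong (*-congˡ (expo-character y u (b ∷ v))) (*-congˡ (expo-character y (a ∷ u) v)) ⟩
    y a * (ε u * ε (b ∷ v)) + y b * (ε (a ∷ u) * ε v)
      ≈⟨ solve 6 (λ p q a b u v → p :* (u :* b) :+ q :* (a :* v) := p :* u :* b :+ a :* (q :* v)) refl _ _ _ _ _ _ ⟩
    y a * ε u * ε (b ∷ v) + ε (a ∷ u) * (y b * ε v)
      ≈⟨ +-cong (*-congʳ (expo-∷ y a u)) (*-congˡ (expo-∷ y b v)) ⟨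
    ν (suc (length u)) * ε (a ∷ u) * ε (b ∷ v) + ε (a ∷ u) * (ν (suc (length v)) * ε (b ∷ v))
      ≈⟨ solve 4 (λ m n a b → m :* a :* b :+ a :* (n :* b) := (m :+ n) :* (a :* b)) refl _ _ _ _ ⟩
    (ν (suc (length u)) + ν (suc (length v))) * (ε (a ∷ u) * ε (b ∷ v))
      ≈⟨ *-congʳ (ν-+ (suc (length u)) (suc (length v))) ⟨
    ν (suc (length u) ℕ.+ suc (length v)) * (ε (a ∷ u) * ε (b ∷ v)) ∎)) (sym (cancel-ν (length u ℕ.+ suc (length v)) refl))
    where
    ε = expo y
    step : ∀ c u v → shuffle (λ w → degree ε (c ∷ w)) u v ≈ y c * shuffle ε u v
    step c u v = trans (shuffle-cong (expo-∷ y c) u v) (shuffle-scale (y c) ε u v)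

-- Nested sums as a model of the Rota-Baxter axioms

record Atoms (K : ℚ-Algebra) : Set where
  open ℚ-Algebra K
  field
    L  : ℕ → Carrier
    D₀ : Carrier → Carrier
    L-* : ∀ a b → L (suc a) * L (suc b) ≈ L (suc a ℕ.+ suc b) * (1# + L (suc a) + L (suc b))
    D₀-cong : ∀ {x y} → x ≈ y → D₀ x ≈ D₀ y
    D₀-+ : ∀ x y → D₀ (x + y) ≈ D₀ x + D₀ y
    D₀-* : ∀ x y → D₀ (x * y) ≈ D₀ x * y + x * D₀ y
    D₀-ι : ∀ c → D₀ (ι c) ≈ 0#
    D₀-L : ∀ s → D₀ (L s) ≈ ν s * (L s + L s * L s)

module NestedSums (K : ℚ-Algebra) (atoms : Atoms K) where
  open ℚ-Algebra K
  open Atoms atoms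
  open Solver using (solve; _:=_; _:+_; _:*_; _:-_; :-_; con)
  open import Relation.Binary.Reasoning.Setoid setoid
  open PowerSeries K using (algebra; antidiag; antidiag-cong; antidiag-+; antidiag-scale; conv; const; θ-derivation) renaming (θ to θ′)

  -- The constant term is 0 also for k = 1, where the divided power `0ℚ ^[ 0 ]` would be 1:
  -- consecutive summation indices must differ.
  φ : ℕ → ℕ → Carrier
  φ k zero    = 0#
  φ k (suc n) = ι (ℕ→ℚ (suc n) ^[ pred k ])

  Λ : (ℕ → Carrier) → ℕ → Carrier
  Λ F s = L s * F s

  rotaBaxter : ∀ F G → F 0 ≈ 0# → G 0 ≈ 0# →
    ∀ n → conv (Λ F) (Λ G) n ≈ Λ (λ s → conv F (Λ G) s + conv G (Λ F) s + conv F G s) n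
  rotaBaxter F G F0 G0 n = begin
    conv (Λ F) (Λ G) n
      ≈⟨ antidiag-cong n kernel ⟩
    antidiag (λ x y → L n * (F x * (L y * G y) + G y * (L x * F x) + F x * G y)) n
      ≈⟨ trans (antidiag-scale (L n) _ n) (*-congˡ (trans (antidiag-+ _ _ n) (+-congʳ (antidiag-+ _ _ n)))) ⟩
    L n * (conv F (Λ G) n + antidiag (λ x y → G y * (L x * F x)) n + conv F G n)
      ≈⟨ *-congˡ (+-congʳ (+-congˡ (trans (antidiag-cong n (λ x y _ → *-comm _ _)) (ℚ-Algebra.*-comm algebra (Λ F) G n)))) ⟩
    L n * (conv F (Λ G) n + conv G (Λ F) n + conv F G n) ∎
    where
    kernel : ∀ x y → x ℕ.+ y ≡ n → L x * F x * (L y * G y) ≈ L n * (F x * (L y * G y) + G y * (L x * F x) + F x * G y)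
    kernel zero y _ = begin
      L 0 * F 0 * (L y * G y)
        ≈⟨ *-congʳ (*-congˡ (trans F0 (sym ι-0))) ⟩
      L 0 * ι 0ℚ * (L y * G y)
        ≈⟨ solve 4 (λ l m k g → l :* con 0ℚ :* (m :* g) := k :* (con 0ℚ :* (m :* g) :+ g :* (l :* con 0ℚ) :+ con 0ℚ :* g)) refl _ _ _ _ ⟩
      L n * (ι 0ℚ * (L y * G y) + G y * (L 0 * ι 0ℚ) + ι 0ℚ * G y)
        ≈⟨ *-congˡ (+-cong (+-cong (*-congʳ z) (*-congˡ (*-congˡ z))) (*-congʳ z)) ⟩
      L n * (F 0 * (L y * G y) + G y * (L 0 * F 0) + F 0 * G y) ∎
      where z = trans ι-0 (sym F0)
    kernel (suc x) zero _ = begin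
      L (suc x) * F (suc x) * (L 0 * G 0)
        ≈⟨ *-congˡ (*-congˡ (trans G0 (sym ι-0))) ⟩
      L (suc x) * F (suc x) * (L 0 * ι 0ℚ)
        ≈⟨ solve 4 (λ l f m k → l :* f :* (m :* con 0ℚ) := k :* (f :* (m :* con 0ℚ) :+ con 0ℚ :* (l :* f) :+ f :* con 0ℚ)) refl _ _ _ _ ⟩
      L n * (F (suc x) * (L 0 * ι 0ℚ) + ι 0ℚ * (L (suc x) * F (suc x)) + F (suc x) * ι 0ℚ)
        ≈⟨ *-congˡ (+-cong (+-cong (*-congˡ (*-congˡ z)) (*-congʳ z)) (*-congˡ z)) ⟩
      L n * (F (suc x) * (L 0 * G 0) + G 0 * (L (suc x) * F (suc x)) + F (suc x) * G 0) ∎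
      where z = trans ι-0 (sym G0)
    kernel (suc x) (suc y) ≡.refl = begin
      L (suc x) * F (suc x) * (L (suc y) * G (suc y))
        ≈⟨ solve 4 (λ l f m g → l :* f :* (m :* g) := l :* m :* (f :* g)) refl _ _ _ _ ⟩
      L (suc x) * L (suc y) * (F (suc x) * G (suc y))
        ≈⟨ *-congʳ (trans (L-* x y) (*-congˡ (+-congʳ (+-congʳ (sym ι-1))))) ⟩
      L n * (ι 1ℚ + L (suc x) + L (suc y)) * (F (suc x) * G (suc y))
        ≈⟨ solve 5 (λ n l m f g → n :* (con 1ℚ :+ l :+ m) :* (f :* g) := n :* (f :* (m :* g) :+ g :* (l :* f) :+ f :* g)) refl _ _ _ _ _ ⟩
      L n * (F (suc x) * (L (suc y) * G (suc y)) + G (suc y) * (L (suc x) * F (suc x)) + F (suc x) * G (suc y)) ∎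

  φ₁² : ∀ n → conv (φ 1) (φ 1) n ≈ φ 2 n + - φ 1 n
  φ₁² zero    = trans (zeroˡ _) (sym (-‿inverseʳ _))
  φ₁² (suc n) = begin
    0# * φ 1 (suc n) + antidiag (λ x y → ι 1ℚ * φ 1 y) n  ≈⟨ trans (+-cong (zeroˡ _) (ones n)) (+-identityˡ _) ⟩
    ν n  ≈⟨ solve 1 (λ x → x := x :+ con 1ℚ :- con 1ℚ) refl _ ⟩
    ν n + ι 1ℚ - ι 1ℚ  ≈⟨ +-congʳ (trans (ι-cong e) (ν-suc n)) ⟨
    φ 2 (suc n) - φ 1 (suc n)  ∎
    where
    e : (ℤ.+ 1 ℚ./ 1) ℚ.* (ℕ→ℚ (suc n) ℚ.* 1ℚ) ≡ ℕ→ℚ (suc n)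
    e = ≡.trans (ℚₚ.*-identityˡ _) (ℚₚ.*-identityʳ (ℕ→ℚ (suc n)))
    ones : ∀ n → antidiag (λ x y → ι 1ℚ * φ 1 y) n ≈ ν n
    ones zero    = trans (zeroʳ _) (sym ι-0)
    ones (suc n) = trans (+-congˡ (ones n)) (trans (solve 1 (λ x → con 1ℚ :* con 1ℚ :+ x := x :+ con 1ℚ) refl _) (sym (ν-suc n)))

  D₀-0 : D₀ 0# ≈ 0#
  D₀-0 = trans (D₀-cong (sym ι-0)) (D₀-ι 0ℚ)

  D-antidiag : ∀ k n → D₀ (antidiag k n) ≈ antidiag (λ x y → D₀ (k x y)) n
  D-antidiag k zero    = refl
  D-antidiag k (suc n) = trans (D₀-+ _ _) (+-congˡ (D-antidiag (λ x → k (suc x)) n))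

  D-φ : ∀ k F n → D₀ (conv (φ k) F n) ≈ conv (φ k) (λ s → D₀ (F s)) n
  D-φ k F n = trans (D-antidiag _ n) (antidiag-cong n (λ x y _ →
    trans (D₀-* _ _) (trans (+-congʳ (trans (*-congʳ (Dφ x)) (zeroˡ _))) (+-identityˡ _))))
    where
    Dφ : ∀ x → D₀ (φ k x) ≈ 0#
    Dφ zero    = D₀-0
    Dφ (suc x) = D₀-ι _

  const-* : ∀ c F n → conv (const c) F n ≈ c * F n
  const-* = PowerSeries.conv-constˡ K

  rotaBaxterData : RotaBaxterData algebra
  rotaBaxterData = record
    { φ = φ
    ; Λ = Λ
    ; θ = θ′
    ; D = λ F s → D₀ (F s)
    ; Small = λ F → F 0 ≈ 0#
    ; Λ-linear = record
      { T-cong  = λ e s → *-congˡ (e s)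
      ; T-+     = λ F G s → distribˡ _ _ _
      ; T-scale = λ c F s → trans (*-congˡ (const-* _ F s))
          (trans (solve 3 (λ x y z → x :* (y :* z) := y :* (x :* z)) refl _ _ _) (sym (const-* _ _ s)))
      }
    ; θ-linear = record
      { T-cong  = λ e s → *-congˡ (e s)
      ; T-+     = λ F G s → distribˡ _ _ _
      ; T-scale = λ c F s → trans (*-congˡ (const-* _ F s))
          (trans (solve 3 (λ x y z → x :* (y :* z) := y :* (x :* z)) refl _ _ _) (sym (const-* _ _ s)))
      }
    ; D-cong = λ e s → D₀-cong (e s)
    ; φ-small = λ k → refl
    ; *-small = λ G F0 → trans (*-congʳ F0) (zeroˡ _)
    ; rotaBaxter = rotaBaxter
    ; θ-* = θ-derivation
    ; θ-Λ = λ F s → solve 3 (λ x y z → x :* (y :* z) := y :* (x :* z)) refl _ _ _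
    ; θ-1 = λ { zero → trans (*-congʳ ι-0) (zeroˡ _) ; (suc s) → zeroʳ _ }
    ; θ-φ = λ { (suc k) s → trans (θ-φ k s) (sym (const-* _ _ s)) }
    ; φ₁² = φ₁²
    ; D-φ = D-φ
    ; D-Λ = λ F s → trans (D₀-* _ _) (trans (+-congʳ (*-congʳ (D₀-L s)))
        (solve 4 (λ n l f d → n :* (l :+ l :* l) :* f :+ l :* d := l :* d :+ (l :* (n :* f) :+ l :* (l :* (n :* f)))) refl _ _ _ _))
    ; D-1 = λ { zero → trans (D₀-cong (sym ι-1)) (D₀-ι 1ℚ) ; (suc s) → D₀-0 }
    }
    where
    θ-φ : ∀ k s → ν s * φ (suc k) s ≈ ν (suc k) * φ (suc (suc k)) s
    θ-φ k zero    = trans (zeroʳ _) (sym (zeroʳ _))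
    θ-φ k (suc s) = trans (sym (ι-* _ _)) (trans (ι-cong (≡.sym (^[]-suc (ℕ→ℚ (suc s)) k))) (ι-* _ _))

-- The q-series q^s/(1 - q^s)

qSeries : ℚ-Algebra
qSeries = PowerSeries.algebra ℚ-algebra

module GeometricIdentities (K : ℚ-Algebra) where
  open ℚ-Algebra K
  open Solver using (solve; _:=_; _:+_; _:*_; _:-_; :-_; con)
  open import Relation.Binary.Reasoning.Setoid setoid

  difference-zero : ∀ f g → f - g ≈ 0# → f ≈ g
  difference-zero f g e = begin
    f  ≈⟨ solve 2 (λ f g → f := g :+ (f :- g)) refl f g ⟩
    g + (f - g)  ≈⟨ +-congˡ e ⟩
    g + 0#  ≈⟨ +-identityʳ g ⟩
    g  ∎

  -- Here A = x/(1 - x), and likewise for B and C, but only the equation A = x + xA is used. The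
  -- discrepancy of the two sides turns out to be fixed under multiplication by z, and `vanish` then
  -- shows that it is 0.
  product-identity : ∀ x y z A B C → z ≈ x * y → A ≈ x + x * A → B ≈ y + y * B → C ≈ z + z * C →
    A * B - C * (1# + A + B) ≈ z * (A * B - C * (1# + A + B))
  product-identity x y z A B C z≈ A≈ B≈ C≈ = begin
    A * B - C * (1# + A + B)
      ≈⟨ +-cong (*-cong A≈ B≈) (-‿cong (*-cong (trans C≈ (+-cong z≈ (*-congʳ z≈))) (+-congʳ (+-congʳ (sym ι-1))))) ⟩
    (x + x * A) * (y + y * B) - (x * y + x * y * C) * (ι 1ℚ + A + B)
      ≈⟨ solve 5 (λ x y A B C → (x :+ x :* A) :* (y :+ y :* B) :- (x :* y :+ x :* y :* C) :* (con 1ℚ :+ A :+ B)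
           := x :* y :* (A :* B :- C :* (con 1ℚ :+ A :+ B))) refl x y A B C ⟩
    x * y * (A * B - C * (ι 1ℚ + A + B))
      ≈⟨ *-cong (sym z≈) (+-congˡ (-‿cong (*-congˡ (+-congʳ (+-congʳ ι-1))))) ⟩
    z * (A * B - C * (1# + A + B)) ∎

  derivative-identity : ∀ m x A δ → A ≈ x + x * A → δ ≈ m * x + (m * x * A + x * δ) →
    δ - m * (A + A * A) ≈ x * (δ - m * (A + A * A))
  derivative-identity m x A δ A≈ δ≈ = begin
    δ - m * (A + A * A)
      ≈⟨ +-cong δ≈ (-‿cong (*-congˡ (+-cong A≈ (*-congʳ A≈)))) ⟩
    m * x + (m * x * A + x * δ) - m * ((x + x * A) + (x + x * A) * A)
      ≈⟨ solve 4 (λ m x A δ → m :* x :+ (m :* x :* A :+ x :* δ) :- m :* ((x :+ x :* A) :+ (x :+ x :* A) :* A)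
           := x :* (δ :- m :* (A :+ A :* A))) refl m x A δ ⟩
    x * (δ - m * (A + A * A)) ∎

module Geometric where
  open GeometricIdentities qSeries
  open ℚ-Algebra qSeries
  open PowerSeries ℚ-algebra using (conv; const; θ-derivation; conv-constˡ)

  q^ : ℕ → ℕ → ℚ
  q^ zero            = const 1ℚ
  q^ (suc c) zero    = 0ℚ
  q^ (suc c) (suc n) = q^ c n

  shift : ℕ → (ℕ → ℚ) → ℕ → ℚ
  shift zero    f n       = f n
  shift (suc c) f zero    = 0ℚ
  shift (suc c) f (suc n) = shift c f n

  q^-* : ∀ c f n → conv (q^ c) f n ≡ shift c f n
  q^-* zero    f n       = *-identityˡ f n
  q^-* (suc c) f zero    = ℚₚ.*-zeroˡ (f 0)
  q^-* (suc c) f (suc n) = ≡.trans (≡.cong (ℚ._+ conv (q^ c) f n) (ℚₚ.*-zeroˡ (f (suc n))))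
    (≡.trans (ℚₚ.+-identityˡ _) (q^-* c f n))

  q^-+ : ∀ a b → q^ (a ℕ.+ b) ≈ q^ a * q^ b
  q^-+ a b n = ≡.trans (sh a n) (≡.sym (q^-* a (q^ b) n))
    where
    sh : ∀ a n → q^ (a ℕ.+ b) n ≡ shift a (q^ b) n
    sh zero    n       = ≡.refl
    sh (suc a) zero    = ≡.refl
    sh (suc a) (suc n) = sh a n

  shift-+ : ∀ c f m → shift c f (c ℕ.+ m) ≡ f m
  shift-+ zero    f m = ≡.refl
  shift-+ (suc c) f m = shift-+ c f m

  shift-< : ∀ c f {n} → n < c → shift c f n ≡ 0ℚ
  shift-< (suc c) f {zero}  _       = ≡.refl
  shift-< (suc c) f {suc n} (s≤s p) = shift-< c f p

  shift-zero : ∀ c f n → (∀ m → m ≤ n → f m ≡ 0ℚ) → shift c f n ≡ 0ℚ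
  shift-zero zero    f n       p = p n ≤-refl
  shift-zero (suc c) f zero    p = ≡.refl
  shift-zero (suc c) f (suc n) p = shift-zero c f n (λ m m≤n → p m (m≤n⇒m≤1+n m≤n))

  -- A series fixed by multiplication with a positive power of q has all coefficients 0, one after
  -- the other. This replaces division by 1 - q^s.
  vanish : ∀ c f → f ≈ q^ (suc c) * f → f ≈ 0#
  vanish c f e n = below n n ≤-refl
    where
    below : ∀ n m → m ≤ n → f m ≡ 0ℚ
    below n       zero    _       = ≡.trans (e 0) (q^-* (suc c) f 0)
    below (suc n) (suc m) (s≤s p) = ≡.trans (e (suc m)) (≡.trans (q^-* (suc c) f (suc m))
      (shift-zero c f m (λ i i≤m → below n i (≤-trans i≤m p))))

  vanish-− : ∀ c f g → f - g ≈ q^ (suc c) * (f - g) → f ≈ g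
  vanish-− c f g e = difference-zero f g (vanish c (f - g) e)

  geometric-∤ : ∀ s {n} → ¬ s ∣ suc n → geometric s (suc n) ≡ 0ℚ
  geometric-∤ s {n} s∤n = ≡.cong (if_then 1ℚ else 0ℚ) (dec-false (s ∣? suc n) s∤n)

  geometric-< : ∀ s {n} → n < s → geometric s n ≡ 0ℚ
  geometric-< s {zero}  _   = ≡.refl
  geometric-< s {suc n} n<s = geometric-∤ s (λ s∣n → ℕₚ.<⇒≱ n<s (∣⇒≤ s∣n))

  geometric-period : ∀ a m → geometric (suc a) (suc a ℕ.+ suc m) ≡ geometric (suc a) (suc m)
  geometric-period a m = ≡.cong (if_then 1ℚ else 0ℚ)
    (does-⇔ (mk⇔ (λ p → ∣m+n∣m⇒∣n p ∣-refl) (∣m∣n⇒∣m+n ∣-refl)) (suc a ∣? (suc a ℕ.+ suc m)) (suc a ∣? suc m))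

  geometric-one : ∀ a → geometric (suc a) (suc a ℕ.+ 0) ≡ 1ℚ
  geometric-one a = ≡.cong (if_then 1ℚ else 0ℚ)
    (dec-true (suc a ∣? (suc a ℕ.+ 0)) (≡.subst (suc a ∣_) (≡.sym (ℕₚ.+-identityʳ (suc a))) ∣-refl))

  geometric-≈ : ∀ a → geometric (suc a) ≈ q^ (suc a) + q^ (suc a) * geometric (suc a)
  geometric-≈ a n = ≡.trans (eq n (ℕₚ.<-≤-connex n (suc a))) (≡.cong (q^ (suc a) n ℚ.+_) (≡.sym (q^-* (suc a) _ n)))
    where
    L = geometric (suc a)
    q^-+ʳ : ∀ c m → q^ c (c ℕ.+ m) ≡ const 1ℚ m
    q^-+ʳ zero    m = ≡.refl
    q^-+ʳ (suc c) m = q^-+ʳ c m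
    q^-< : ∀ c {n} → n < c → q^ c n ≡ 0ℚ
    q^-< (suc c) {zero}  _       = ≡.refl
    q^-< (suc c) {suc n} (s≤s p) = q^-< c p
    shifted : ∀ m → L (suc a ℕ.+ m) ≡ q^ (suc a) (suc a ℕ.+ m) ℚ.+ shift (suc a) L (suc a ℕ.+ m)
    shifted m rewrite q^-+ʳ a m | shift-+ a L m = go m
      where
      go : ∀ m → L (suc a ℕ.+ m) ≡ const 1ℚ m ℚ.+ L m
      go zero    = geometric-one a
      go (suc m) = ≡.trans (geometric-period a m) (≡.sym (ℚₚ.+-identityˡ _))
    eq : ∀ n → n < suc a ⊎ suc a ≤ n → L n ≡ q^ (suc a) n ℚ.+ shift (suc a) L n
    eq n (inj₁ n<) = ≡.trans (geometric-< (suc a) n<) (≡.sym (≡.cong₂ ℚ._+_ (q^-< (suc a) n<) (shift-< (suc a) L n<)))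
    eq n (inj₂ ≤n) = ≡.subst (λ n → L n ≡ q^ (suc a) n ℚ.+ shift (suc a) L n) (ℕₚ.m+[n∸m]≡n ≤n) (shifted (n ℕ.∸ suc a))

  geometric-* : ∀ a b → geometric (suc a) * geometric (suc b) ≈
                geometric (suc a ℕ.+ suc b) * (1# + geometric (suc a) + geometric (suc b))
  geometric-* a b = vanish-− (a ℕ.+ suc b) _ _
    (product-identity (q^ (suc a)) (q^ (suc b)) _ _ _ _ (q^-+ (suc a) (suc b)) (geometric-≈ a) (geometric-≈ b) (geometric-≈ (a ℕ.+ suc b)))

  d-+ : ∀ f g → d (f + g) ≈ d f + d g
  d-+ f g n = ℚₚ.*-distribˡ-+ (ℕ→ℚ n) (f n) (g n)

  d-ι : ∀ c → d (ι c) ≈ 0#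
  d-ι c zero    = ℚₚ.*-zeroˡ c
  d-ι c (suc n) = ℚₚ.*-zeroʳ (ℕ→ℚ (suc n))

  d-q^ : ∀ s → d (q^ s) ≈ ν s * q^ s
  d-q^ s n = ≡.trans (coeff s n) (≡.sym (conv-constˡ (ℕ→ℚ s) (q^ s) n))
    where
    coeff : ∀ s n → ℕ→ℚ n ℚ.* q^ s n ≡ ℕ→ℚ s ℚ.* q^ s n
    coeff zero    zero    = ≡.refl
    coeff zero    (suc n) = ≡.trans (ℚₚ.*-zeroʳ (ℕ→ℚ (suc n))) (≡.sym (ℚₚ.*-zeroʳ (ℕ→ℚ 0)))
    coeff (suc s) zero    = ≡.trans (ℚₚ.*-zeroʳ (ℕ→ℚ 0)) (≡.sym (ℚₚ.*-zeroʳ (ℕ→ℚ (suc s))))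
    coeff (suc s) (suc n) =
      ≡.trans (≡.cong (ℚ._* q^ s n) (ℕ→ℚ-suc n)) (≡.trans (ℚₚ.*-distribʳ-+ (q^ s n) (ℕ→ℚ n) 1ℚ)
      (≡.trans (≡.cong (ℚ._+ 1ℚ ℚ.* q^ s n) (coeff s n)) (≡.trans (≡.sym (ℚₚ.*-distribʳ-+ (q^ s n) (ℕ→ℚ s) 1ℚ))
      (≡.cong (ℚ._* q^ s n) (≡.sym (ℕ→ℚ-suc s))))))

  geometric-0 : ∀ n → geometric 0 n ≡ 0ℚ
  geometric-0 zero    = ≡.refl
  geometric-0 (suc n) = ≡.refl

  d-geometric : ∀ s → d (geometric s) ≈ ν s * (geometric s + geometric s * geometric s)
  d-geometric zero n = ≡.trans (≡.trans (≡.cong (ℕ→ℚ n ℚ.*_) (geometric-0 n)) (ℚₚ.*-zeroʳ (ℕ→ℚ n)))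
    (≡.sym (≡.trans (conv-constˡ (ℕ→ℚ 0) _ n) (ℚₚ.*-zeroˡ ((geometric 0 + geometric 0 * geometric 0) n))))
  d-geometric (suc a) = vanish-− a _ _ (derivative-identity m x A (d A) (geometric-≈ a) (λ n →
    ≡.trans (≡.cong (ℕ→ℚ n ℚ.*_) (geometric-≈ a n))
      (≡.trans (d-+ x (x * A) n) (≡.cong₂ ℚ._+_ (d-q^ (suc a) n)
        (≡.trans (θ-derivation x A n) (≡.cong (ℚ._+ (x * d A) n) (*-congʳ {A} {d x} {m * x} (d-q^ (suc a)) n)))))))
    where
    A = geometric (suc a)
    x = q^ (suc a)
    m = ν (suc a)

-- Finite sums

module Sums (K : ℚ-Algebra) where
  open ℚ-Algebra K
  open PowerSeries K using (antidiag; antidiag-+; antidiag-last)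
  open Solver using (solve; _:=_; _:+_)
  open import Relation.Binary.Reasoning.Setoid setoid

  sumTo : (ℕ → Carrier) → ℕ → Carrier
  sumTo f zero    = f 0
  sumTo f (suc n) = sumTo f n + f (suc n)

  sumTo-cong : ∀ {f g} n → (∀ s → s ≤ n → f s ≈ g s) → sumTo f n ≈ sumTo g n
  sumTo-cong zero    p = p 0 z≤n
  sumTo-cong (suc n) p = +-cong (sumTo-cong n (λ s s≤n → p s (m≤n⇒m≤1+n s≤n))) (p (suc n) ≤-refl)

  sumTo-+ : ∀ f g n → sumTo (λ s → f s + g s) n ≈ sumTo f n + sumTo g n
  sumTo-+ f g zero    = refl
  sumTo-+ f g (suc n) = trans (+-congʳ (sumTo-+ f g n)) (solve 4 (λ a b c d → a :+ b :+ (c :+ d) := a :+ c :+ (b :+ d)) refl _ _ _ _)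

  sumTo-scale : ∀ c f n → sumTo (λ s → c * f s) n ≈ c * sumTo f n
  sumTo-scale c f zero    = refl
  sumTo-scale c f (suc n) = trans (+-congʳ (sumTo-scale c f n)) (sym (distribˡ _ _ _))

  sumTo-extend : ∀ f {m n} → m ≤ n → (∀ s → m < s → f s ≈ 0#) → sumTo f n ≈ sumTo f m
  sumTo-extend f {m} {zero}  z≤n z = refl
  sumTo-extend f {m} {suc n} m≤  z with ℕₚ.m≤n⇒m<n∨m≡n m≤
  ... | inj₁ (s≤s m≤n) = trans (+-cong (sumTo-extend f m≤n z) (z (suc n) (s≤s m≤n))) (+-identityʳ _)
  ... | inj₂ ≡.refl    = refl

  sumTo-antidiag : ∀ k n → sumTo (antidiag k) n ≈ antidiag (λ x m → sumTo (k x) m) n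
  sumTo-antidiag k zero    = refl
  sumTo-antidiag k (suc n) = begin
    sumTo (antidiag k) n + antidiag k (suc n)
      ≈⟨ +-cong (sumTo-antidiag k n) (antidiag-last k n) ⟩
    antidiag (λ x m → sumTo (k x) m) n + (antidiag (λ x m → k x (suc m)) n + k (suc n) 0)
      ≈⟨ +-assoc _ _ _ ⟨
    antidiag (λ x m → sumTo (k x) m) n + antidiag (λ x m → k x (suc m)) n + k (suc n) 0
      ≈⟨ +-congʳ (antidiag-+ _ _ n) ⟨
    antidiag (λ x m → sumTo (k x) (suc m)) n + k (suc n) 0
      ≈⟨ antidiag-last (λ x m → sumTo (k x) m) n ⟨
    antidiag (λ x m → sumTo (k x) m) (suc n) ∎

  antidiag-const : ∀ f n → antidiag (λ x _ → f x) n ≈ sumTo f n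
  antidiag-const f zero    = refl
  antidiag-const f (suc n) = trans (antidiag-last (λ x _ → f x) n) (+-congʳ (antidiag-const f n))

  sumTo-antidiag-swap : ∀ (k : ℕ → ℕ → ℕ → Carrier) n N → antidiag (λ i j → sumTo (λ x → k x i j) N) n ≈ sumTo (λ x → antidiag (k x) n) N
  sumTo-antidiag-swap k n zero    = refl
  sumTo-antidiag-swap k n (suc N) = trans (antidiag-+ _ _ n) (+-congʳ (sumTo-antidiag-swap k n N))

-- Setting t = 1

module TotalSum (K : ℚ-Algebra) where
  open ℚ-Algebra K
  open PowerSeries K using (antidiag; antidiag-cong; antidiag-zero; conv; algebra)
  open Sums K
  private module R = PowerSeries algebra
  open import Relation.Binary.Reasoning.Setoid setoid

  -- The coefficient of t^s is divisible by q^s, which makes the value at t = 1 a finite sum in each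
  -- degree.
  Supported : (ℕ → ℕ → Carrier) → Set
  Supported F = ∀ s {n} → n < s → F s n ≈ 0#

  total : (ℕ → ℕ → Carrier) → ℕ → Carrier
  total F n = sumTo (λ s → F s n) n

  antidiag-eval : ∀ k s n → R.antidiag k s n ≈ antidiag (λ x y → k x y n) s
  antidiag-eval k zero    n = refl
  antidiag-eval k (suc s) n = +-congˡ (antidiag-eval (λ x → k (suc x)) s n)

  -- `total` cuts the sum over s off at the degree n in q. For products the cut-off is harmless: if
  -- x + y > n = i + j, then x > i or y > j, and one of the factors vanishes.
  total-* : ∀ {F G} → Supported F → Supported G → ∀ n → total (R.conv F G) n ≈ conv (total F) (total G) n
  total-* {F} {G} supF supG n = begin
    sumTo (λ s → R.conv F G s n) n
      ≈⟨ sumTo-cong n (λ s _ → antidiag-eval _ s n) ⟩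
    sumTo (antidiag k) n
      ≈⟨ sumTo-antidiag k n ⟩
    antidiag (λ x m → sumTo (k x) m) n
      ≈⟨ antidiag-cong n (λ x m e → sym (sumTo-extend (k x) (≡.subst (m ≤_) e (m≤n+m m x))
          (λ y m<y → k-zero x y (≡.subst (_< x ℕ.+ y) e (ℕₚ.+-monoʳ-< x m<y))))) ⟩
    antidiag (λ x _ → sumTo (k x) n) n
      ≈⟨ antidiag-const _ n ⟩
    sumTo (λ x → sumTo (k x) n) n
      ≈⟨ sumTo-cong n (λ x _ → sumTo-antidiag-swap (λ y i j → F x i * G y j) n n) ⟨
    sumTo (λ x → antidiag (λ i j → sumTo (λ y → F x i * G y j) n) n) n
      ≈⟨ sumTo-antidiag-swap (λ x i j → sumTo (λ y → F x i * G y j) n) n n ⟨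
    antidiag (λ i j → sumTo (λ x → sumTo (λ y → F x i * G y j) n) n) n
      ≈⟨ antidiag-cong n (λ i j e → trans
           (sumTo-cong n (λ x _ → trans (sumTo-scale (F x i) _ n) (*-comm _ _)))
           (trans (sumTo-scale _ _ n) (trans (*-comm _ _)
           (*-cong (sumTo-extend _ (≡.subst (i ≤_) e (m≤m+n i j)) (λ s i<s → supF s i<s))
                   (sumTo-extend _ (≡.subst (j ≤_) e (m≤n+m j i)) (λ s j<s → supG s j<s)))))) ⟩
    conv (total F) (total G) n ∎
    where
    k : ℕ → ℕ → Carrier
    k x y = conv (F x) (G y) n
    k-zero : ∀ x y → n < x ℕ.+ y → k x y ≈ 0#
    k-zero x y n< = trans (antidiag-cong n (λ i j e → zero′ i j e)) (antidiag-zero n)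
      where
      zero′ : ∀ i j → i ℕ.+ j ≡ n → F x i * G y j ≈ 0#
      zero′ i j ≡.refl with ℕₚ.<-≤-connex i x
      ... | inj₁ i<x = trans (*-congʳ (supF x i<x)) (zeroˡ _)
      ... | inj₂ x≤i = trans (*-congˡ (supG y (ℕₚ.≰⇒> (λ y≤j → ℕₚ.<⇒≱ n< (ℕₚ.+-mono-≤ x≤i y≤j))))) (zeroʳ _)

-- Coefficients of the path-ordered product

module PathOrdered (K : ℚ-Algebra) (atoms : Atoms K) where
  open ℚ-Algebra K
  open Atoms atoms
  open NestedSums K atoms
  open Stuffle (PowerSeries.algebra K) rotaBaxterData using (G; G′; Λ^)
  open PowerSeries K
  open Sums K
  open ShuffleCharacter K
  open Solver using (solve; _:=_; _:*_)
  open import Relation.Binary.Reasoning.Setoid setoid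

  antidiag-flip : ∀ k n → antidiag k n ≈ antidiag (λ x y → k y x) n
  antidiag-flip k zero    = refl
  antidiag-flip k (suc n) = trans (+-congˡ (antidiag-flip (λ x → k (suc x)) n)) (trans (+-comm _ _) (sym (antidiag-last (λ x y → k y x) n)))

  antidiag-sumTo : ∀ (k : ℕ → ℕ → Carrier) n → antidiag k n ≈ sumTo (λ v → k (n ℕ.∸ v) v) n
  antidiag-sumTo k n = begin
    antidiag k n  ≈⟨ antidiag-flip k n ⟩
    antidiag (λ v x → k x v) n
      ≈⟨ antidiag-cong n (λ v x e → reflexive (≡.cong (λ m → k m v) (≡.sym (≡.trans (≡.cong (ℕ._∸ v) (≡.sym e)) (ℕₚ.m+n∸m≡n v x))))) ⟩
    antidiag (λ v _ → k (n ℕ.∸ v) v) n  ≈⟨ antidiag-const _ n ⟩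
    sumTo (λ v → k (n ℕ.∸ v) v) n  ∎

  ι-antidiag : ∀ k n → ι (Qˢ.antidiag k n) ≈ antidiag (λ x y → ι (k x y)) n
  ι-antidiag k zero    = refl
  ι-antidiag k (suc n) = trans (ι-+ _ _) (+-congˡ (ι-antidiag (λ x → k (suc x)) n))

  atom : Carrier → Letter → Carrier
  atom x e₀ = 0#
  atom x e₁ = x

  step : Letter → Carrier
  step e₀ = 1#
  step e₁ = 0#

  -- Φ n is the path-ordered product exp(L_n e₁) exp(e₀) ⋯ exp(L₁ e₁) exp(e₀), as a functional on words;
  -- Φ⁻ n stops just before the factor exp(L_{n+1} e₁).
  Φ Φ⁻ : ℕ → Word → Carrier
  Φ zero    = expo (λ _ → 0#)
  Φ (suc n) = expo (atom (L (suc n))) ⋆ Φ⁻ n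
  Φ⁻ n = expo step ⋆ Φ n

  Φ-character : ∀ n → IsCharacter (Φ n)
  Φ-character zero    = expo-character _
  Φ-character (suc n) = ⋆-character (expo-character _) (⋆-character (expo-character _) (Φ-character n))

  splitSum-zero : ∀ {k} → (∀ u v → k u v ≈ 0#) → ∀ w → splitSum k w ≈ 0#
  splitSum-zero p []      = p [] []
  splitSum-zero p (a ∷ w) = trans (+-cong (p [] (a ∷ w)) (splitSum-zero (λ u → p (a ∷ u)) w)) (+-identityˡ 0#)

  e₀^_·_ : ℕ → List ℕ → Word
  e₀^ t · ks = replicate t e₀ ++ encode ks

  expo-step : ∀ t → expo step (replicate t e₀) ≈ ι (1ℚ ^[ t ])
  expo-step zero    = sym ι-1
  expo-step (suc t) = begin
    ι (ℤ.+ 1 ℚ./ suc (length (replicate t e₀))) * (1# * expo step (replicate t e₀))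
      ≈⟨ *-cong (ι-cong (≡.cong (λ m → ℤ.+ 1 ℚ./ suc m) (Listₚ.length-replicate t))) (*-cong (sym ι-1) (expo-step t)) ⟩
    ι (ℤ.+ 1 ℚ./ suc t) * (ι 1ℚ * ι (1ℚ ^[ t ]))
      ≈⟨ trans (ι-* _ _) (*-congˡ (ι-* _ _)) ⟨
    ι (1ℚ ^[ suc t ]) ∎

  expo-zero : ∀ y b w → y b ≈ 0# → expo y (b ∷ w) ≈ 0#
  expo-zero y b w p = trans (*-congˡ (trans (*-congʳ p) (zeroˡ _))) (zeroʳ _)

  expo-step-e₁ : ∀ t u → expo step (replicate t e₀ ++ e₁ ∷ u) ≈ 0#
  expo-step-e₁ zero    u = expo-zero step e₁ u refl
  expo-step-e₁ (suc t) u = trans (*-congˡ (trans (*-congˡ (expo-step-e₁ t u)) (zeroʳ _))) (zeroʳ _)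

  -- As `h` vanishes on words that reach the first e₁, only the cuts inside the leading run of
  -- letters e₀ contribute.
  split-e₀ : ∀ (h f : Word → Carrier) (c : ℕ → Carrier) → (∀ j → h (replicate j e₀) ≈ c j) → (∀ j u → h (replicate j e₀ ++ e₁ ∷ u) ≈ 0#) →
             ∀ t ks → (h ⋆ f) (e₀^ t · ks) ≈ antidiag (λ j m → c j * f (e₀^ m · ks)) t
  split-e₀ h f c p z zero    []       = *-congʳ (p 0)
  split-e₀ h f c p z zero    (k ∷ ks) = trans (+-cong (*-congʳ (p 0)) (splitSum-zero (λ u v → trans (*-congʳ (z 0 u)) (zeroˡ _))
      (e₀^ pred k · ks)))
    (+-identityʳ _)
  split-e₀ h f c p z (suc t) ks = +-cong (*-congʳ (p 0)) (split-e₀ (λ u → h (e₀ ∷ u)) f (λ j → c (suc j)) (λ j → p (suc j))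
      (λ j → z (suc j)) t ks)

  -- Sum over the time v at which the first letter e₁ fires; the t letters e₀ before it fill the time from v to N.
  lag : ℕ → ℕ → ℕ → List ℕ → Carrier
  lag N n t ks = sumTo (λ v → ι (ℕ→ℚ (N ℕ.∸ v) ^[ t ]) * G ks v) n

  -- The factor exp(e₀) advances the time by 1: by the binomial theorem, (n - v)^t/t! becomes (n + 1
  -- - v)^t/t!.
  Φ⁻-encode : ∀ n → (∀ t ks → Φ n (e₀^ t · ks) ≈ lag n n t ks) → ∀ t ks → Φ⁻ n (e₀^ t · ks) ≈ lag (suc n) n t ks
  Φ⁻-encode n IH t ks = begin
    (expo step ⋆ Φ n) (e₀^ t · ks)
      ≈⟨ split-e₀ (expo step) (Φ n) (λ j → ι (1ℚ ^[ j ])) expo-step expo-step-e₁ t ks ⟩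
    antidiag (λ j m → ι (1ℚ ^[ j ]) * Φ n (e₀^ m · ks)) t
      ≈⟨ antidiag-cong t (λ j m _ → trans (*-congˡ (IH m ks)) (sym (sumTo-scale _ _ n))) ⟩
    antidiag (λ j m → sumTo (λ v → ι (1ℚ ^[ j ]) * (ι (ℕ→ℚ (n ℕ.∸ v) ^[ m ]) * G ks v)) n) t
      ≈⟨ sumTo-antidiag-swap _ t n ⟩
    sumTo (λ v → antidiag (λ j m → ι (1ℚ ^[ j ]) * (ι (ℕ→ℚ (n ℕ.∸ v) ^[ m ]) * G ks v)) t) n
      ≈⟨ sumTo-cong n (λ v v≤n → begin
         antidiag (λ j m → ι (1ℚ ^[ j ]) * (ι (ℕ→ℚ (n ℕ.∸ v) ^[ m ]) * G ks v)) t
           ≈⟨ antidiag-cong t (λ j m _ → trans (sym (*-assoc _ _ _)) (trans (*-comm _ _) (*-congˡ (sym (ι-* _ _))))) ⟩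
         antidiag (λ j m → G ks v * ι (1ℚ ^[ j ] ℚ.* ℕ→ℚ (n ℕ.∸ v) ^[ m ])) t
           ≈⟨ trans (antidiag-scale (G ks v) _ t) (*-congˡ (sym (ι-antidiag _ t))) ⟩
         G ks v * ι (Qˢ.antidiag (λ j m → 1ℚ ^[ j ] ℚ.* ℕ→ℚ (n ℕ.∸ v) ^[ m ]) t)
           ≈⟨ trans (*-congˡ (ι-cong (≡.trans (^[]-+ 1ℚ (ℕ→ℚ (n ℕ.∸ v)) t)
               (≡.cong (_^[ t ]) (≡.trans (≡.sym (ℕ→ℚ-+ 1 (n ℕ.∸ v))) (≡.cong ℕ→ℚ (≡.sym (ℕₚ.+-∸-assoc 1 v≤n)))))))) (*-comm _ _) ⟩
         ι (ℕ→ℚ (suc n ℕ.∸ v) ^[ t ]) * G ks v ∎) ⟩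
    lag (suc n) n t ks ∎

  φ-lag : ∀ n k ks → conv (φ k) (G ks) (suc n) ≈ lag (suc n) n (pred k) ks
  φ-lag n k ks = begin
    0# * G ks (suc n) + antidiag (λ x y → ι (ℕ→ℚ (suc x) ^[ pred k ]) * G ks y) n
      ≈⟨ trans (+-congʳ (zeroˡ _)) (+-identityˡ _) ⟩
    antidiag (λ x y → ι (ℕ→ℚ (suc x) ^[ pred k ]) * G ks y) n
      ≈⟨ antidiag-sumTo _ n ⟩
    sumTo (λ v → ι (ℕ→ℚ (suc (n ℕ.∸ v)) ^[ pred k ]) * G ks v) n
      ≈⟨ sumTo-cong n (λ v v≤n → *-congʳ (ι-cong (≡.cong (λ m → ℕ→ℚ m ^[ pred k ]) (≡.sym (ℕₚ.+-∸-assoc 1 v≤n))))) ⟩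
    lag (suc n) n (pred k) ks ∎

  expo-atom : ∀ i (F : ℕ → Carrier) s → expo (atom (L s)) (replicate i e₁ ++ []) * F s ≈ ι (1/ i !) * Λ^ i F s
  expo-atom zero    F s = *-congʳ (sym ι-1)
  expo-atom (suc i) F s = begin
    ι (ℤ.+ 1 ℚ./ suc (length (replicate i e₁ ++ []))) * (L s * ε) * F s
      ≈⟨ *-congʳ (*-congʳ (ι-cong (≡.cong (λ m → ℤ.+ 1 ℚ./ suc m) len))) ⟩
    ι (ℤ.+ 1 ℚ./ suc i) * (L s * ε) * F s
      ≈⟨ solve 4 (λ c l e f → c :* (l :* e) :* f := c :* (l :* (e :* f))) refl _ _ _ _ ⟩
    ι (ℤ.+ 1 ℚ./ suc i) * (L s * (ε * F s))
      ≈⟨ *-congˡ (*-congˡ (expo-atom i F s)) ⟩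
    ι (ℤ.+ 1 ℚ./ suc i) * (L s * (ι (1/ i !) * Λ^ i F s))
      ≈⟨ solve 4 (λ c l e f → c :* (l :* (e :* f)) := c :* e :* (l :* f)) refl _ _ _ _ ⟩
    ι (ℤ.+ 1 ℚ./ suc i) * ι (1/ i !) * (L s * Λ^ i F s)
      ≈⟨ *-congʳ (trans (ι-cong (1/!-suc i)) (ι-* _ _)) ⟨
    ι (1/ (suc i) !) * Λ^ (suc i) F s ∎
    where
    ε = expo (atom (L s)) (replicate i e₁ ++ [])
    len : length (replicate i e₁ ++ []) ≡ i
    len = ≡.trans (≡.cong length (Listₚ.++-identityʳ (replicate i e₁))) (Listₚ.length-replicate i)

  expo-atom-e₀ : ∀ x i u → expo (atom x) (replicate i e₁ ++ e₀ ∷ u) ≈ 0#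
  expo-atom-e₀ x zero    u = expo-zero (atom x) e₀ u refl
  expo-atom-e₀ x (suc i) u = trans (*-congˡ (trans (*-congˡ (expo-atom-e₀ x i u)) (zeroʳ _))) (zeroʳ _)

  replicate-++-∷ : ∀ i (u : Word) → replicate i e₁ ++ e₁ ∷ u ≡ e₁ ∷ replicate i e₁ ++ u
  replicate-++-∷ zero    u = ≡.refl
  replicate-++-∷ (suc i) u = ≡.cong (e₁ ∷_) (replicate-++-∷ i u)

  ι-0^[suc] : ∀ t → ι (0ℚ ^[ suc t ]) ≈ 0#
  ι-0^[suc] t = trans (ι-cong (0^[suc] t)) ι-0

  module _ (n : ℕ) (Φ⁻-lag : ∀ t ks → Φ⁻ n (e₀^ t · ks) ≈ lag (suc n) n t ks) where
    -- i letters e₁ have already fired at time n + 1.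
    burst : ℕ → Word → Carrier
    burst i u = expo (atom (L (suc n))) (replicate i e₁ ++ u)

    burst-[] : ∀ i k ks → burst i [] * Φ⁻ n (e₀^ pred k · ks) ≈ conv (const (ι (1/ i !))) (Λ^ i (conv (φ k) (G ks))) (suc n)
    burst-[] i k ks = trans (*-congˡ (trans (Φ⁻-lag (pred k) ks) (sym (φ-lag n k ks))))
      (trans (expo-atom i (conv (φ k) (G ks)) (suc n)) (sym (conv-constˡ _ _ (suc n))))

    burst-e₀ : ∀ i w → splitSum (λ u v → burst i (e₀ ∷ u) * Φ⁻ n v) w ≈ 0#
    burst-e₀ i = splitSum-zero (λ u v → trans (*-congʳ (expo-atom-e₀ _ i u)) (zeroˡ _))

    -- This is where the recursion of `G′` comes from. After i letters e₁ at time n + 1, either the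
    -- rest of the word belongs to earlier times, or one more e₁ fires at once, which is possible
    -- only if no e₀ intervenes. The numbers k = 0 and k = 1 have the same encoding and are treated
    -- alike.
    burst-⋆ : ∀ i k ks → (burst i ⋆ Φ⁻ n) (e₀^ pred k · ks) ≈ G′ i k ks (suc n)
    burst-⋆′ : ∀ i t l ks → splitSum (λ u v → burst i (e₁ ∷ u) * Φ⁻ n v) (e₀^ pred l · ks) ≈ conv (const (ι 1ℚ)) (G′ (suc i) l ks) (suc n)
    burst-⋆ i zero          []       = burst-[] i 0 []
    burst-⋆ i (suc zero)    []       = burst-[] i 1 []
    burst-⋆ i (suc (suc t)) []       = trans (+-cong (burst-[] i (suc (suc t)) []) (burst-e₀ i (e₀^ t · []))) (+-identityʳ _)
    burst-⋆ i zero          (l ∷ ks) = +-cong (burst-[] i 0 (l ∷ ks)) (burst-⋆′ i 0 l ks)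
    burst-⋆ i (suc zero)    (l ∷ ks) = +-cong (burst-[] i 1 (l ∷ ks)) (burst-⋆′ i 0 l ks)
    burst-⋆ i (suc (suc t)) (l ∷ ks) = +-cong (burst-[] i (suc (suc t)) (l ∷ ks))
      (trans (burst-e₀ i (e₀^ t · (l ∷ ks))) (sym (trans (conv-constˡ _ (G′ (suc i) l ks) (suc n))
          (trans (*-congʳ (ι-0^[suc] t)) (zeroˡ _)))))
    burst-⋆′ i t l ks = begin
      splitSum (λ u v → burst i (e₁ ∷ u) * Φ⁻ n v) (e₀^ pred l · ks)
        ≈⟨ splitSum-cong (λ u v → *-congʳ (reflexive (≡.cong (expo (atom (L (suc n)))) (replicate-++-∷ i u)))) (e₀^ pred l · ks) ⟩
      (burst (suc i) ⋆ Φ⁻ n) (e₀^ pred l · ks)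
        ≈⟨ burst-⋆ (suc i) l ks ⟩
      G′ (suc i) l ks (suc n)
        ≈⟨ trans (conv-constˡ _ (G′ (suc i) l ks) (suc n)) (trans (*-congʳ ι-1) (*-identityˡ _)) ⟨
      conv (const (ι 1ℚ)) (G′ (suc i) l ks) (suc n) ∎

  Λ^-φ-0 : ∀ i k ks → Λ^ (suc i) (conv (φ k) (G ks)) 0 ≈ 0#
  Λ^-φ-0 zero    k ks = trans (*-congˡ (zeroˡ _)) (zeroʳ _)
  Λ^-φ-0 (suc i) k ks = trans (*-congˡ (Λ^-φ-0 i k ks)) (zeroʳ _)

  G′-0 : ∀ i k ks → G′ (suc i) k ks 0 ≈ 0#
  G′-0 i k []       = trans (*-congˡ (Λ^-φ-0 i k [])) (zeroʳ _)
  G′-0 i k (l ∷ ks) = trans (+-cong (trans (*-congˡ (Λ^-φ-0 i k (l ∷ ks))) (zeroʳ _)) (trans (*-congˡ (G′-0 (suc i) l ks)) (zeroʳ _)))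
      (+-identityˡ _)

  -- Either nothing fires at time n + 1, and `Φ⁻` accounts for the terms v ≤ n; or the first e₁
  -- fires then, and the term v = n + 1 arises. The latter requires t = 0, in agreement with the
  -- coefficient 0^t/t!.
  Φ-lag : ∀ n t ks → Φ n (e₀^ t · ks) ≈ lag n n t ks
  Φ⁻-lag : ∀ n t ks → Φ⁻ n (e₀^ t · ks) ≈ lag (suc n) n t ks
  Φ⁻-lag n = Φ⁻-encode n (Φ-lag n)
  Φ-lag zero zero    []       = sym (trans (*-congʳ ι-1) (*-identityˡ _))
  Φ-lag zero zero    (k ∷ ks) = trans (expo-zero _ e₁ (e₀^ pred k · ks) refl) (sym (trans (*-congˡ (G′-0 0 k ks)) (zeroʳ _)))
  Φ-lag zero (suc t) ks       = trans (expo-zero _ e₀ (e₀^ t · ks) refl) (sym (trans (*-congʳ (ι-0^[suc] t)) (zeroˡ _)))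
  Φ-lag (suc n) zero    []       = trans (*-identityˡ _) (trans (Φ⁻-lag n 0 []) (sym (trans (+-congˡ (zeroʳ _)) (+-identityʳ _))))
  Φ-lag (suc n) zero    (k ∷ ks) = +-cong (trans (*-identityˡ _) (Φ⁻-lag n 0 (k ∷ ks)))
    (trans (burst-⋆ n (Φ⁻-lag n) 1 k ks) (sym (trans (*-congʳ ι-1) (*-identityˡ _))))
  Φ-lag (suc n) (suc t) ks       = +-cong (trans (*-identityˡ _) (Φ⁻-lag n (suc t) ks))
    (trans (burst-e₀ n (Φ⁻-lag n) 0 (e₀^ t · ks)) (sym (trans (*-congʳ
        (trans (reflexive (≡.cong (λ m → ι (ℕ→ℚ m ^[ suc t ])) (ℕₚ.n∸n≡0 n))) (ι-0^[suc] t))) (zeroˡ _))))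

  Φ-encode : ∀ n ks → Φ n (encode ks) ≈ sumTo (G ks) n
  Φ-encode n ks = trans (Φ-lag n 0 ks) (sumTo-cong n (λ v _ → trans (*-congʳ ι-1) (*-identityˡ _)))

-- Exponentials of linear forms in several variables

module Exponentials where
  open ≡ using (refl; sym; trans; cong; cong₂)
  open import Data.Rational.Base using (_+_; _*_)
  open Defs hiding (e)
  open PowerSeries ℚ-algebra using (antidiag; antidiag-cong; antidiag-scale; antidiag-zero)
  open ℚ-Algebra.Solver ℚ-algebra using (solve; _:=_; _:+_; _:*_; con)
  open ≡.≡-Reasoning

  ∑-applyUpTo : ∀ (g : ℕ → ℕ) n F → ∑ (applyUpTo g (suc n)) F ≡ antidiag (λ x _ → F (g x)) n
  ∑-applyUpTo g zero    F = ℚₚ.+-identityʳ (F (g 0))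
  ∑-applyUpTo g (suc n) F = cong (F (g 0) +_) (∑-applyUpTo (g ∘ suc) n F)

  ∑-range₀ : ∀ n F → ∑ (range 0 n) F ≡ antidiag (λ x _ → F x) n
  ∑-range₀ n F = trans (cong (λ xs → ∑ xs F) (Listₚ.map-id (upTo (suc n)))) (∑-applyUpTo id n F)

  ∑-range₀-∸ : ∀ n (k : ℕ → ℕ → ℚ) → ∑ (range 0 n) (λ i → k i (n ∸ i)) ≡ antidiag k n
  ∑-range₀-∸ n k = trans (∑-range₀ n _) (antidiag-cong n (λ x y e → cong (k x) (trans (cong (_∸ x) (sym e)) (ℕₚ.m+n∸m≡n x y))))

  *ˣ-∷ : ∀ {r} (f g : Series (suc r)) n α → (f *ˣ g) (n ∷ α) ≡ antidiag (λ i j → ((λ β → f (i ∷ β)) *ˣ (λ β → g (j ∷ β))) α) n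
  *ˣ-∷ f g n α = ∑-range₀-∸ n (λ i j → ((λ β → f (i ∷ β)) *ˣ (λ β → g (j ∷ β))) α)

  *ˣ-cong : ∀ {r} {f f′ g g′ : Series r} → f ≗ f′ → g ≗ g′ → f *ˣ g ≗ f′ *ˣ g′
  *ˣ-cong {zero}  p q []      = cong₂ _*_ (p []) (q [])
  *ˣ-cong {suc r} {f} {f′} {g} {g′} p q (n ∷ α) = trans (*ˣ-∷ f g n α) (trans
    (antidiag-cong n (λ i j _ → *ˣ-cong (λ β → p (i ∷ β)) (λ β → q (j ∷ β)) α)) (sym (*ˣ-∷ f′ g′ n α)))

  *ˣ-scale : ∀ {r} c d (f g : Series r) → (c •ˣ f) *ˣ (d •ˣ g) ≗ (c * d) •ˣ (f *ˣ g)
  *ˣ-scale {zero}  c d f g []      = solve 4 (λ c d x y → c :* x :* (d :* y) := c :* d :* (x :* y)) refl c d (f []) (g [])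
  *ˣ-scale {suc r} c d f g (n ∷ α) = trans (*ˣ-∷ (c •ˣ f) (d •ˣ g) n α)
    (trans (antidiag-cong n (λ i j _ → *ˣ-scale c d (λ β → f (i ∷ β)) (λ β → g (j ∷ β)) α))
    (trans (antidiag-scale (c * d) _ n) (cong (c * d *_) (sym (*ˣ-∷ f g n α)))))

  -- The exponential of c 0 X₁ + c 1 X₂ + ⋯ (variables are numbered from 1, coefficients from 0).
  𝔼 : ∀ {r} → (ℕ → ℚ) → Series r
  𝔼 c []      = 1ℚ
  𝔼 c (n ∷ α) = c 0 ^[ n ] * 𝔼 (c ∘ suc) α

  𝔼-cong : ∀ {r} {c c′ : ℕ → ℚ} → c ≗ c′ → 𝔼 {r} c ≗ 𝔼 c′
  𝔼-cong p []      = refl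
  𝔼-cong p (n ∷ α) = cong₂ (λ x y → x ^[ n ] * y) (p 0) (𝔼-cong (p ∘ suc) α)

  𝔼-* : ∀ {r} c c′ → 𝔼 {r} c *ˣ 𝔼 c′ ≗ 𝔼 (λ l → c l + c′ l)
  𝔼-* c c′ []      = refl
  𝔼-* c c′ (n ∷ α) = begin
    (𝔼 c *ˣ 𝔼 c′) (n ∷ α)
      ≡⟨ *ˣ-∷ (𝔼 c) (𝔼 c′) n α ⟩
    antidiag (λ i j → ((c 0 ^[ i ] •ˣ 𝔼 (c ∘ suc)) *ˣ (c′ 0 ^[ j ] •ˣ 𝔼 (c′ ∘ suc))) α) n
      ≡⟨ antidiag-cong n (λ i j _ → trans (*ˣ-scale (c 0 ^[ i ]) (c′ 0 ^[ j ]) (𝔼 (c ∘ suc)) (𝔼 (c′ ∘ suc)) α)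
           (trans (cong (c 0 ^[ i ] * c′ 0 ^[ j ] *_) (𝔼-* (c ∘ suc) (c′ ∘ suc) α)) (ℚₚ.*-comm (c 0 ^[ i ] * c′ 0 ^[ j ]) _))) ⟩
    antidiag (λ i j → 𝔼 (λ l → c (suc l) + c′ (suc l)) α * (c 0 ^[ i ] * c′ 0 ^[ j ])) n
      ≡⟨ antidiag-scale (𝔼 (λ l → c (suc l) + c′ (suc l)) α) _ n ⟩
    𝔼 (λ l → c (suc l) + c′ (suc l)) α * antidiag (λ i j → c 0 ^[ i ] * c′ 0 ^[ j ]) n
      ≡⟨ trans (ℚₚ.*-comm (𝔼 (λ l → c (suc l) + c′ (suc l)) α) (antidiag (λ i j → c 0 ^[ i ] * c′ 0 ^[ j ]) n))
          (cong (_* 𝔼 (λ l → c (suc l) + c′ (suc l)) α) (^[]-+ (c 0) (c′ 0) n)) ⟩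
    𝔼 (λ l → c l + c′ l) (n ∷ α) ∎

  𝔼-0 : ∀ {r} → 1ˣ {r} ≗ 𝔼 (λ _ → 0ℚ)
  𝔼-0 []          = refl
  𝔼-0 (zero ∷ α)  = trans (𝔼-0 α) (sym (ℚₚ.*-identityˡ _))
  𝔼-0 (suc n ∷ α) = sym (trans (cong (_* 𝔼 (λ _ → 0ℚ) α) (0^[suc] n)) (ℚₚ.*-zeroˡ (𝔼 (λ _ → 0ℚ) α)))

  linear-form : ∀ {r} → (ℕ → ℚ) → Series r
  linear-form c []                = 0ℚ
  linear-form c (zero ∷ α)        = linear-form (c ∘ suc) α
  linear-form c (suc zero ∷ α)    = c 0 * 1ˣ α
  linear-form c (suc (suc _) ∷ α) = 0ℚ

  *ˣ-zeroˡ : ∀ {r} {f : Series r} g → (∀ α → f α ≡ 0ℚ) → ∀ α → (f *ˣ g) α ≡ 0ℚ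
  *ˣ-zeroˡ g z []      = trans (cong (_* g []) (z [])) (ℚₚ.*-zeroˡ (g []))
  *ˣ-zeroˡ {f = f} g z (n ∷ α) = trans (*ˣ-∷ f g n α)
    (trans (antidiag-cong n (λ i j _ → *ˣ-zeroˡ (λ β → g (j ∷ β)) (λ β → z (i ∷ β)) α)) (antidiag-zero n))

  1ˣ-* : ∀ {r} c (f : Series r) α → ((c •ˣ 1ˣ) *ˣ f) α ≡ c * f α
  1ˣ-* c f []      = cong (_* f []) (ℚₚ.*-identityʳ c)
  1ˣ-* c f (n ∷ α) = trans (*ˣ-∷ (c •ˣ 1ˣ) f n α) (trans (antidiag-first n (λ i j → *ˣ-zeroˡ (λ β → f (j ∷ β)) (λ β → ℚₚ.*-zeroʳ c) α))
      (1ˣ-* c (λ β → f (n ∷ β)) α))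
    where
    antidiag-first : ∀ n {k} → (∀ i j → k (suc i) j ≡ 0ℚ) → antidiag k n ≡ k 0 n
    antidiag-first zero        z = refl
    antidiag-first (suc n) {k} z = trans (cong (k 0 (suc n) +_) (trans (antidiag-cong n (λ i j _ → z i j)) (antidiag-zero n)))
        (ℚₚ.+-identityʳ _)

  -- Multiplication by a linear form, on series of the shape h(|α|) · 𝔼 c α.
  raise : (ℕ → ℚ) → ℕ → ℚ
  raise h k = ℕ→ℚ k * h (pred k)

  -- Lowering one exponent of `𝔼 c` and multiplying by the coefficient of that variable has the
  -- effect of a factor equal to the exponent; the exponents add up to the total degree, whence
  -- `raise`. The weight `h` is arbitrary because fixing the first exponent n replaces it by k ↦ h(n
  -- + k) c₀^n/n!.
  linear-form-* : ∀ {r} c h (f : Series r) → (∀ α → f α ≡ h (Vec.sum α) * 𝔼 c α) →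
                  ∀ α → (linear-form c *ˣ f) α ≡ raise h (Vec.sum α) * 𝔼 c α
  linear-form-* c h f p [] = trans (ℚₚ.*-zeroˡ (f [])) (sym (trans (cong (_* 1ℚ) (ℚₚ.*-zeroˡ (h 0))) (ℚₚ.*-zeroˡ 1ℚ)))
  linear-form-* c h f p (n ∷ α) = trans (*ˣ-∷ (linear-form c) f n α) (go n)
    where
    E = 𝔼 (c ∘ suc) α
    low : ∀ n → (linear-form (c ∘ suc) *ˣ (λ β → f (n ∷ β))) α ≡ raise (λ k → h (n ℕ.+ k) * c 0 ^[ n ]) (Vec.sum α) * E
    low n = linear-form-* (c ∘ suc) (λ k → h (n ℕ.+ k) * c 0 ^[ n ]) (λ β → f (n ∷ β))
      (λ β → trans (p (n ∷ β)) (sym (ℚₚ.*-assoc (h (n ℕ.+ Vec.sum β)) (c 0 ^[ n ]) (𝔼 (c ∘ suc) β)))) α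
    k : ℕ → ℕ → ℚ
    k i j = ((λ β → linear-form c (i ∷ β)) *ˣ (λ β → f (j ∷ β))) α
    high : ∀ m → antidiag (k ∘ suc) m ≡ c 0 * (h (m ℕ.+ Vec.sum α) * (c 0 ^[ m ] * E))
    high zero    = trans (1ˣ-* (c 0) (λ β → f (0 ∷ β)) α) (cong (c 0 *_) (p (0 ∷ α)))
    high (suc m) = trans (cong₂ _+_ (trans (1ˣ-* (c 0) (λ β → f (suc m ∷ β)) α) (cong (c 0 *_) (p (suc m ∷ α))))
      (trans (antidiag-cong m (λ i j _ → *ˣ-zeroˡ (λ β → f (j ∷ β)) (λ _ → refl) α)) (antidiag-zero m))) (ℚₚ.+-identityʳ _)
    combine : ∀ m s → ℕ→ℚ s * (h (suc m ℕ.+ pred s) * c 0 ^[ suc m ]) * E + c 0 * (h (m ℕ.+ s) * (c 0 ^[ m ] * E))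
              ≡ raise h (suc m ℕ.+ s) * (c 0 ^[ suc m ] * E)
    combine m s = begin
      ℕ→ℚ s * (h (suc m ℕ.+ pred s) * P) * E + c 0 * (h (m ℕ.+ s) * (c 0 ^[ m ] * E))
        ≡⟨ cong₂ _+_ (pred-shift s) (solve 4 (λ c h p e → c :* (h :* (p :* e)) := c :* p :* h :* e) refl (c 0) (h (m ℕ.+ s))
            (c 0 ^[ m ]) E) ⟩
      ℕ→ℚ s * (h (m ℕ.+ s) * P) * E + c 0 * c 0 ^[ m ] * h (m ℕ.+ s) * E
        ≡⟨ cong (λ x → ℕ→ℚ s * (h (m ℕ.+ s) * P) * E + x * h (m ℕ.+ s) * E) (^[]-suc (c 0) m) ⟨
      ℕ→ℚ s * (h (m ℕ.+ s) * P) * E + ℕ→ℚ (suc m) * P * h (m ℕ.+ s) * E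
        ≡⟨ solve 5 (λ s m h p e → s :* (h :* p) :* e :+ m :* p :* h :* e := (m :+ s) :* h :* (p :* e)) refl (ℕ→ℚ s) (ℕ→ℚ (suc m))
            (h (m ℕ.+ s)) P E ⟩
      (ℕ→ℚ (suc m) + ℕ→ℚ s) * h (m ℕ.+ s) * (P * E)
        ≡⟨ cong (λ x → x * h (m ℕ.+ s) * (P * E)) (ℕ→ℚ-+ (suc m) s) ⟨
      raise h (suc m ℕ.+ s) * (P * E) ∎
      where
      P = c 0 ^[ suc m ]
      -- For s = 0 the arguments of `h` on the two sides differ, but then the factor s is 0.
      pred-shift : ∀ s → ℕ→ℚ s * (h (suc m ℕ.+ pred s) * P) * E ≡ ℕ→ℚ s * (h (m ℕ.+ s) * P) * E
      pred-shift zero    = solve 4 (λ x y p e → con 0ℚ :* (x :* p) :* e := con 0ℚ :* (y :* p) :* e) refl (h (suc m ℕ.+ 0)) (h (m ℕ.+ 0)) P E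
      pred-shift (suc s) = cong (λ i → ℕ→ℚ (suc s) * (h i * P) * E) (sym (ℕₚ.+-suc m s))
    go : ∀ n → antidiag k n ≡ raise h (n ℕ.+ Vec.sum α) * (c 0 ^[ n ] * E)
    go zero    = trans (low 0) (solve 3 (λ s h e → s :* (h :* con 1ℚ) :* e := s :* h :* (con 1ℚ :* e)) refl (ℕ→ℚ (Vec.sum α))
        (h (pred (Vec.sum α))) E)
    go (suc m) = trans (cong₂ _+_ (low (suc m)) (high m)) (combine m (Vec.sum α))

  -- degree-weight n k is n! if k = n, and 0 otherwise.
  degree-weight : ℕ → ℕ → ℚ
  degree-weight zero    zero    = 1ℚ
  degree-weight zero    (suc _) = 0ℚ
  degree-weight (suc n) k       = raise (degree-weight n) k

  linear-form-^ : ∀ {r} c {Y : Series r} → Y ≗ linear-form c → ∀ n α → (Y ^ˣ n) α ≡ degree-weight n (Vec.sum α) * 𝔼 c α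
  linear-form-^ c {Y} p zero    α = one α
    where
    one : ∀ {r} {c} (α : Vec ℕ r) → 1ˣ α ≡ degree-weight 0 (Vec.sum α) * 𝔼 c α
    one []          = refl
    one {c = c} (zero ∷ α)  = trans (one {c = c ∘ suc} α) (cong (degree-weight 0 (Vec.sum α) *_) (sym (ℚₚ.*-identityˡ (𝔼 (c ∘ suc) α))))
    one {c = c} (suc n ∷ α) = sym (ℚₚ.*-zeroˡ (𝔼 c (suc n ∷ α)))
  linear-form-^ c {Y} p (suc n) α = trans (*ˣ-cong p (λ _ → refl) α)
    (linear-form-* c (degree-weight n) (Y ^ˣ n) (linear-form-^ c p n) α)

  degree-weight-sum : ∀ (g : ℕ → ℚ) k → antidiag (λ n _ → g n * degree-weight n k) k ≡ g k * ℕ→ℚ (k !)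
  degree-weight-sum g zero    = refl
  degree-weight-sum g (suc k) = begin
    g 0 * 0ℚ + antidiag (λ n _ → g (suc n) * (ℕ→ℚ (suc k) * degree-weight n k)) k
      ≡⟨ cong₂ _+_ (ℚₚ.*-zeroʳ (g 0)) (antidiag-cong k (λ n _ _ → solve 3 (λ x y z → x :* (y :* z) := y :* (x :* z)) refl (g (suc n))
          (ℕ→ℚ (suc k)) (degree-weight n k))) ⟩
    0ℚ + antidiag (λ n _ → ℕ→ℚ (suc k) * (g (suc n) * degree-weight n k)) k
      ≡⟨ trans (ℚₚ.+-identityˡ _) (antidiag-scale (ℕ→ℚ (suc k)) _ k) ⟩
    ℕ→ℚ (suc k) * antidiag (λ n _ → g (suc n) * degree-weight n k) k
      ≡⟨ cong (ℕ→ℚ (suc k) *_) (degree-weight-sum (g ∘ suc) k) ⟩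
    ℕ→ℚ (suc k) * (g (suc k) * ℕ→ℚ (k !))
      ≡⟨ solve 3 (λ x y z → x :* (y :* z) := y :* (x :* z)) refl (ℕ→ℚ (suc k)) (g (suc k)) (ℕ→ℚ (k !)) ⟩
    g (suc k) * (ℕ→ℚ (suc k) * ℕ→ℚ (k !))
      ≡⟨ cong (g (suc k) *_) (ℕ→ℚ-* (suc k) (k !)) ⟨
    g (suc k) * ℕ→ℚ (suc k !) ∎

  exp-linear-form : ∀ {r} c {Y : Series r} → Y ≗ linear-form c → exp Y ≗ 𝔼 c
  exp-linear-form c {Y} p α = begin
    ∑ (range 0 k) (λ n → 1/ n ! * (Y ^ˣ n) α)
      ≡⟨ ∑-range₀ k _ ⟩
    antidiag (λ n _ → 1/ n ! * (Y ^ˣ n) α) k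
      ≡⟨ antidiag-cong k (λ n _ _ → trans (cong (1/ n ! *_) (linear-form-^ c p n α))
           (solve 3 (λ x y z → x :* (y :* z) := z :* (x :* y)) refl (1/ n !) (degree-weight n k) (𝔼 c α))) ⟩
    antidiag (λ n _ → 𝔼 c α * (1/ n ! * degree-weight n k)) k
      ≡⟨ trans (antidiag-scale (𝔼 c α) _ k) (cong (𝔼 c α *_) (degree-weight-sum 1/_! k)) ⟩
    𝔼 c α * (1/ k ! * ℕ→ℚ (k !))
      ≡⟨ trans (cong (𝔼 c α *_) (1/!-* k)) (ℚₚ.*-identityʳ _) ⟩
    𝔼 c α ∎
    where k = Vec.sum α

-- The lower entries of H as gaps between summation indices

module LowerEntries where
  open import Data.Bool.Base using (T)
  open Defs hiding (e)
  open Exponentials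
  open ≡ using (refl; sym; trans; cong; cong₂; subst)
  open import Data.Rational.Base using (_+_; _*_; _-_; -_)
  open ℚ-Algebra.Solver ℚ-algebra using (solve; _:=_; _:+_; _:*_; _:-_; :-_; con)

  unit : ℕ → ℕ → ℚ
  unit zero    _ = 0ℚ
  unit (suc j) l = if j ≡ᵇ l then 1ℚ else 0ℚ

  linear-form-0 : ∀ {r} (α : Vec ℕ r) → linear-form (λ _ → 0ℚ) α ≡ 0ℚ
  linear-form-0 []                = refl
  linear-form-0 (zero ∷ α)        = linear-form-0 α
  linear-form-0 (suc zero ∷ α)    = ℚₚ.*-zeroˡ (1ˣ α)
  linear-form-0 (suc (suc _) ∷ α) = refl

  X-linear-form : ∀ {r} j → X {r} j ≗ linear-form (unit j)
  X-linear-form zero          α                 = sym (linear-form-0 α)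
  X-linear-form (suc j)       []                = refl
  X-linear-form (suc zero)    (zero ∷ α)        = sym (linear-form-0 α)
  X-linear-form (suc zero)    (suc zero ∷ α)    = sym (ℚₚ.*-identityˡ (1ˣ α))
  X-linear-form (suc zero)    (suc (suc n) ∷ α) = refl
  X-linear-form (suc (suc j)) (zero ∷ α)        = X-linear-form (suc j) α
  X-linear-form (suc (suc j)) (suc zero ∷ α)    = sym (ℚₚ.*-zeroˡ (1ˣ α))
  X-linear-form (suc (suc j)) (suc (suc n) ∷ α) = refl

  linear-form-combination : ∀ {r} x c c′ → x •ˣ (linear-form {r} c -ˣ linear-form c′) ≗ linear-form (λ l → x * (c l - c′ l))
  linear-form-combination x c c′ []                = ℚₚ.*-zeroʳ x
  linear-form-combination x c c′ (zero ∷ α)        = linear-form-combination x (c ∘ suc) (c′ ∘ suc) α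
  linear-form-combination x c c′ (suc zero ∷ α)    = solve 4 (λ x a b e → x :* (a :* e :- b :* e) := x :* (a :- b) :* e) refl x (c 0)
      (c′ 0) (1ˣ α)
  linear-form-combination x c c′ (suc (suc n) ∷ α) = ℚₚ.*-zeroʳ x

  coefficients : ∀ {m} → ℕ → Vec ℕ m → Vec ℕ m → ℕ → ℚ
  coefficients s []       []       l = 0ℚ
  coefficients s (i ∷ is) (δ ∷ δs) l = ℕ→ℚ δ * (unit s l - unit (s ∸ i) l) + coefficients (s ∸ i) is δs l

  product-exp : ∀ {r m} s (is δs : Vec ℕ m) →
    Vec.foldr′ _*ˣ_ 1ˣ (Vec.zipWith (λ δ Y → exp (ℕ→ℚ δ •ˣ Y)) δs (lowerEntries {r} s is)) ≗ 𝔼 (coefficients s is δs)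
  product-exp s []       []       α = 𝔼-0 α
  product-exp s (i ∷ is) (δ ∷ δs) α = trans
    (*ˣ-cong (exp-linear-form (λ l → ℕ→ℚ δ * (unit s l - unit (s ∸ i) l)) (λ β → trans
        (cong (ℕ→ℚ δ *_) (cong₂ _-_ (X-linear-form s β) (X-linear-form (s ∸ i) β)))
        (linear-form-combination (ℕ→ℚ δ) (unit s) (unit (s ∸ i)) β)))
      (product-exp (s ∸ i) is δs) α)
    (𝔼-* (λ l → ℕ→ℚ δ * (unit s l - unit (s ∸ i) l)) (coefficients (s ∸ i) is δs) α)

  data Composition : ∀ {m} → ℕ → Vec ℕ m → Set where
    []  : Composition 0 []
    _∷_ : ∀ {m s i} {is : Vec ℕ m} → 1 ≤ i → Composition (s ∸ i) is → Composition s (i ∷ is)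

  -- The coefficients of Σⱼ (δⱼ − δⱼ₋₁) X_{sⱼ}, where s₁ = s, sⱼ₊₁ = sⱼ − iⱼ and δ₀ = a.
  gaps : ∀ {m} → ℕ → ℚ → Vec ℕ m → Vec ℕ m → ℕ → ℚ
  gaps s a []       []       l = 0ℚ
  gaps s a (i ∷ is) (δ ∷ δs) l = if s ≡ᵇ suc l then ℕ→ℚ δ - a else gaps (s ∸ i) (ℕ→ℚ δ) is δs l

  ≡ᵇ-false : ∀ {m n} → m < n → (m ≡ᵇ n) ≡ false
  ≡ᵇ-false {zero}  {suc n} _       = refl
  ≡ᵇ-false {suc m} {suc n} (s≤s p) = ≡ᵇ-false p

  gaps-beyond : ∀ {m} s a (is δs : Vec ℕ m) l → s ≤ l → gaps s a is δs l ≡ 0ℚ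
  gaps-beyond s a []       []       l s≤l = refl
  gaps-beyond s a (i ∷ is) (δ ∷ δs) l s≤l rewrite ≡ᵇ-false (s≤s s≤l) =
    gaps-beyond (s ∸ i) (ℕ→ℚ δ) is δs l (≤-trans (ℕₚ.m∸n≤m s i) s≤l)

  absent : ∀ d u g a → d * (0ℚ - u) + (d * u + g) ≡ a * 0ℚ + g
  absent = solve 4 (λ d u g a → d :* (con 0ℚ :- u) :+ (d :* u :+ g) := a :* con 0ℚ :+ g) refl

  -- Abel summation: X_{s-i} occurs with -δ in one block and with the next summation index in the
  -- following block, so each variable collects a gap. The parameter `a` is the preceding index.
  coefficients-gaps : ∀ {m s} {is : Vec ℕ m} → Composition s is → ∀ a δs l →
    coefficients s is δs l ≡ a * unit s l + gaps s a is δs l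
  coefficients-gaps [] a [] l = sym (trans (cong (_+ 0ℚ) (ℚₚ.*-zeroʳ a)) (ℚₚ.+-identityˡ 0ℚ))
  coefficients-gaps {s = zero} {i ∷ is} (p ∷ v) a (δ ∷ δs) l = trans
    (cong (ℕ→ℚ δ * (0ℚ - unit (0 ∸ i) l) +_) (coefficients-gaps v (ℕ→ℚ δ) δs l))
    (absent (ℕ→ℚ δ) (unit (0 ∸ i) l) (gaps (0 ∸ i) (ℕ→ℚ δ) is δs l) a)
  coefficients-gaps {s = suc j} {i ∷ is} (p ∷ v) a (δ ∷ δs) l
    rewrite coefficients-gaps v (ℕ→ℚ δ) δs l with j ≡ᵇ l in eq
  ... | false = absent (ℕ→ℚ δ) (unit (suc j ∸ i) l) (gaps (suc j ∸ i) (ℕ→ℚ δ) is δs l) a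
  ... | true  = trans (cong (λ g → ℕ→ℚ δ * (1ℚ - unit (suc j ∸ i) l) + (ℕ→ℚ δ * unit (suc j ∸ i) l + g))
      (gaps-beyond (suc j ∸ i) (ℕ→ℚ δ) is δs l below))
    (solve 3 (λ d u a → d :* (con 1ℚ :- u) :+ (d :* u :+ con 0ℚ) := a :* con 1ℚ :+ (d :- a)) refl (ℕ→ℚ δ) (unit (suc j ∸ i) l) a)
    where
    j≡l : j ≡ l
    j≡l = ℕₚ.≡ᵇ⇒≡ j l (subst T (sym eq) _)
    below : suc j ∸ i ≤ l
    below = subst (suc j ∸ i ≤_) j≡l (ℕₚ.∸-monoʳ-≤ (suc j) p)

  product-gaps : ∀ {r m s} {is : Vec ℕ m} → Composition s is → ∀ δs →
    Vec.foldr′ _*ˣ_ 1ˣ (Vec.zipWith (λ δ Y → exp (ℕ→ℚ δ •ˣ Y)) δs (lowerEntries {r} s is)) ≗ 𝔼 (gaps s 0ℚ is δs)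
  product-gaps {s = s} {is} v δs α = trans (product-exp s is δs α) (𝔼-cong (λ l →
    trans (coefficients-gaps v 0ℚ δs l) (trans (cong (_+ gaps s 0ℚ is δs l) (ℚₚ.*-zeroˡ (unit s l))) (ℚₚ.+-identityˡ _))) α)

-- Sums over increasing tuples as iterated convolutions

module NestedRanges (K : ℚ-Algebra) (atoms : Atoms K) where
  open Defs using (range; increasing)
  open ℚ-Algebra K
  open Atoms atoms
  open NestedSums K atoms using (φ; rotaBaxterData)
  open Stuffle (PowerSeries.algebra K) rotaBaxterData using (G; G′; Λ^)
  open PowerSeries K using (conv; const; conv-constˡ; conv-distribˡ; conv-scaleˡ; conv-cong; conv-zeroˡ; conv-comm)
  open PathOrdered K atoms using (antidiag-sumTo)
  open Sums K
  open Solver using (solve; _:=_; _:+_; _:*_)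
  open import Relation.Binary.Reasoning.Setoid setoid

  sumL : {A : Set} → List A → (A → Carrier) → Carrier
  sumL xs f = foldr (λ x s → f x + s) 0# xs

  sumL-cong : ∀ {A : Set} (xs : List A) {f g : A → Carrier} → (∀ x → f x ≈ g x) → sumL xs f ≈ sumL xs g
  sumL-cong []       p = refl
  sumL-cong (x ∷ xs) p = +-cong (p x) (sumL-cong xs p)

  sumL-++ : ∀ {A : Set} (xs ys : List A) f → sumL (xs ++ ys) f ≈ sumL xs f + sumL ys f
  sumL-++ []       ys f = sym (+-identityˡ _)
  sumL-++ (x ∷ xs) ys f = trans (+-congˡ (sumL-++ xs ys f)) (sym (+-assoc _ _ _))

  sumL-scale : ∀ {A : Set} c (xs : List A) f → sumL xs (λ x → c * f x) ≈ c * sumL xs f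
  sumL-scale c []       f = sym (zeroʳ c)
  sumL-scale c (x ∷ xs) f = trans (+-congˡ (sumL-scale c xs f)) (sym (distribˡ _ _ _))

  sumL-map : ∀ {A B : Set} (h : A → B) xs f → sumL (map h xs) f ≈ sumL xs (f ∘ h)
  sumL-map h []       f = refl
  sumL-map h (x ∷ xs) f = +-congˡ (sumL-map h xs f)

  sumL-concatMap : ∀ {A B : Set} (h : A → List B) xs f → sumL (concatMap h xs) f ≈ sumL xs (λ x → sumL (h x) f)
  sumL-concatMap h []       f = refl
  sumL-concatMap h (x ∷ xs) f = trans (sumL-++ (h x) (concatMap h xs) f) (+-congˡ (sumL-concatMap h xs f))

  sumL-applyUpTo : ∀ {A : Set} (g : ℕ → A) m f → sumL (applyUpTo g (suc m)) f ≈ sumL (applyUpTo g m) f + f (g m)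
  sumL-applyUpTo g zero    f = trans (+-identityʳ _) (sym (+-identityˡ _))
  sumL-applyUpTo g (suc m) f = trans (+-congˡ (sumL-applyUpTo (g ∘ suc) m f)) (sym (+-assoc _ _ _))

  sumL-range : ∀ a b (g h : ℕ → Carrier) → (∀ δ → δ ≤ a → h δ ≈ 0#) → (∀ δ → a < δ → g δ ≈ h δ) → sumL (range (suc a) b) g ≈ sumTo h b
  sumL-range a b g h z p = trans (sumL-map (suc a ℕ.+_) (upTo (b ∸ a)) g) (go b)
    where
    go : ∀ b → sumL (upTo (b ∸ a)) (λ x → g (suc a ℕ.+ x)) ≈ sumTo h b
    go zero    = trans (reflexive (≡.cong (λ m → sumL (upTo m) (λ x → g (suc a ℕ.+ x))) (ℕₚ.0∸n≡0 a))) (sym (z 0 z≤n))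
    go (suc b) with ℕₚ.<-≤-connex a (suc b)
    ... | inj₂ b<a = trans (reflexive (≡.cong (λ m → sumL (upTo m) (λ x → g (suc a ℕ.+ x)))
        (≡.trans (ℕₚ.m≤n⇒m∸n≡0 b<a) (≡.sym (ℕₚ.m≤n⇒m∸n≡0 (<⇒≤ b<a))))))
        (trans (go b) (trans (sym (+-identityʳ _)) (+-congˡ (sym (z (suc b) b<a)))))
    ... | inj₁ (s≤s a≤b) = begin
        sumL (upTo (suc b ∸ a)) (λ x → g (suc a ℕ.+ x))
          ≈⟨ reflexive (≡.cong (λ m → sumL (upTo m) (λ x → g (suc a ℕ.+ x))) (ℕₚ.+-∸-assoc 1 a≤b)) ⟩
        sumL (upTo (suc (b ∸ a))) (λ x → g (suc a ℕ.+ x))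
          ≈⟨ sumL-applyUpTo id (b ∸ a) _ ⟩
        sumL (upTo (b ∸ a)) (λ x → g (suc a ℕ.+ x)) + g (suc a ℕ.+ (b ∸ a))
          ≈⟨ +-cong (go b) (trans (reflexive (≡.cong (g ∘ suc) (ℕₚ.m+[n∸m]≡n a≤b))) (p (suc b) (s≤s a≤b))) ⟩
        sumTo h b + h (suc b) ∎

  pow : Carrier → ℕ → Carrier
  pow x zero    = 1#
  pow x (suc i) = x * pow x i

  monomial : ∀ {m} → Vec ℕ m → Vec ℕ m → Carrier
  monomial []       []       = 1#
  monomial (i ∷ is) (δ ∷ δs) = pow (L δ) i * monomial is δs

  weight : ∀ {m} → ℚ → Vec ℕ m → Vec ℕ m → ℚ
  weight a []       []       = 1ℚ
  weight a (k ∷ ks) (δ ∷ δs) = (ℕ→ℚ δ ℚ.- a) ^[ pred k ] ℚ.* weight (ℕ→ℚ δ) ks δs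

  -- upward starts from the smallest summation index, as H does, and downward from the largest, as G does.
  upward : ∀ {m} → ℕ → ℕ → Vec ℕ m → Vec ℕ m → Carrier
  upward b a []       []       = 1#
  upward b a (k ∷ ks) (i ∷ is) = sumTo (λ δ → φ k (δ ∸ a) * (pow (L δ) i * upward b δ ks is)) b

  φ-gap : ∀ k a δ → a < δ → ι ((ℕ→ℚ δ ℚ.- ℕ→ℚ a) ^[ pred k ]) ≈ φ k (δ ∸ a)
  φ-gap k a (suc δ) (s≤s a≤δ) = trans (ι-cong (≡.cong (_^[ pred k ]) e)) (reflexive (≡.cong (φ k) (≡.sym (ℕₚ.+-∸-assoc 1 a≤δ))))
    where
    e : ℕ→ℚ (suc δ) ℚ.- ℕ→ℚ a ≡ ℕ→ℚ (suc (δ ∸ a))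
    e = ≡.trans (≡.cong (λ m → ℕ→ℚ m ℚ.- ℕ→ℚ a) (≡.cong suc (≡.sym (ℕₚ.m∸n+n≡m a≤δ))))
      (≡.trans (≡.cong (ℚ._- ℕ→ℚ a) (ℕ→ℚ-+ (suc (δ ∸ a)) a))
      (ℚ-Algebra.Solver.solve ℚ-algebra 2 (λ x y → (x Q.:+ y) Q.:- y Q.:= x) ≡.refl (ℕ→ℚ (suc (δ ∸ a))) (ℕ→ℚ a)))
      where module Q = ℚ-Algebra.Solver ℚ-algebra

  sum-increasing : ∀ {m} b a (ks is : Vec ℕ m) → sumL (increasing m a b) (λ δs → ι (weight (ℕ→ℚ a) ks δs) * monomial is δs) ≈ upward b a
      ks is
  sum-increasing b a []       []       = trans (+-identityʳ _) (trans (*-congʳ ι-1) (*-identityˡ _))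
  sum-increasing {suc m} b a (k ∷ ks) (i ∷ is) = begin
    sumL (concatMap (λ δ → map (δ ∷_) (increasing m δ b)) (range (suc a) b)) f
      ≈⟨ sumL-concatMap (λ δ → map (δ ∷_) (increasing m δ b)) (range (suc a) b) f ⟩
    sumL (range (suc a) b) (λ δ → sumL (map (δ ∷_) (increasing m δ b)) f)
      ≈⟨ sumL-range a b _ _
           (λ δ δ≤a → trans (*-congʳ (reflexive (≡.cong (φ k) (ℕₚ.m≤n⇒m∸n≡0 δ≤a)))) (zeroˡ _))
           (λ δ a<δ → begin
             sumL (map (δ ∷_) (increasing m δ b)) f
               ≈⟨ sumL-map (δ ∷_) (increasing m δ b) f ⟩
             sumL (increasing m δ b) (λ δs → f (δ ∷ δs))
               ≈⟨ sumL-cong (increasing m δ b) (λ δs → trans (*-congʳ (ι-* _ _))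
                    (solve 4 (λ x y z w → x :* y :* (z :* w) := x :* z :* (y :* w)) refl _ _ _ _)) ⟩
             sumL (increasing m δ b) (λ δs → ι ((ℕ→ℚ δ ℚ.- ℕ→ℚ a) ^[ pred k ]) * pow (L δ) i * (ι (weight (ℕ→ℚ δ) ks δs) * monomial is δs))
               ≈⟨ sumL-scale _ (increasing m δ b) _ ⟩
             ι ((ℕ→ℚ δ ℚ.- ℕ→ℚ a) ^[ pred k ]) * pow (L δ) i * sumL (increasing m δ b) (λ δs → ι (weight (ℕ→ℚ δ) ks δs) * monomial is δs)
               ≈⟨ *-cong (*-congʳ (φ-gap k a δ a<δ)) (sum-increasing b δ ks is) ⟩
             φ k (δ ∸ a) * pow (L δ) i * upward b δ ks is
               ≈⟨ *-assoc _ _ _ ⟩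
             φ k (δ ∸ a) * (pow (L δ) i * upward b δ ks is) ∎) ⟩
    upward b a (k ∷ ks) (i ∷ is) ∎
    where
    f : Vec ℕ (suc m) → Carrier
    f δs = ι (weight (ℕ→ℚ a) (k ∷ ks) δs) * monomial (i ∷ is) δs

  downward : (ℕ → Carrier) → List (ℕ × ℕ) → ℕ → Carrier
  downward F []             = F
  downward F ((k , i) ∷ bs) = downward (Λ^ i (conv (φ k) F)) bs

  Λ^-pow : ∀ i (F : ℕ → Carrier) s → Λ^ i F s ≈ pow (L s) i * F s
  Λ^-pow zero    F s = sym (*-identityˡ _)
  Λ^-pow (suc i) F s = trans (*-congˡ (Λ^-pow i F s)) (sym (*-assoc _ _ _))

  sumTo-swap : ∀ (k : ℕ → ℕ → Carrier) m n → sumTo (λ x → sumTo (k x) n) m ≈ sumTo (λ y → sumTo (λ x → k x y) m) n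
  sumTo-swap k zero    n = refl
  sumTo-swap k (suc m) n = trans (+-congʳ (sumTo-swap k m n)) (sym (sumTo-+ _ _ n))

  -- Interchanging the sums over a and δ turns F(a) φ_k(δ - a) into the coefficient of φ_k F at δ.
  -- One block thereby moves from `upward` into the accumulator of `downward`.
  upward-downward : ∀ {m} b F (ks is : Vec ℕ m) → sumTo (λ a → F a * upward b a ks is) b ≈ sumTo (downward F (Vec.toList (Vec.zip ks is))) b
  upward-downward b F []       []       = sumTo-cong b (λ _ _ → *-identityʳ _)
  upward-downward b F (k ∷ ks) (i ∷ is) = begin
    sumTo (λ a → F a * sumTo (λ δ → φ k (δ ∸ a) * Y δ) b) b
      ≈⟨ sumTo-cong b (λ a _ → sumTo-scale (F a) _ b) ⟨
    sumTo (λ a → sumTo (λ δ → F a * (φ k (δ ∸ a) * Y δ)) b) b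
      ≈⟨ sumTo-swap _ b b ⟩
    sumTo (λ δ → sumTo (λ a → F a * (φ k (δ ∸ a) * Y δ)) b) b
      ≈⟨ sumTo-cong b (λ δ δ≤b → begin
           sumTo (λ a → F a * (φ k (δ ∸ a) * Y δ)) b
             ≈⟨ sumTo-cong b (λ a _ → solve 3 (λ f p y → f :* (p :* y) := y :* (p :* f)) refl _ _ _) ⟩
           sumTo (λ a → Y δ * (φ k (δ ∸ a) * F a)) b
             ≈⟨ sumTo-scale (Y δ) _ b ⟩
           Y δ * sumTo (λ a → φ k (δ ∸ a) * F a) b
             ≈⟨ *-congˡ (sumTo-extend _ δ≤b (λ a δ<a → trans (*-congʳ (reflexive (≡.cong (φ k) (ℕₚ.m≤n⇒m∸n≡0 (<⇒≤ δ<a))))) (zeroˡ _))) ⟩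
           Y δ * sumTo (λ a → φ k (δ ∸ a) * F a) δ
             ≈⟨ *-congˡ (antidiag-sumTo (λ x y → φ k x * F y) δ) ⟨
           pow (L δ) i * upward b δ ks is * conv (φ k) F δ
             ≈⟨ solve 3 (λ p u c → p :* u :* c := p :* c :* u) refl _ _ _ ⟩
           pow (L δ) i * conv (φ k) F δ * upward b δ ks is
             ≈⟨ *-congʳ (Λ^-pow i (conv (φ k) F) δ) ⟨
           Λ^ i (conv (φ k) F) δ * upward b δ ks is ∎) ⟩
    sumTo (λ δ → Λ^ i (conv (φ k) F) δ * upward b δ ks is) b
      ≈⟨ upward-downward b (Λ^ i (conv (φ k) F)) ks is ⟩
    sumTo (downward F (Vec.toList (Vec.zip (k ∷ ks) (i ∷ is)))) b ∎
    where
    Y : ℕ → Carrier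
    Y δ = pow (L δ) i * upward b δ ks is

  upward-0 : ∀ {m} b (ks is : Vec ℕ m) → upward b 0 ks is ≈ sumTo (downward (const 1#) (Vec.toList (Vec.zip ks is))) b
  upward-0 b ks is = trans (sym (first b)) (upward-downward b (const 1#) ks is)
    where
    first : ∀ n → sumTo (λ a → const 1# a * upward b a ks is) n ≈ upward b 0 ks is
    first zero    = *-identityˡ _
    first (suc n) = trans (+-cong (first n) (zeroˡ _)) (+-identityʳ _)

  -- A composition in H: for each block, the smallest summation index first, its last letter and its size.
  Blocks : Set
  Blocks = List (ℕ × ℕ)

  mutual
    -- The recursion of `G` and `G′` with the nested sums left symbolic, so that it can be compared
    -- with the compositions in `generating` term by term.
    expansion : List ℕ → List (ℚ × Blocks)
    expansion []      = (1ℚ , []) ∷ []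
    expansion (k ∷ w) = expansion′ 1 k w

    expansion′ : ℕ → ℕ → List ℕ → List (ℚ × Blocks)
    expansion′ i k []      = (1/ i ! , (k , i) ∷ []) ∷ []
    expansion′ i k (l ∷ w) = map (λ (c , bs) → 1/ i ! ℚ.* c , bs ++ (k , i) ∷ []) (expansion (l ∷ w))
                          ++ map (λ (c , bs) → 0ℚ ^[ pred k ] ℚ.* c , bs) (expansion′ (suc i) l w)

  evaluate : List (ℚ × Blocks) → ℕ → Carrier
  evaluate xs s = sumL xs (λ (c , bs) → ι c * downward (const 1#) bs s)

  downward-snoc : ∀ F bs k i → downward F (bs ++ (k , i) ∷ []) ≡ Λ^ i (conv (φ k) (downward F bs))
  downward-snoc F []       k i = ≡.refl
  downward-snoc F (b ∷ bs) k i = downward-snoc _ bs k i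

  evaluate-snoc : ∀ c k i xs s → evaluate (map (λ (d , bs) → c ℚ.* d , bs ++ (k , i) ∷ []) xs) s ≈ ι c * Λ^ i (conv (φ k) (evaluate xs)) s
  evaluate-snoc c k i [] s = sym (trans (*-congˡ (trans (Λ^-pow i _ s)
      (trans (*-congˡ (trans (conv-comm (φ k) (λ _ → 0#) s) (conv-zeroˡ _ (φ k) (λ _ → refl) s))) (zeroʳ _)))) (zeroʳ _))
  evaluate-snoc c k i ((d , bs) ∷ xs) s = begin
    ι (c ℚ.* d) * downward (const 1#) (bs ++ (k , i) ∷ []) s + evaluate (map _ xs) s
      ≈⟨ +-cong (*-cong (ι-* c d) (trans (reflexive (≡.cong (λ F → F s) (downward-snoc (const 1#) bs k i))) (Λ^-pow i _ s)))
                (trans (evaluate-snoc c k i xs s) (*-congˡ (Λ^-pow i _ s))) ⟩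
    ι c * ι d * (pow (L s) i * conv (φ k) F s) + ι c * (pow (L s) i * conv (φ k) (evaluate xs) s)
      ≈⟨ solve 5 (λ c d p f e → c :* d :* (p :* f) :+ c :* (p :* e) := c :* (p :* (d :* f :+ e))) refl _ _ _ _ _ ⟩
    ι c * (pow (L s) i * (ι d * conv (φ k) F s + conv (φ k) (evaluate xs) s))
      ≈⟨ *-congˡ (*-congˡ (+-congʳ (scaleʳ s))) ⟨
    ι c * (pow (L s) i * (conv (φ k) (λ s → ι d * F s) s + conv (φ k) (evaluate xs) s))
      ≈⟨ *-congˡ (trans (Λ^-pow i _ s) (*-congˡ (conv-distribˡ (φ k) _ _ s))) ⟨
    ι c * Λ^ i (conv (φ k) (evaluate ((d , bs) ∷ xs))) s ∎
    where
    F = downward (const 1#) bs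
    scaleʳ : ∀ s → conv (φ k) (λ s → ι d * F s) s ≈ ι d * conv (φ k) F s
    scaleʳ s = trans (conv-comm (φ k) _ s) (trans (conv-scaleˡ (ι d) F (φ k) s) (*-congˡ (conv-comm F (φ k) s)))

  evaluate-scale : ∀ c xs s → evaluate (map (λ (d , bs) → c ℚ.* d , bs) xs) s ≈ ι c * evaluate xs s
  evaluate-scale c []              s = sym (zeroʳ _)
  evaluate-scale c ((d , bs) ∷ xs) s = trans (+-cong (trans (*-congʳ (ι-* c d)) (*-assoc _ _ _)) (evaluate-scale c xs s))
      (sym (distribˡ _ _ _))

  G-expansion : ∀ w s → G w s ≈ evaluate (expansion w) s
  G′-expansion : ∀ i k w s → G′ i k w s ≈ evaluate (expansion′ i k w) s
  G-expansion []      s = sym (trans (+-identityʳ _) (trans (*-congʳ ι-1) (*-identityˡ _)))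
  G-expansion (k ∷ w) s = G′-expansion 1 k w s
  G′-expansion i k []      s = trans (conv-constˡ _ _ s) (sym (+-identityʳ _))
  G′-expansion i k (l ∷ w) s = begin
    conv (const (ι (1/ i !))) (Λ^ i (conv (φ k) (G (l ∷ w)))) s + conv (const (ι (0ℚ ^[ pred k ]))) (G′ (suc i) l w) s
      ≈⟨ +-cong (trans (conv-constˡ _ _ s) (*-congˡ (trans (Λ^-pow i _ s)
          (trans (*-congˡ (conv-cong (λ _ → refl) (G-expansion (l ∷ w)) s)) (sym (Λ^-pow i _ s))))))
                (trans (conv-constˡ _ (G′ (suc i) l w) s) (*-congˡ (G′-expansion (suc i) l w s))) ⟩
    ι (1/ i !) * Λ^ i (conv (φ k) (evaluate (expansion (l ∷ w)))) s + ι (0ℚ ^[ pred k ]) * evaluate (expansion′ (suc i) l w) s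
      ≈⟨ +-cong (evaluate-snoc (1/ i !) k i (expansion (l ∷ w)) s) (evaluate-scale (0ℚ ^[ pred k ]) (expansion′ (suc i) l w) s) ⟨
    evaluate (map _ (expansion (l ∷ w))) s + evaluate (map _ (expansion′ (suc i) l w)) s
      ≈⟨ sumL-++ (map _ (expansion (l ∷ w))) _ _ ⟨
    evaluate (expansion′ i k (l ∷ w)) s ∎

-- The model over ℚ[[q]]

geometricAtoms : Atoms qSeries
geometricAtoms = record
  { L = geometric
  ; D₀ = d
  ; L-* = Geometric.geometric-*
  ; D₀-cong = λ e n → ≡.cong (ℕ→ℚ n ℚ.*_) (e n)
  ; D₀-+ = Geometric.d-+
  ; D₀-* = PowerSeries.θ-derivation ℚ-algebra
  ; D₀-ι = Geometric.d-ι
  ; D₀-L = Geometric.d-geometric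
  }

-- Series in t over ℚ[[q]]; the coefficient of tˢ collects the tuples whose largest entry is s.
𝒜 : ℚ-Algebra
𝒜 = PowerSeries.algebra qSeries

S : RotaBaxterData 𝒜
S = NestedSums.rotaBaxterData qSeries geometricAtoms

-- gˢʰ as the value of G at t = 1

module ShuffleSeries where
  open ≡ using (refl; sym; trans; cong; cong₂; subst)
  open import Data.Rational.Base using (_+_; _*_; _-_; -_)
  open Defs
  open Exponentials using (𝔼; ∑-range₀-∸)
  open LowerEntries
  open NestedRanges qSeries geometricAtoms
  open PowerSeries ℚ-algebra using (conv; const; conv-constˡ; conv-cong; antidiag-cong; antidiag-zero)
  open Sums ℚ-algebra using (sumTo; sumTo-cong; sumTo-+; sumTo-scale; sumTo-extend)
  open TotalSum ℚ-algebra using (total; Supported; total-*)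
  private
    module 𝒜 = ℚ-Algebra 𝒜
    module ℛ = ℚ-Algebra qSeries
    module Sumsℛ = Sums qSeries
  open Stuffle 𝒜 S using (G; G′; Λ^)
  open ℚ-Algebra.Solver ℚ-algebra using (solve; _:=_; _:+_; _:*_; _:-_; :-_; con)

  *q-conv : ∀ f g → f *q g ≗ conv f g
  *q-conv f g n = ∑-range₀-∸ n (λ i j → f i * g j)

  ^q-pow : ∀ f i → f ^q i ≗ pow f i
  ^q-pow f zero    zero    = refl
  ^q-pow f zero    (suc n) = refl
  ^q-pow f (suc i) n       = trans (*q-conv f (f ^q i) n) (conv-cong {f} {f} (λ _ → refl) (^q-pow f i) n)

  monomial-geometric : ∀ {m} (is δs : Vec ℕ m) →
    Vec.foldr′ _*q_ 1q (Vec.zipWith (λ δ i → geometric δ ^q i) δs is) ≗ monomial is δs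
  monomial-geometric []       []       zero    = refl
  monomial-geometric []       []       (suc n) = refl
  monomial-geometric (i ∷ is) (δ ∷ δs) n       =
    trans (*q-conv (geometric δ ^q i) _ n) (conv-cong (^q-pow (geometric δ) i) (monomial-geometric is δs) n)

  sumTo-eval : ∀ (F : ℕ → ℕ → ℚ) N n → Sumsℛ.sumTo F N n ≡ sumTo (λ s → F s n) N
  sumTo-eval F zero    n = refl
  sumTo-eval F (suc N) n = cong (_+ F (suc N) n) (sumTo-eval F N n)

  block-sum : Blocks → ℕ → ℚ
  block-sum bs N = sumTo (λ s → downward (PowerSeries.const qSeries (const 1ℚ)) bs s N) N

  ∑-cong : ∀ {A : Set} (xs : List A) {f g : A → ℚ} → (∀ x → f x ≡ g x) → ∑ xs f ≡ ∑ xs g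
  ∑-cong []       p = refl
  ∑-cong (x ∷ xs) p = cong₂ _+_ (p x) (∑-cong xs p)

  ∑-eval : ∀ {A : Set} ζ (w : A → ℚ) (f : A → ℕ → ℚ) (xs : List A) N →
    ∑ xs (λ x → ζ * w x * f x N) ≡ ζ * sumL xs (λ x → conv (const (w x)) (f x)) N
  ∑-eval ζ w f []       N = sym (ℚₚ.*-zeroʳ ζ)
  ∑-eval ζ w f (x ∷ xs) N = trans
    (cong₂ _+_ (trans (ℚₚ.*-assoc ζ (w x) (f x N)) (cong (ζ *_) (sym (conv-constˡ (w x) (f x) N)))) (∑-eval ζ w f xs N))
    (sym (ℚₚ.*-distribˡ-+ ζ (conv (const (w x)) (f x) N) (sumL xs (λ x → conv (const (w x)) (f x)) N)))

  -- A block contributes the gap of its last letter only. The variables of its other letters have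
  -- coefficient 0, and their divided powers 0^(k-1)/(k-1)!, which vanish unless the letter is 1,
  -- are collected in `ζ`.
  H-block-sum : ∀ {r m} (α : Vec ℕ r) (is ks : Vec ℕ m) ζ → Composition r is →
    (∀ δs → 𝔼 (gaps r 0ℚ is δs) α ≡ ζ * weight 0ℚ ks δs) →
    ∀ N → H is (lowerEntries r is) α N ≡ ζ * block-sum (Vec.toList (Vec.zip ks is)) N
  H-block-sum {r} {m} α is ks ζ v p N = trans
    (∑-cong (increasing m 0 N) (λ δs → cong₂ _*_ (trans (product-gaps v δs α) (p δs)) (monomial-geometric is δs N)))
    (trans (∑-eval ζ (weight 0ℚ ks) (monomial is) (increasing m 0 N) N)
    (cong (ζ *_) (trans (sum-increasing N 0 ks is N) (trans (upward-0 N ks is N) (sumTo-eval _ N N)))))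

  total-G : ∀ w N → total (G w) N ≡ ∑ (expansion w) (λ (c , bs) → c * block-sum bs N)
  total-G w N = trans (sumTo-cong N (λ s _ → G-expansion w s N)) (go (expansion w))
    where
    go : ∀ xs → sumTo (λ s → evaluate xs s N) N ≡ ∑ xs (λ (c , bs) → c * block-sum bs N)
    go []              = trans (sumTo-cong N (λ s _ → sym (ℚₚ.*-zeroˡ 0ℚ)))
        (trans (sumTo-scale 0ℚ (λ _ → 0ℚ) N) (ℚₚ.*-zeroˡ (sumTo (λ _ → 0ℚ) N)))
    go ((c , bs) ∷ xs) = trans (sumTo-+ (λ s → conv (const c) (downward _ bs s) N) (λ s → evaluate xs s N) N)
      (cong₂ _+_ (trans (sumTo-cong N (λ s _ → conv-constˡ c (downward _ bs s) N)) (sumTo-scale c (λ s → downward _ bs s N) N)) (go xs))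

  inv : ∀ {n} → ℕ → ℚ-Algebra.Solver.Polynomial ℚ-algebra n
  inv i = con (1/ i !)

  infixr 5 _⊹_
  infixr 6 _·_
  _⊹_ : ∀ {x x′ y y′ : ℚ} → x ≡ x′ → y ≡ y′ → x + y ≡ x′ + y′
  p ⊹ q = cong₂ _+_ p q

  _·_ : ∀ c {x x′ : ℚ} → x ≡ x′ → c * x ≡ c * x′
  c · p = cong (c *_) p

  ζ : ℕ → ℚ
  ζ k = 0ℚ ^[ pred k ]

  1≤suc : ∀ {i} → 1 ≤ suc i
  1≤suc = s≤s z≤n

  -- In each depth both sides run over all ways to cut the word into blocks, `generating` by the
  -- number of blocks and `expansion` by its recursion. `H-block-sum` evaluates every composition,
  -- and the solver matches the coefficients.
  gˢʰ-total-1 : ∀ k1 N → gˢʰ (k1 ∷ []) N ≡ total (G (k1 ∷ [])) N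
  gˢʰ-total-1 k1 N =
    trans (
      ((1/ 1 ! * 1ℚ) · h1 ⊹ refl) ⊹ refl)
    (trans (solve 1 (λ b1 →
        ((inv 1 :* con 1ℚ) :* (con 1ℚ :* b1) :+ con 0ℚ) :+ con 0ℚ
        := inv 1 :* b1 :+ con 0ℚ) refl
        (block-sum ((k1 , 1) ∷ []) N))
    (sym (total-G (k1 ∷ []) N)))
    where
    α : Vec ℕ 1
    α = pred k1 ∷ []
    h1 = H-block-sum α (1 ∷ []) (k1 ∷ []) 1ℚ (1≤suc ∷ [])
      (λ { (δ1 ∷ []) → solve 1 (λ x1 → (x1 :* con 1ℚ) := con 1ℚ :* (x1 :* con 1ℚ)) refl
          ((ℕ→ℚ δ1 - 0ℚ) ^[ pred k1 ]) }) N

  gˢʰ-total-2 : ∀ k1 k2 N → gˢʰ (k1 ∷ k2 ∷ []) N ≡ total (G (k1 ∷ k2 ∷ [])) N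
  gˢʰ-total-2 k1 k2 N =
    trans (
      ((1/ 2 ! * 1ℚ) · h1 ⊹ refl) ⊹
      ((1/ 1 ! * (1/ 1 ! * 1ℚ)) · h2 ⊹ refl) ⊹ refl)
    (trans (solve 3 (λ z1 b1 b2 →
        ((inv 2 :* con 1ℚ) :* ((z1 :* con 1ℚ) :* b1) :+ con 0ℚ) :+ (
        ((inv 1 :* (inv 1 :* con 1ℚ)) :* (con 1ℚ :* b2) :+ con 0ℚ) :+ con 0ℚ)
        := (inv 1 :* inv 1) :* b2 :+ (
           (z1 :* inv 2) :* b1 :+ con 0ℚ)) refl
        (ζ k1)
        (block-sum ((k2 , 2) ∷ []) N)
        (block-sum ((k2 , 1) ∷ (k1 , 1) ∷ []) N))
    (sym (total-G (k1 ∷ k2 ∷ []) N)))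
    where
    α : Vec ℕ 2
    α = pred k1 ∷ pred k2 ∷ []
    h1 = H-block-sum α (2 ∷ []) (k2 ∷ []) (ζ k1 * 1ℚ) (1≤suc ∷ [])
      (λ { (δ1 ∷ []) → solve 2 (λ x1 x2 → (x1 :* (x2 :* con 1ℚ)) := (x1 :* con 1ℚ) :* (x2 :* con 1ℚ)) refl
          (0ℚ ^[ pred k1 ]) ((ℕ→ℚ δ1 - 0ℚ) ^[ pred k2 ]) }) N
    h2 = H-block-sum α (1 ∷ 1 ∷ []) (k2 ∷ k1 ∷ []) 1ℚ (1≤suc ∷ 1≤suc ∷ [])
      (λ { (δ1 ∷ δ2 ∷ []) → solve 2 (λ x1 x2 → (x1 :* (x2 :* con 1ℚ)) := con 1ℚ :* (x2 :* (x1 :* con 1ℚ))) refl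
          ((ℕ→ℚ δ2 - ℕ→ℚ δ1) ^[ pred k1 ]) ((ℕ→ℚ δ1 - 0ℚ) ^[ pred k2 ]) }) N

  gˢʰ-total-3 : ∀ k1 k2 k3 N → gˢʰ (k1 ∷ k2 ∷ k3 ∷ []) N ≡ total (G (k1 ∷ k2 ∷ k3 ∷ [])) N
  gˢʰ-total-3 k1 k2 k3 N =
    trans (
      ((1/ 3 ! * 1ℚ) · h1 ⊹ refl) ⊹
      ((1/ 1 ! * (1/ 2 ! * 1ℚ)) · h2 ⊹ (1/ 2 ! * (1/ 1 ! * 1ℚ)) · h3 ⊹ refl) ⊹
      ((1/ 1 ! * (1/ 1 ! * (1/ 1 ! * 1ℚ))) · h4 ⊹ refl) ⊹ refl)
    (trans (solve 6 (λ z1 z2 b1 b2 b3 b4 →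
        ((inv 3 :* con 1ℚ) :* ((z1 :* (z2 :* con 1ℚ)) :* b1) :+ con 0ℚ) :+ (
        ((inv 1 :* (inv 2 :* con 1ℚ)) :* ((z1 :* con 1ℚ) :* b2) :+ ((inv 2 :* (inv 1 :* con 1ℚ)) :* ((z2 :* con 1ℚ) :* b3) :+ con 0ℚ)) :+ (
        ((inv 1 :* (inv 1 :* (inv 1 :* con 1ℚ))) :* (con 1ℚ :* b4) :+ con 0ℚ) :+ con 0ℚ))
        := (inv 1 :* (inv 1 :* inv 1)) :* b4 :+ (
           (inv 1 :* (z2 :* inv 2)) :* b3 :+ (
           (z1 :* (inv 2 :* inv 1)) :* b2 :+ (
           (z1 :* (z2 :* inv 3)) :* b1 :+ con 0ℚ)))) refl
        (ζ k1) (ζ k2)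
        (block-sum ((k3 , 3) ∷ []) N)
        (block-sum ((k3 , 1) ∷ (k2 , 2) ∷ []) N)
        (block-sum ((k3 , 2) ∷ (k1 , 1) ∷ []) N)
        (block-sum ((k3 , 1) ∷ (k2 , 1) ∷ (k1 , 1) ∷ []) N))
    (sym (total-G (k1 ∷ k2 ∷ k3 ∷ []) N)))
    where
    α : Vec ℕ 3
    α = pred k1 ∷ pred k2 ∷ pred k3 ∷ []
    h1 = H-block-sum α (3 ∷ []) (k3 ∷ []) (ζ k1 * (ζ k2 * 1ℚ)) (1≤suc ∷ [])
      (λ { (δ1 ∷ []) → solve 3 (λ x1 x2 x3 → (x1 :* (x2 :* (x3 :* con 1ℚ))) := (x1 :* (x2 :* con 1ℚ)) :* (x3 :* con 1ℚ)) refl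
          (0ℚ ^[ pred k1 ]) (0ℚ ^[ pred k2 ]) ((ℕ→ℚ δ1 - 0ℚ) ^[ pred k3 ]) }) N
    h2 = H-block-sum α (1 ∷ 2 ∷ []) (k3 ∷ k2 ∷ []) (ζ k1 * 1ℚ) (1≤suc ∷ 1≤suc ∷ [])
      (λ { (δ1 ∷ δ2 ∷ []) → solve 3 (λ x1 x2 x3 → (x1 :* (x2 :* (x3 :* con 1ℚ))) := (x1 :* con 1ℚ) :* (x3 :* (x2 :* con 1ℚ))) refl
          (0ℚ ^[ pred k1 ]) ((ℕ→ℚ δ2 - ℕ→ℚ δ1) ^[ pred k2 ]) ((ℕ→ℚ δ1 - 0ℚ) ^[ pred k3 ]) }) N
    h3 = H-block-sum α (2 ∷ 1 ∷ []) (k3 ∷ k1 ∷ []) (ζ k2 * 1ℚ) (1≤suc ∷ 1≤suc ∷ [])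
      (λ { (δ1 ∷ δ2 ∷ []) → solve 3 (λ x1 x2 x3 → (x1 :* (x2 :* (x3 :* con 1ℚ))) := (x2 :* con 1ℚ) :* (x3 :* (x1 :* con 1ℚ))) refl
          ((ℕ→ℚ δ2 - ℕ→ℚ δ1) ^[ pred k1 ]) (0ℚ ^[ pred k2 ]) ((ℕ→ℚ δ1 - 0ℚ) ^[ pred k3 ]) }) N
    h4 = H-block-sum α (1 ∷ 1 ∷ 1 ∷ []) (k3 ∷ k2 ∷ k1 ∷ []) 1ℚ (1≤suc ∷ 1≤suc ∷ 1≤suc ∷ [])
      (λ { (δ1 ∷ δ2 ∷ δ3 ∷ []) → solve 3 (λ x1 x2 x3 → (x1 :* (x2 :* (x3 :* con 1ℚ))) := con 1ℚ :* (x3 :* (x2 :* (x1 :* con 1ℚ)))) refl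
          ((ℕ→ℚ δ3 - ℕ→ℚ δ2) ^[ pred k1 ]) ((ℕ→ℚ δ2 - ℕ→ℚ δ1) ^[ pred k2 ]) ((ℕ→ℚ δ1 - 0ℚ) ^[ pred k3 ]) }) N

  gˢʰ-total-4 : ∀ k1 k2 k3 k4 N → gˢʰ (k1 ∷ k2 ∷ k3 ∷ k4 ∷ []) N ≡ total (G (k1 ∷ k2 ∷ k3 ∷ k4 ∷ [])) N
  gˢʰ-total-4 k1 k2 k3 k4 N =
    trans (
      ((1/ 4 ! * 1ℚ) · h1 ⊹ refl) ⊹
      ((1/ 1 ! * (1/ 3 ! * 1ℚ)) · h2 ⊹ (1/ 2 ! * (1/ 2 ! * 1ℚ)) · h3 ⊹ (1/ 3 ! * (1/ 1 ! * 1ℚ)) · h4 ⊹ refl) ⊹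
      ((1/ 1 ! * (1/ 1 ! * (1/ 2 ! * 1ℚ))) · h5 ⊹ (1/ 1 ! * (1/ 2 ! * (1/ 1 ! * 1ℚ))) · h6 ⊹ (1/ 2 ! * (1/ 1 ! * (1/ 1 ! * 1ℚ))) · h7 ⊹
          refl) ⊹
      ((1/ 1 ! * (1/ 1 ! * (1/ 1 ! * (1/ 1 ! * 1ℚ)))) · h8 ⊹ refl) ⊹ refl)
    (trans (solve 11 (λ z1 z2 z3 b1 b2 b3 b4 b5 b6 b7 b8 →
        ((inv 4 :* con 1ℚ) :* ((z1 :* (z2 :* (z3 :* con 1ℚ))) :* b1) :+ con 0ℚ) :+ (
        ((inv 1 :* (inv 3 :* con 1ℚ)) :* ((z1 :* (z2 :* con 1ℚ)) :* b2) :+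
            ((inv 2 :* (inv 2 :* con 1ℚ)) :* ((z1 :* (z3 :* con 1ℚ)) :* b3) :+
                ((inv 3 :* (inv 1 :* con 1ℚ)) :* ((z2 :* (z3 :* con 1ℚ)) :* b4) :+ con 0ℚ))) :+ (
        ((inv 1 :* (inv 1 :* (inv 2 :* con 1ℚ))) :* ((z1 :* con 1ℚ) :* b5) :+
            ((inv 1 :* (inv 2 :* (inv 1 :* con 1ℚ))) :* ((z2 :* con 1ℚ) :* b6) :+
                ((inv 2 :* (inv 1 :* (inv 1 :* con 1ℚ))) :* ((z3 :* con 1ℚ) :* b7) :+ con 0ℚ))) :+ (
        ((inv 1 :* (inv 1 :* (inv 1 :* (inv 1 :* con 1ℚ)))) :* (con 1ℚ :* b8) :+ con 0ℚ) :+ con 0ℚ)))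
        := (inv 1 :* (inv 1 :* (inv 1 :* inv 1))) :* b8 :+ (
           (inv 1 :* (inv 1 :* (z3 :* inv 2))) :* b7 :+ (
           (inv 1 :* (z2 :* (inv 2 :* inv 1))) :* b6 :+ (
           (inv 1 :* (z2 :* (z3 :* inv 3))) :* b4 :+ (
           (z1 :* (inv 2 :* (inv 1 :* inv 1))) :* b5 :+ (
           (z1 :* (inv 2 :* (z3 :* inv 2))) :* b3 :+ (
           (z1 :* (z2 :* (inv 3 :* inv 1))) :* b2 :+ (
           (z1 :* (z2 :* (z3 :* inv 4))) :* b1 :+ con 0ℚ)))))))) refl
        (ζ k1) (ζ k2) (ζ k3)
        (block-sum ((k4 , 4) ∷ []) N)
        (block-sum ((k4 , 1) ∷ (k3 , 3) ∷ []) N)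
        (block-sum ((k4 , 2) ∷ (k2 , 2) ∷ []) N)
        (block-sum ((k4 , 3) ∷ (k1 , 1) ∷ []) N)
        (block-sum ((k4 , 1) ∷ (k3 , 1) ∷ (k2 , 2) ∷ []) N)
        (block-sum ((k4 , 1) ∷ (k3 , 2) ∷ (k1 , 1) ∷ []) N)
        (block-sum ((k4 , 2) ∷ (k2 , 1) ∷ (k1 , 1) ∷ []) N)
        (block-sum ((k4 , 1) ∷ (k3 , 1) ∷ (k2 , 1) ∷ (k1 , 1) ∷ []) N))
    (sym (total-G (k1 ∷ k2 ∷ k3 ∷ k4 ∷ []) N)))
    where
    α : Vec ℕ 4
    α = pred k1 ∷ pred k2 ∷ pred k3 ∷ pred k4 ∷ []
    h1 = H-block-sum α (4 ∷ []) (k4 ∷ []) (ζ k1 * (ζ k2 * (ζ k3 * 1ℚ))) (1≤suc ∷ [])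
      (λ { (δ1 ∷ []) → solve 4 (λ x1 x2 x3 x4 → (x1 :* (x2 :* (x3 :* (x4 :* con 1ℚ)))) := (x1 :* (x2 :* (x3 :* con 1ℚ))) :*
          (x4 :* con 1ℚ)) refl
          (0ℚ ^[ pred k1 ]) (0ℚ ^[ pred k2 ]) (0ℚ ^[ pred k3 ]) ((ℕ→ℚ δ1 - 0ℚ) ^[ pred k4 ]) }) N
    h2 = H-block-sum α (1 ∷ 3 ∷ []) (k4 ∷ k3 ∷ []) (ζ k1 * (ζ k2 * 1ℚ)) (1≤suc ∷ 1≤suc ∷ [])
      (λ { (δ1 ∷ δ2 ∷ []) → solve 4 (λ x1 x2 x3 x4 → (x1 :* (x2 :* (x3 :* (x4 :* con 1ℚ)))) := (x1 :* (x2 :* con 1ℚ)) :*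
          (x4 :* (x3 :* con 1ℚ))) refl
          (0ℚ ^[ pred k1 ]) (0ℚ ^[ pred k2 ]) ((ℕ→ℚ δ2 - ℕ→ℚ δ1) ^[ pred k3 ]) ((ℕ→ℚ δ1 - 0ℚ) ^[ pred k4 ]) }) N
    h3 = H-block-sum α (2 ∷ 2 ∷ []) (k4 ∷ k2 ∷ []) (ζ k1 * (ζ k3 * 1ℚ)) (1≤suc ∷ 1≤suc ∷ [])
      (λ { (δ1 ∷ δ2 ∷ []) → solve 4 (λ x1 x2 x3 x4 → (x1 :* (x2 :* (x3 :* (x4 :* con 1ℚ)))) := (x1 :* (x3 :* con 1ℚ)) :*
          (x4 :* (x2 :* con 1ℚ))) refl
          (0ℚ ^[ pred k1 ]) ((ℕ→ℚ δ2 - ℕ→ℚ δ1) ^[ pred k2 ]) (0ℚ ^[ pred k3 ]) ((ℕ→ℚ δ1 - 0ℚ) ^[ pred k4 ]) }) N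
    h4 = H-block-sum α (3 ∷ 1 ∷ []) (k4 ∷ k1 ∷ []) (ζ k2 * (ζ k3 * 1ℚ)) (1≤suc ∷ 1≤suc ∷ [])
      (λ { (δ1 ∷ δ2 ∷ []) → solve 4 (λ x1 x2 x3 x4 → (x1 :* (x2 :* (x3 :* (x4 :* con 1ℚ)))) := (x2 :* (x3 :* con 1ℚ)) :*
          (x4 :* (x1 :* con 1ℚ))) refl
          ((ℕ→ℚ δ2 - ℕ→ℚ δ1) ^[ pred k1 ]) (0ℚ ^[ pred k2 ]) (0ℚ ^[ pred k3 ]) ((ℕ→ℚ δ1 - 0ℚ) ^[ pred k4 ]) }) N
    h5 = H-block-sum α (1 ∷ 1 ∷ 2 ∷ []) (k4 ∷ k3 ∷ k2 ∷ []) (ζ k1 * 1ℚ) (1≤suc ∷ 1≤suc ∷ 1≤suc ∷ [])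
      (λ { (δ1 ∷ δ2 ∷ δ3 ∷ []) → solve 4 (λ x1 x2 x3 x4 → (x1 :* (x2 :* (x3 :* (x4 :* con 1ℚ)))) := (x1 :* con 1ℚ) :*
          (x4 :* (x3 :* (x2 :* con 1ℚ)))) refl
          (0ℚ ^[ pred k1 ]) ((ℕ→ℚ δ3 - ℕ→ℚ δ2) ^[ pred k2 ]) ((ℕ→ℚ δ2 - ℕ→ℚ δ1) ^[ pred k3 ]) ((ℕ→ℚ δ1 - 0ℚ) ^[ pred k4 ]) }) N
    h6 = H-block-sum α (1 ∷ 2 ∷ 1 ∷ []) (k4 ∷ k3 ∷ k1 ∷ []) (ζ k2 * 1ℚ) (1≤suc ∷ 1≤suc ∷ 1≤suc ∷ [])
      (λ { (δ1 ∷ δ2 ∷ δ3 ∷ []) → solve 4 (λ x1 x2 x3 x4 → (x1 :* (x2 :* (x3 :* (x4 :* con 1ℚ)))) := (x2 :* con 1ℚ) :*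
          (x4 :* (x3 :* (x1 :* con 1ℚ)))) refl
          ((ℕ→ℚ δ3 - ℕ→ℚ δ2) ^[ pred k1 ]) (0ℚ ^[ pred k2 ]) ((ℕ→ℚ δ2 - ℕ→ℚ δ1) ^[ pred k3 ]) ((ℕ→ℚ δ1 - 0ℚ) ^[ pred k4 ]) }) N
    h7 = H-block-sum α (2 ∷ 1 ∷ 1 ∷ []) (k4 ∷ k2 ∷ k1 ∷ []) (ζ k3 * 1ℚ) (1≤suc ∷ 1≤suc ∷ 1≤suc ∷ [])
      (λ { (δ1 ∷ δ2 ∷ δ3 ∷ []) → solve 4 (λ x1 x2 x3 x4 → (x1 :* (x2 :* (x3 :* (x4 :* con 1ℚ)))) := (x3 :* con 1ℚ) :*
          (x4 :* (x2 :* (x1 :* con 1ℚ)))) refl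
          ((ℕ→ℚ δ3 - ℕ→ℚ δ2) ^[ pred k1 ]) ((ℕ→ℚ δ2 - ℕ→ℚ δ1) ^[ pred k2 ]) (0ℚ ^[ pred k3 ]) ((ℕ→ℚ δ1 - 0ℚ) ^[ pred k4 ]) }) N
    h8 = H-block-sum α (1 ∷ 1 ∷ 1 ∷ 1 ∷ []) (k4 ∷ k3 ∷ k2 ∷ k1 ∷ []) 1ℚ (1≤suc ∷ 1≤suc ∷ 1≤suc ∷ 1≤suc ∷ [])
      (λ { (δ1 ∷ δ2 ∷ δ3 ∷ δ4 ∷ []) → solve 4 (λ x1 x2 x3 x4 → (x1 :* (x2 :* (x3 :* (x4 :* con 1ℚ)))) := con 1ℚ :*
          (x4 :* (x3 :* (x2 :* (x1 :* con 1ℚ))))) refl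
          ((ℕ→ℚ δ4 - ℕ→ℚ δ3) ^[ pred k1 ]) ((ℕ→ℚ δ3 - ℕ→ℚ δ2) ^[ pred k2 ]) ((ℕ→ℚ δ2 - ℕ→ℚ δ1) ^[ pred k3 ])
              ((ℕ→ℚ δ1 - 0ℚ) ^[ pred k4 ]) }) N

  -- The bound 4 is the largest total length of two words to which ds is applied in (ii).
  gˢʰ-total : ∀ w → length w ≤ 4 → ∀ N → gˢʰ w N ≡ total (G w) N
  gˢʰ-total []                       _ N = sym (trans (sumTo-extend (λ s → PowerSeries.const qSeries (const 1ℚ) s N) {0} {N} z≤n
      (λ { (suc s) _ → refl })) (one N))
    where
    one : ∀ N → const 1ℚ N ≡ 1q N
    one zero    = refl
    one (suc N) = refl
  gˢʰ-total (k ∷ [])                 _ N = gˢʰ-total-1 k N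
  gˢʰ-total (k ∷ l ∷ [])             _ N = gˢʰ-total-2 k l N
  gˢʰ-total (k ∷ l ∷ m ∷ [])         _ N = gˢʰ-total-3 k l m N
  gˢʰ-total (k ∷ l ∷ m ∷ n ∷ [])     _ N = gˢʰ-total-4 k l m n N
  gˢʰ-total (_ ∷ _ ∷ _ ∷ _ ∷ _ ∷ _) (s≤s (s≤s (s≤s (s≤s ())))) N

  open Remainder 𝒜 S using (Ĝ; R)
  open RotaBaxterData S using (φ)
  open PathOrdered qSeries geometricAtoms using (Φ; Φ-character; Φ-encode)
  open ShuffleCharacter qSeries using (extend; extend-⧢ʷ)

  total-cong : ∀ {F F′} → F 𝒜.≈ F′ → total F ≗ total F′
  total-cong p n = sumTo-cong n (λ s _ → p s n)

  total-+ : ∀ F F′ n → total (F 𝒜.+ F′) n ≡ total F n + total F′ n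
  total-+ F F′ n = sumTo-+ (λ s → F s n) (λ s → F′ s n) n

  total-scale : ∀ c F n → total (𝒜.ι c 𝒜.* F) n ≡ c * total F n
  total-scale c F n = trans (sumTo-cong n (λ s _ → trans (PowerSeries.conv-constˡ qSeries (const c) F s n) (conv-constˡ c (F s) n)))
    (sumTo-scale c (λ s → F s n) n)

  total-0 : ∀ n → total 𝒜.0# n ≡ 0ℚ
  total-0 n = sumTo-extend (λ _ → 0ℚ) {0} {n} z≤n (λ _ _ → refl)

  total-neg : ∀ F n → total (𝒜.- F) n ≡ - total F n
  total-neg F n = trans (sumTo-cong n (λ s _ → neg (F s n)))
    (trans (sumTo-scale (- 1ℚ) (λ s → F s n) n) (sym (neg (total F n))))
    where
    neg : ∀ x → - x ≡ - 1ℚ * x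
    neg = solve 1 (λ x → :- x := con (- 1ℚ) :* x) refl

  total-− : ∀ F F′ n → total (F 𝒜.- F′) n ≡ total F n - total F′ n
  total-− F F′ n = trans (total-+ F (𝒜.- F′) n) (cong (total F n +_) (total-neg F′ n))

  𝔤ˢʰ-⊕ : ∀ u v n → 𝔤ˢʰ (u ⊕ v) n ≡ 𝔤ˢʰ u n + 𝔤ˢʰ v n
  𝔤ˢʰ-⊕ []            v n = sym (ℚₚ.+-identityˡ _)
  𝔤ˢʰ-⊕ ((c , w) ∷ u) v n = trans (cong (c * gˢʰ w n +_) (𝔤ˢʰ-⊕ u v n)) (sym (ℚₚ.+-assoc (c * gˢʰ w n) (𝔤ˢʰ u n) (𝔤ˢʰ v n)))

  𝔤ˢʰ-• : ∀ c u n → 𝔤ˢʰ (c • u) n ≡ c * 𝔤ˢʰ u n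
  𝔤ˢʰ-• c []            n = sym (ℚₚ.*-zeroʳ c)
  𝔤ˢʰ-• c ((b , w) ∷ u) n = trans (cong₂ _+_ (ℚₚ.*-assoc c b (gˢʰ w n)) (𝔤ˢʰ-• c u n)) (sym (ℚₚ.*-distribˡ-+ c (b * gˢʰ w n) (𝔤ˢʰ u n)))

  𝔤ˢʰ-⊖ : ∀ u v n → 𝔤ˢʰ (u ⊖ v) n ≡ 𝔤ˢʰ u n - 𝔤ˢʰ v n
  𝔤ˢʰ-⊖ u v n = trans (𝔤ˢʰ-⊕ u ((- 1ℚ) • v) n) (cong (𝔤ˢʰ u n +_) (trans (𝔤ˢʰ-• (- 1ℚ) v n)
    (solve 1 (λ x → con (- 1ℚ) :* x := :- x) refl (𝔤ˢʰ v n))))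

  bilinear-single : ∀ {A B C : Set} (f : A → B → Lin C) a b → bilinear f (single a) (single b) ≡ f a b
  bilinear-single f a b = trans (Listₚ.++-identityʳ _) (trans (•-1 _) (trans (Listₚ.++-identityʳ _) (•-1 (f a b))))
    where
    •-1 : ∀ {A : Set} (u : Lin A) → 1ℚ • u ≡ u
    •-1 []            = refl
    •-1 ((c , x) ∷ u) = cong₂ (λ d v → (d , x) ∷ v) (ℚₚ.*-identityˡ c) (•-1 u)

  total-Ĝ : ∀ u → All (λ (_ , w) → length w ≤ 4) u → ∀ n → 𝔤ˢʰ u n ≡ total (Ĝ u) n
  total-Ĝ []            []      n = sym (trans (total-cong 𝒜.ι-0 n) (total-0 n))
  total-Ĝ ((c , w) ∷ u) (p ∷ q) n = trans (cong₂ _+_ (trans (cong (c *_) (gˢʰ-total w p n)) (sym (total-scale c (G w) n))) (total-Ĝ u q n))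
    (sym (total-+ (𝒜.ι c 𝒜.* G w) (Ĝ u) n))

  ∗ʷ-length : ∀ v w → All (λ (_ , x) → length x ≤ length v ℕ.+ length w) (v ∗ʷ w)
  ∗ʷ-length []      w       = ≤-refl ∷ []
  ∗ʷ-length (k ∷ v) []      = m≤m+n _ 0 ∷ []
  ∗ʷ-length (k ∷ v) (l ∷ w) = Allₚ.++⁺ (Allₚ.++⁺ (Allₚ.map⁺ (All.map s≤s (∗ʷ-length v (l ∷ w))))
    (Allₚ.map⁺ (All.map (λ {x} p → subst (length (l ∷ proj₂ x) ≤_) (cong suc (sym (ℕₚ.+-suc (length v) (length w)))) (s≤s p))
        (∗ʷ-length (k ∷ v) w))))
    (Allₚ.map⁺ (All.map (λ p → s≤s (≤-trans p (+-monoʳ-≤ (length v) (ℕₚ.n≤1+n _)))) (∗ʷ-length v w)))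

  Λ-supported : ∀ (F : ℕ → ℕ → ℚ) → Supported (λ s → geometric s ℛ.* F s)
  Λ-supported F s {n} n<s = trans (antidiag-cong n (λ i j e → trans
      (cong (_* F s j) (Geometric.geometric-< s (ℕₚ.≤-<-trans (subst (i ≤_) e (m≤m+n i j)) n<s)))
      (ℚₚ.*-zeroˡ (F s j)))) (antidiag-zero n)

  scaled-supported : ∀ c F → Supported F → Supported (𝒜.ι c 𝒜.* F)
  scaled-supported c F p s {n} n<s = trans (PowerSeries.conv-constˡ qSeries (const c) F s n) (trans (conv-constˡ c (F s) n)
    (trans (cong (c *_) (p s n<s)) (ℚₚ.*-zeroʳ c)))

  G′-supported : ∀ i k w → Supported (G′ (suc i) k w)
  G′-supported i k []      = scaled-supported (1/ (suc i) !) (Λ^ (suc i) F) (Λ-supported (Λ^ i F))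
    where F = φ k 𝒜.* 𝒜.1#
  G′-supported i k (l ∷ w) s n<s = trans (cong₂ _+_
    (scaled-supported (1/ (suc i) !) (Λ^ (suc i) F) (Λ-supported (Λ^ i F)) s n<s)
    (scaled-supported (0ℚ ^[ pred k ]) (G′ (suc (suc i)) l w) (G′-supported (suc i) l w) s n<s)) (ℚₚ.+-identityˡ 0ℚ)
    where F = φ k 𝒜.* G (l ∷ w)

  -- A single N serves all degrees i ≤ N, as is required for the coefficient of q^N in a product:
  -- summation indices above i do not reach degree i.
  Φ-total : ∀ k w {N i} → i ≤ N → Φ N (encode (k ∷ w)) i ≡ total (G (k ∷ w)) i
  Φ-total k w {N} {i} i≤N = trans (Φ-encode N (k ∷ w) i) (trans (sumTo-eval (G (k ∷ w)) N i)
    (sumTo-extend (λ s → G (k ∷ w) s i) i≤N (λ s i<s → G′-supported 0 k w s i<s)))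

  Φ-total-N : ∀ w N → Φ N (encode w) N ≡ total (G w) N
  Φ-total-N w N = trans (Φ-encode N w N) (sumTo-eval (G w) N N)

  count₁ : List Letter → ℕ
  count₁ []       = 0
  count₁ (e₀ ∷ w) = count₁ w
  count₁ (e₁ ∷ w) = suc (count₁ w)

  length-decode : ∀ w → length (decode w) ≡ count₁ w
  length-decode []       = refl
  length-decode (e₀ ∷ w) = length-decode w
  length-decode (e₁ ∷ w) = cong suc (length-decode w)

  count₁-encode : ∀ w → count₁ (encode w) ≡ length w
  count₁-encode []      = refl
  count₁-encode (k ∷ w) = cong suc (go (pred k))
    where
    go : ∀ t → count₁ (replicate t e₀ ++ encode w) ≡ length w
    go zero    = count₁-encode w
    go (suc t) = go t

  encode-decode : ∀ w → replicate (leading₀ w) e₀ ++ encode (decode w) ≡ w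
  encode-decode []       = refl
  encode-decode (e₀ ∷ w) = cong (e₀ ∷_) (encode-decode w)
  encode-decode (e₁ ∷ w) = cong (e₁ ∷_) (encode-decode w)

  ⧢ʷ-count₁ : ∀ u v → All (λ (_ , x) → count₁ x ≡ count₁ u ℕ.+ count₁ v) (u ⧢ʷ v)
  ⧢ʷ-count₁ []      v       = refl ∷ []
  ⧢ʷ-count₁ (a ∷ u) []      = sym (ℕₚ.+-identityʳ _) ∷ []
  ⧢ʷ-count₁ (a ∷ u) (b ∷ v) = Allₚ.++⁺
    (Allₚ.map⁺ (All.map (λ {x} → left a (proj₂ x)) (⧢ʷ-count₁ u (b ∷ v))))
    (Allₚ.map⁺ (All.map (λ {x} → right b (proj₂ x)) (⧢ʷ-count₁ (a ∷ u) v)))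
    where
    left : ∀ a x → count₁ x ≡ count₁ u ℕ.+ count₁ (b ∷ v) → count₁ (a ∷ x) ≡ count₁ (a ∷ u) ℕ.+ count₁ (b ∷ v)
    left e₀ x p = p
    left e₁ x p = cong suc p
    right : ∀ b x → count₁ x ≡ count₁ (a ∷ u) ℕ.+ count₁ v → count₁ (b ∷ x) ≡ count₁ (a ∷ u) ℕ.+ count₁ (b ∷ v)
    right e₀ x p = p
    right e₁ x p = trans (cong suc p) (sym (ℕₚ.+-suc (count₁ (a ∷ u)) (count₁ v)))

  ⧢ʷ-leading₀ : ∀ k v l w → All (λ (_ , x) → leading₀ x ≡ 0) (encode (k ∷ v) ⧢ʷ encode (l ∷ w))
  ⧢ʷ-leading₀ k v l w = Allₚ.++⁺ (e₁-first (V ⧢ʷ encode (l ∷ w))) (e₁-first (encode (k ∷ v) ⧢ʷ W))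
    where
    V = replicate (pred k) e₀ ++ encode v
    W = replicate (pred l) e₀ ++ encode w
    e₁-first : ∀ u → All (λ (_ , x) → leading₀ x ≡ 0) (mapLin (e₁ ∷_) u)
    e₁-first []      = []
    e₁-first (_ ∷ u) = refl ∷ e₁-first u

  decode-total : ∀ (u : ℌ) → All (λ (_ , x) → leading₀ x ≡ 0 × count₁ x ≤ 4) u → ∀ N → 𝔤ˢʰ (mapLin decode u) N ≡ extend (Φ N) u N
  decode-total []            []              N = refl
  decode-total ((c , x) ∷ u) ((p , q) ∷ r)   N = cong₂ _+_
    (trans (cong (c *_) (trans (gˢʰ-total (decode x) (subst (_≤ 4) (sym (length-decode x)) q) N)
      (trans (sym (Φ-total-N (decode x) N)) (cong (λ y → Φ N y N) x≡))))
      (sym (conv-constˡ c (Φ N x) N)))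
    (decode-total u r N)
    where
    x≡ : encode (decode x) ≡ x
    x≡ = trans (cong (λ t → replicate t e₀ ++ encode (decode x)) (sym p)) (encode-decode x)

  𝔤ˢʰ-ds : ∀ k v l w → length (k ∷ v) ℕ.+ length (l ∷ w) ≤ 4 → ∀ N →
            𝔤ˢʰ (ds (e (k ∷ v)) (e (l ∷ w))) N ≡ total (R (k ∷ v) (l ∷ w)) N
  𝔤ˢʰ-ds k v l w len N = trans (𝔤ˢʰ-⊖ (e V ∗ e W) _ N) (trans (cong₂ _-_ stuffle shuffle′) (sym (total-− (Ĝ (V ∗ʷ W)) (G V 𝒜.* G W) N)))
    where
    V = k ∷ v
    W = l ∷ w
    stuffle : 𝔤ˢʰ (e V ∗ e W) N ≡ total (Ĝ (V ∗ʷ W)) N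
    stuffle = trans (cong (λ u → 𝔤ˢʰ u N) (bilinear-single _∗ʷ_ V W))
      (total-Ĝ (V ∗ʷ W) (All.map (λ p → ≤-trans p len) (∗ʷ-length V W)) N)
    words : All (λ (_ , x) → leading₀ x ≡ 0 × count₁ x ≤ 4) (encode V ⧢ʷ encode W)
    words = All.zipWith (λ {x} (p , q) → p , subst (_≤ 4) (sym (trans q (cong₂ ℕ._+_ (count₁-encode V) (count₁-encode W)))) len)
      (⧢ʷ-leading₀ k v l w , ⧢ʷ-count₁ (encode V) (encode W))
    shuffle′ : 𝔤ˢʰ (mapLin decode (mapLin encode (e V) ⧢ mapLin encode (e W))) N ≡ total (G V 𝒜.* G W) N
    shuffle′ = trans (cong (λ u → 𝔤ˢʰ (mapLin decode u) N) (bilinear-single _⧢ʷ_ (encode V) (encode W)))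
      (trans (decode-total (encode V ⧢ʷ encode W) words N)
      (trans (extend-⧢ʷ (Φ N) (encode V) (encode W) N)
      (trans (Φ-character N (encode V) (encode W) N)
      (trans (antidiag-cong N (λ i j p → cong₂ _*_ (Φ-total k v (subst (i ≤_) p (m≤m+n i j))) (Φ-total l w (subst (j ≤_) p (m≤n+m j i)))))
      (sym (total-* (G′-supported 0 k v) (G′-supported 0 l w) N))))))

  -- Membership in the space of weight at most n

  module Membership (n : ℕ) where
    Good : List ℕ → Set
    Good w = length w ≤ n × All (1 ≤_) w × sum w ≤ n

    AllGood : ℌ¹ → Set
    AllGood = All (λ (_ , w) → Good w)

    P : (ℕ → ℕ → ℚ) → Set
    P F = 𝒢ˢʰ≤ n (total F)

    P-0 : P 𝒜.0#
    P-0 = [] , [] , total-0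

    P-+ : ∀ c {F F′} → P F → P F′ → P (𝒜.ι c 𝒜.* F 𝒜.+ F′)
    P-+ c {F} {F′} (u , p , f) (v , q , g) = (c • u) ⊕ v , Allₚ.++⁺ (scale p) q , λ N →
      trans (total-+ (𝒜.ι c 𝒜.* F) F′ N) (trans (cong₂ _+_ (trans (total-scale c F N) (cong (c *_) (f N))) (g N))
      (sym (trans (𝔤ˢʰ-⊕ (c • u) v N) (cong (_+ 𝔤ˢʰ v N) (𝔤ˢʰ-• c u N)))))
      where
      scale : ∀ {u} → AllGood u → AllGood (c • u)
      scale []      = []
      scale (x ∷ p) = x ∷ scale p

    P-≈ : ∀ {F F′} → F 𝒜.≈ F′ → P F′ → P F
    P-≈ e (u , p , f) = u , p , λ N → trans (total-cong e N) (f N)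

    length≤sum : ∀ {w} → All (1 ≤_) w → length w ≤ sum w
    length≤sum []      = z≤n
    length≤sum (p ∷ q) = ℕₚ.+-mono-≤ p (length≤sum q)

    good : ∀ {w} → All (1 ≤_) w → sum w ≤ n → Good w
    good p s = ≤-trans (length≤sum p) s , p , s

    P-G : ∀ w → All (1 ≤_) w → length w ≤ 3 → sum w ≤ n → P (G w)
    P-G w p l s = e w , good p s ∷ [] , λ N → trans (sym (gˢʰ-total w (m≤n⇒m≤1+n l) N))
      (solve 1 (λ x → x := con 1ℚ :* x :+ con 0ℚ) refl (gˢʰ w N))

    leading₀+sum : ∀ w → leading₀ w ℕ.+ sum (decode w) ≤ length w
    leading₀+sum []       = z≤n
    leading₀+sum (e₀ ∷ w) = s≤s (leading₀+sum w)
    leading₀+sum (e₁ ∷ w) = s≤s (leading₀+sum w)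

    decode-positive : ∀ w → All (1 ≤_) (decode w)
    decode-positive []       = []
    decode-positive (e₀ ∷ w) = decode-positive w
    decode-positive (e₁ ∷ w) = s≤s z≤n ∷ decode-positive w

    ⧢ʷ-length : ∀ u v → All (λ (_ , x) → length x ≡ length u ℕ.+ length v) (u ⧢ʷ v)
    ⧢ʷ-length []      v       = refl ∷ []
    ⧢ʷ-length (a ∷ u) []      = sym (ℕₚ.+-identityʳ _) ∷ []
    ⧢ʷ-length (a ∷ u) (b ∷ v) = Allₚ.++⁺
      (prefix a (All.map (cong suc) (⧢ʷ-length u (b ∷ v))))
      (prefix b (All.map (λ p → trans (cong suc p) (sym (ℕₚ.+-suc (length (a ∷ u)) (length v)))) (⧢ʷ-length (a ∷ u) v)))
      where
      prefix : ∀ a {m x} → All (λ (_ , x) → suc (length x) ≡ m) x → All (λ (_ , x) → length x ≡ m) (mapLin (a ∷_) x)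
      prefix a []      = []
      prefix a (p ∷ q) = p ∷ prefix a q

    decode-good : ∀ (u : ℌ) → All (λ (_ , x) → length x ≤ n) u → AllGood ((- 1ℚ) • mapLin decode u)
    decode-good []            []      = []
    decode-good ((c , x) ∷ u) (p ∷ q) =
      good (decode-positive x) (≤-trans (ℕₚ.m+n≤o⇒n≤o (leading₀ x) (leading₀+sum x)) p) ∷ decode-good u q

    length-encode : ∀ {w} → All (1 ≤_) w → length (encode w) ≡ sum w
    length-encode []                    = refl
    length-encode {suc k ∷ w} (_ ∷ p) = cong suc (trans (Listₚ.length-++ (replicate k e₀))
        (cong₂ ℕ._+_ (Listₚ.length-replicate k) (length-encode p)))

    -- The witness is ds itself. The stuffle product preserves the weight, and so does the shuffle
    -- product, for which the weight is the length of the encoded word.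
    P-R : ∀ k m → 2 ≤ k → 2 ≤ m → k ℕ.+ m ℕ.+ 1 ≤ n → P (R (k ∷ []) (m ∷ 1 ∷ []))
    P-R k m pk pm s = ds (e V) (e W) , Allₚ.++⁺ stuffle shuffle′ , λ N → sym (𝔤ˢʰ-ds k [] m (1 ∷ []) (s≤s (s≤s (s≤s z≤n))) N)
      where
      V = k ∷ []
      W = m ∷ 1 ∷ []
      1≤k = <⇒≤ pk
      1≤m = <⇒≤ pm
      open ℕSolver using () renaming (solve to solveℕ; _:+_ to _⊞_; _:=_ to _⊜_; con to #)
      bound : ∀ {i} → k ℕ.+ m ℕ.+ 1 ≡ i → i ≤ n
      bound p = subst (_≤ n) p s
      stuffle : AllGood (e V ∗ e W)
      stuffle = subst AllGood (sym (bilinear-single _∗ʷ_ V W))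
        ( good (1≤k ∷ 1≤m ∷ 1≤suc ∷ []) (bound (solveℕ 2 (λ k m → k ⊞ m ⊞ # 1 ⊜ k ⊞ (m ⊞ # 1)) refl k m))
        ∷ good (1≤m ∷ 1≤k ∷ 1≤suc ∷ []) (bound (solveℕ 2 (λ k m → k ⊞ m ⊞ # 1 ⊜ m ⊞ (k ⊞ # 1)) refl k m))
        ∷ good (1≤m ∷ 1≤suc ∷ 1≤k ∷ []) (bound (solveℕ 2 (λ k m → k ⊞ m ⊞ # 1 ⊜ m ⊞ (# 1 ⊞ (k ⊞ # 0))) refl k m))
        ∷ good (1≤m ∷ ℕₚ.m≤n⇒m≤n+o 1 1≤k ∷ []) (bound (solveℕ 2 (λ k m → k ⊞ m ⊞ # 1 ⊜ m ⊞ (k ⊞ # 1 ⊞ # 0)) refl k m))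
        ∷ good (ℕₚ.m≤n⇒m≤n+o m 1≤k ∷ 1≤suc ∷ []) (bound (solveℕ 2 (λ k m → k ⊞ m ⊞ # 1 ⊜ k ⊞ m ⊞ # 1) refl k m))
        ∷ [])
      shuffle′ : AllGood ((- 1ℚ) • mapLin decode (mapLin encode (e V) ⧢ mapLin encode (e W)))
      shuffle′ = subst (λ u → AllGood ((- 1ℚ) • mapLin decode u)) (sym (bilinear-single _⧢ʷ_ (encode V) (encode W)))
        (decode-good (encode V ⧢ʷ encode W) (All.map (λ p → subst (_≤ n) (sym (trans p
          (cong₂ ℕ._+_ (length-encode (1≤k ∷ [])) (length-encode (1≤m ∷ 1≤suc ∷ [])))))
          (bound (solveℕ 2 (λ k m → k ⊞ m ⊞ # 1 ⊜ (k ⊞ # 0) ⊞ (m ⊞ # 1)) refl k m))) (⧢ʷ-length (encode V) (encode W))))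

    open Remainder.Modulo 𝒜 S P P-0 P-+ P-≈ n P-G P-R public using (depth₂; depth₃)

-- The congruences in depth 2 and 3

module Depths where
  open ≡ using (refl; sym; trans; cong; cong₂)
  open import Data.Nat.Base using (_+_; _*_)
  open Defs
  open ShuffleSeries
  private module 𝒜 = ℚ-Algebra 𝒜
  open Stuffle 𝒜 S using (G)
  open Remainder 𝒜 S using (R)
  open RotaBaxterData S using (D)
  open Sums ℚ-algebra using (sumTo-scale)
  open TotalSum ℚ-algebra using (total)

  infix 4 _∼_ _≏_

  -- A record and not a function type, so that `f` and `F` can be inferred when the two sides are
  -- matched term by term.
  record _∼_ (f : ℚ[[q]]) (F : ℕ → ℕ → ℚ) : Set where
    constructor at
    field value : ∀ N → f N ≡ total F N

  record _≏_ (u : ℌ¹) (F : ℕ → ℕ → ℚ) : Set where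
    constructor at
    field value : ∀ N → 𝔤ˢʰ u N ≡ total F N

  ∼-d : ∀ w → length w ≤ 4 → d (gˢʰ w) ∼ D (G w)
  ∼-d w p = at λ N → trans (cong (ℕ→ℚ N ℚ.*_) (gˢʰ-total w p N)) (sym (sumTo-scale (ℕ→ℚ N) (λ s → G w s N) N))

  ≏-ds : ∀ k v l w → length (k ∷ v) + length (l ∷ w) ≤ 4 → ds (e (k ∷ v)) (e (l ∷ w)) ≏ R (k ∷ v) (l ∷ w)
  ≏-ds k v l w p = at (𝔤ˢʰ-ds k v l w p)

  ≏-⊕ : ∀ {u v F F′} → u ≏ F → v ≏ F′ → u ⊕ v ≏ F 𝒜.+ F′
  ≏-⊕ {u} {v} {F} {F′} (at p) (at q) = at λ N → trans (𝔤ˢʰ-⊕ u v N) (trans (cong₂ ℚ._+_ (p N) (q N)) (sym (total-+ F F′ N)))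

  ≏-⊖ : ∀ {u v F F′} → u ≏ F → v ≏ F′ → u ⊖ v ≏ F 𝒜.- F′
  ≏-⊖ {u} {v} {F} {F′} (at p) (at q) = at λ N → trans (𝔤ˢʰ-⊖ u v N) (trans (cong₂ ℚ._-_ (p N) (q N)) (sym (total-− F F′ N)))

  ∼-𝔤ˢʰ : ∀ {u F} → u ≏ F → 𝔤ˢʰ u ∼ F
  ∼-𝔤ˢʰ (at p) = at p

  ∼-+ : ∀ {f g F F′} → f ∼ F → g ∼ F′ → f +q g ∼ F 𝒜.+ F′
  ∼-+ {F = F} {F′} (at p) (at q) = at λ N → trans (cong₂ ℚ._+_ (p N) (q N)) (sym (total-+ F F′ N))

  ∼-− : ∀ {f g F F′} → f ∼ F → g ∼ F′ → f -q g ∼ F 𝒜.- F′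
  ∼-− {F = F} {F′} (at p) (at q) = at λ N → trans (cong₂ ℚ._-_ (p N) (q N)) (sym (total-− F F′ N))

  ∼-2ν : ∀ k {f F} → f ∼ F → ℕ→ℚ (2 * k) •q f ∼ 𝒜.ι (ℕ→ℚ 2) 𝒜.* 𝒜.ν k 𝒜.* F
  ∼-2ν k {f} {F} (at p) = at λ N → begin
    ℕ→ℚ (2 * k) ℚ.* f N  ≡⟨ cong₂ ℚ._*_ (ℕ→ℚ-* 2 k) (p N) ⟩
    ℕ→ℚ 2 ℚ.* ℕ→ℚ k ℚ.* total F N  ≡⟨ ℚₚ.*-assoc (ℕ→ℚ 2) (ℕ→ℚ k) (total F N) ⟩
    ℕ→ℚ 2 ℚ.* (ℕ→ℚ k ℚ.* total F N)  ≡⟨ cong (ℕ→ℚ 2 ℚ.*_) (total-scale (ℕ→ℚ k) F N) ⟨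
    ℕ→ℚ 2 ℚ.* total (𝒜.ν k 𝒜.* F) N  ≡⟨ total-scale (ℕ→ℚ 2) (𝒜.ν k 𝒜.* F) N ⟨
    total (𝒜.ι (ℕ→ℚ 2) 𝒜.* (𝒜.ν k 𝒜.* F)) N  ≡⟨ total-cong (𝒜.*-assoc (𝒜.ι (ℕ→ℚ 2)) (𝒜.ν k) F) N ⟨
    total (𝒜.ι (ℕ→ℚ 2) 𝒜.* 𝒜.ν k 𝒜.* F) N  ∎
    where open ≡.≡-Reasoning

  𝒢ˢʰ-∼ : ∀ {n f F} → f ∼ F → 𝒢ˢʰ≤ n (total F) → 𝒢ˢʰ≤ n f
  𝒢ˢʰ-∼ (at p) (u , q , r) = u , q , λ N → trans (p N) (r N)

  3≤4 : 3 ≤ 4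
  3≤4 = ℕₚ.n≤1+n 3

  4≤4 : 4 ≤ 4
  4≤4 = ≤-refl

  -- The raised letters are separate parameters, so that the congruence proved with `suc k` can be
  -- transported to `k + 1`.
  Depth₂ : (k₁ k₂ k₁+1 k₂+1 : ℕ) → Set
  Depth₂ k₁ k₂ k₁+1 k₂+1 =
    d (gˢʰ (k₁ ∷ k₂ ∷ []))
      ≡ ℕ→ℚ (2 * k₁) •q
          (  𝔤ˢʰ (ds (e (1 ∷ [])) (e (k₁+1 ∷ k₂ ∷ [])))
          -q 𝔤ˢʰ (ds (e (k₂ ∷ [])) (e (k₁+1 ∷ 1 ∷ []))))
        +q ℕ→ℚ (2 * k₂) •q 𝔤ˢʰ (ds (e (1 ∷ [])) (e (k₁ ∷ k₂+1 ∷ [])))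
      mod 𝒢ˢʰ≤ (k₁ + k₂ + 1)

  depth₂ : ∀ a b → 2 ≤ a → 2 ≤ b → Depth₂ a b (suc a) (suc b)
  depth₂ a b p q = 𝒢ˢʰ-∼
    (∼-− (∼-d (a ∷ b ∷ []) (s≤s (s≤s z≤n)))
      (∼-+ (∼-2ν a (∼-− (∼-𝔤ˢʰ (≏-ds 1 [] (suc a) (b ∷ []) 3≤4)) (∼-𝔤ˢʰ (≏-ds b [] (suc a) (1 ∷ []) 3≤4))))
           (∼-2ν b (∼-𝔤ˢʰ (≏-ds 1 [] a (suc b ∷ []) 3≤4)))))
    (Membership.depth₂ (a + b + 1) a b p q ≤-refl)

  Depth₃ : (k₁ k₂ k₃ k₁+1 k₂+1 k₃+1 : ℕ) → Set
  Depth₃ k₁ k₂ k₃ k₁+1 k₂+1 k₃+1 =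
    d (gˢʰ (k₁ ∷ k₂ ∷ k₃ ∷ []))
      ≡ ℕ→ℚ (2 * k₁) •q 𝔤ˢʰ
          (  ds (e (1 ∷ [])) (e (k₁+1 ∷ k₂ ∷ k₃ ∷ []))
          ⊕  ds (e (k₃ ∷ [])) (e (k₂ ∷ k₁+1 ∷ 1 ∷ [])))
        +q ℕ→ℚ (2 * k₁) •q 𝔤ˢʰ
          (  ds (e (k₃ ∷ [])) (e (k₁+1 + k₂ ∷ 1 ∷ []))
          ⊖  ds (e (k₁+1 ∷ 1 ∷ [])) (e (k₂ ∷ k₃ ∷ [])))
        +q ℕ→ℚ (2 * k₂) •q 𝔤ˢʰ
          (  ds (e (1 ∷ [])) (e (k₁ ∷ k₂+1 ∷ k₃ ∷ []))
          ⊖  ds (e (k₃ ∷ [])) (e (k₁ ∷ k₂+1 ∷ 1 ∷ [])))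
        +q ℕ→ℚ (2 * k₃) •q 𝔤ˢʰ
          (ds (e (1 ∷ [])) (e (k₁ ∷ k₂ ∷ k₃+1 ∷ [])))
      mod 𝒢ˢʰ≤ (k₁ + k₂ + k₃ + 1)

  depth₃ : ∀ a b c → 2 ≤ a → 2 ≤ b → 2 ≤ c →
               Depth₃ a b c (suc a) (suc b) (suc c)
  depth₃ a b c p q r = 𝒢ˢʰ-∼
    (∼-− (∼-d (a ∷ b ∷ c ∷ []) 3≤4)
      (∼-+ (∼-+ (∼-+
        (∼-2ν a (∼-𝔤ˢʰ (≏-⊕ (≏-ds 1 [] (suc a) (b ∷ c ∷ []) 4≤4) (≏-ds c [] b (suc a ∷ 1 ∷ []) 4≤4))))
        (∼-2ν a (∼-𝔤ˢʰ (≏-⊖ (≏-ds c [] (suc a + b) (1 ∷ []) 3≤4) (≏-ds (suc a) (1 ∷ []) b (c ∷ []) 4≤4)))))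
        (∼-2ν b (∼-𝔤ˢʰ (≏-⊖ (≏-ds 1 [] a (suc b ∷ c ∷ []) 4≤4) (≏-ds c [] a (suc b ∷ 1 ∷ []) 4≤4)))))
        (∼-2ν c (∼-𝔤ˢʰ (≏-ds 1 [] a (b ∷ suc c ∷ []) 4≤4)))))
    (Membership.depth₃ (a + b + c + 1) a b c p q r ≤-refl)

open import Data.Nat.Base using (ℕ; _+_; _*_; _≤_)
open import Data.List.Base using ([]; _∷_)
open import Data.Product.Base using (_×_)
open import Defs

theorem4p10 : ((k₁ k₂ : ℕ) → 2 ≤ k₁ → 2 ≤ k₂ →
    d (gˢʰ (k₁ ∷ k₂ ∷ []))
    ≡ ℕ→ℚ (2 * k₁) •q
    (  𝔤ˢʰ (ds (e (1 ∷ [])) (e (k₁ + 1 ∷ k₂ ∷ [])))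
    -q 𝔤ˢʰ (ds (e (k₂ ∷ [])) (e (k₁ + 1 ∷ 1 ∷ []))))
    +q ℕ→ℚ (2 * k₂) •q 𝔤ˢʰ (ds (e (1 ∷ [])) (e (k₁ ∷ k₂ + 1 ∷ [])))
    mod 𝒢ˢʰ≤ (k₁ + k₂ + 1))
    ×
    ((k₁ k₂ k₃ : ℕ) → 2 ≤ k₁ → 2 ≤ k₂ → 2 ≤ k₃ →
    d (gˢʰ (k₁ ∷ k₂ ∷ k₃ ∷ []))
    ≡ ℕ→ℚ (2 * k₁) •q 𝔤ˢʰ
    (  ds (e (1 ∷ [])) (e (k₁ + 1 ∷ k₂ ∷ k₃ ∷ []))
    ⊕  ds (e (k₃ ∷ [])) (e (k₂ ∷ k₁ + 1 ∷ 1 ∷ [])))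
    +q ℕ→ℚ (2 * k₁) •q 𝔤ˢʰ
    (  ds (e (k₃ ∷ [])) (e (k₁ + 1 + k₂ ∷ 1 ∷ []))
    ⊖  ds (e (k₁ + 1 ∷ 1 ∷ [])) (e (k₂ ∷ k₃ ∷ [])))
    +q ℕ→ℚ (2 * k₂) •q 𝔤ˢʰ
    (  ds (e (1 ∷ [])) (e (k₁ ∷ k₂ + 1 ∷ k₃ ∷ []))
    ⊖  ds (e (k₃ ∷ [])) (e (k₁ ∷ k₂ + 1 ∷ 1 ∷ [])))
    +q ℕ→ℚ (2 * k₃) •q 𝔤ˢʰ
    (ds (e (1 ∷ [])) (e (k₁ ∷ k₂ ∷ k₃ + 1 ∷ [])))
    mod 𝒢ˢʰ≤ (k₁ + k₂ + k₃ + 1))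
theorem4p10 =
  (λ k₁ k₂ p q → ≡.subst₂ (Depths.Depth₂ k₁ k₂) (ℕₚ.+-comm 1 k₁) (ℕₚ.+-comm 1 k₂) (Depths.depth₂ k₁ k₂ p q)) ,
  (λ k₁ k₂ k₃ p q r →
    ≡.subst₂ (λ k₁+1 k₂+1 → Depths.Depth₃ k₁ k₂ k₃ k₁+1 k₂+1 (k₃ + 1)) (ℕₚ.+-comm 1 k₁) (ℕₚ.+-comm 1 k₂)
      (≡.subst (Depths.Depth₃ k₁ k₂ k₃ (suc k₁) (suc k₂)) (ℕₚ.+-comm 1 k₃) (Depths.depth₃ k₁ k₂ k₃ p q r)))
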